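{- Let $n\in\mathbb{N}$, $r\in\mathbb{N}$, and let $\bm a=(a_1,\dots,a_r)$ and $\bm b=(b_1,\dots,b_r)$ be partitions of $n$ with $r$ parts such that $\bm b\succ\bm a$. Then for every integer $k\ge 3$, \[ p_k(\bm b)>p_k(\bm a). \]
   Context: A partition of $n$ with $r$ parts is an $r$-tuple $(n_1,\dots,n_r)\in\mathbb{N}^r$ with $1\le n_1\le n_2\le\cdots\le n_r$ and $\sum_j n_j=n$. For $k\in\mathbb{N}$, $p_k(m)$ denotes the number of $k$-coloured partitions of $m$, i.e. $\sum_{m\ge0}p_k(m)q^m=\prod_{j\ge1}(1-q^j)^{ -k}$, and for a tuple $\bm a=(a_1,\dots,a_r)$ one sets $p_k(\bm a):=p_k(a_1)p_k(a_2)\cdots p_k(a_r)$. For partitions $\bm a,\bm b$ of $n$ with $r$ parts, $\bm b$ majorizes $\bm a$, written $\bm b\succeq\bm a$, if $\sum_{j=1}^{\nu}a_j\le\sum_{j=1}^{\nu}b_j$ for all $\nu\in\{1,\dots,r-1\}$; one writes $\bm b\succ\bm a$ if $\bm b\succeq\bm a$ and $\bm a\neq\bm b$. -}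

module Defs where

open import Data.Nat using (ℕ; zero; suc; _+_; _*_; _∸_; _≤_; _<_; _≤ᵇ_)
open import Data.Bool using (if_then_else_)
open import Data.Fin using (Fin; toℕ; fromℕ<)
open import Data.Vec using (Vec; []; _∷_; lookup)
open import Data.List using (List; upTo; map)
open import Data.Nat.ListAction using (sum)
open import Data.Product using (_×_; Σ)
open import Relation.Binary.PropositionalEquality using (_≡_; _≢_)

-- pparts j m : number of partitions of m into parts of size ≤ j,
-- i.e. the coefficient of q^m in ∏_{i=1}^{j} (1 - q^i)^{-1}.
-- Recursion on j: sum over the multiplicity c of the part j+1.
pparts : ℕ → ℕ → ℕ
pparts zero zero = 1
pparts zero (suc m) = 0
pparts (suc j) m =
  sum (map (λ c → if c * suc j ≤ᵇ m then pparts j (m ∸ c * suc j) else 0) (upTo (suc m)))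

-- number of (ordinary) partitions of m: coefficient of q^m in ∏_{j≥1} (1-q^j)^{-1}
-- (parts of a partition of m are ≤ m, so truncating the product at j = m is exact).
p1 : ℕ → ℕ
p1 m = pparts m m

-- p k m : number of k-coloured partitions of m, the coefficient of q^m in
-- ∏_{j≥1} (1-q^j)^{-k} = (∏_{j≥1} (1-q^j)^{-1})^k, computed as k-fold
-- Cauchy product of the series Σ p1(m) q^m with itself (empty product = 1).
p : ℕ → ℕ → ℕ
p zero zero = 1
p zero (suc m) = 0
p (suc k) m = sum (map (λ i → p k i * p1 (m ∸ i)) (upTo (suc m)))

pVec : ℕ → ∀ {r} → Vec ℕ r → ℕ
pVec k [] = 1
pVec k (x ∷ xs) = p k x * pVec k xs

vsum : ∀ {r} → Vec ℕ r → ℕ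
vsum [] = 0
vsum (x ∷ xs) = x + vsum xs

psum : ∀ {r} → ℕ → Vec ℕ r → ℕ
psum zero _ = 0
psum (suc ν) [] = 0
psum (suc ν) (x ∷ xs) = x + psum ν xs

IsPartition : (n r : ℕ) → Vec ℕ r → Set
IsPartition n r a =
  ((i : Fin r) → 1 ≤ lookup a i)
  × ((i j : Fin r) → toℕ i ≤ toℕ j → lookup a i ≤ lookup a j)
  × vsum a ≡ n

Majorizes : ∀ {r} → Vec ℕ r → Vec ℕ r → Set
Majorizes {r} b a = (ν : ℕ) → 1 ≤ ν → ν ≤ r ∸ 1 → psum ν a ≤ psum ν b

StrictlyMajorizes : ∀ {r} → Vec ℕ r → Vec ℕ r → Set
StrictlyMajorizes b a = Majorizes b a × (a ≢ b)

{-# OPTIONS --safe #-}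
-- A power-series proof of strict log-concavity of p_k for k = 3, 4, 5; a product of log-concave series is log-concave by Binet–Cauchy,
-- which covers all k ≥ 3, and majorization then reduces to unit transfers between two entries.
--
-- Let f be the generating function of p_k, fᵢ = (1-q)ⁱ f, u = f₁ and v = f₂. The logarithmic derivative of f₂ gives
-- n f₂(n) = k Σ_x T(x) f₄(n-x) - 2 f₁(n-1), where T(x) = Σ_{de≤x} d (x+1-de). An elementary splitting of this divisor sum yields
-- T(x) = ζ(2) X³/6 - β X² + O(X), X = x+1, where β varies with x in a short interval around 1/4. Since f₄ ≥ 0 (up to one coefficient if k = 3),
-- f is squeezed between two second-order difference inequalities n v ≈ k ζ(2) f - b u. Log-concavity holds while u/f stays
-- above the positive root of n y² + b y = k ζ(2), and that root is a barrier for the recursion as soon as the interval for b is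
-- shorter than 1/2. The values for small n are computed.

module Submission where

open import Defs
open import Data.Nat using (ℕ; _≤_; _<_)
open import Data.Vec using (Vec)
open import Data.Bool using (if_then_else_)
open import Data.Empty using (⊥-elim)
open import Data.Fin using (zero; suc; toℕ)
open import Data.Integer using (ℤ; +_; 0ℤ; 1ℤ; _+_; _*_; _-_; -_) renaming (_≤_ to _≤ℤ_; _<_ to _<ℤ_)
open import Data.Integer.Tactic.RingSolver using (solve-∀)
open import Data.List using (List; []; _∷_; _++_; map; replicate; upTo; applyUpTo)
open import Data.List.Properties using (map-applyUpTo)
open import Data.Nat using (zero; suc; z≤n; s≤s; >-nonZero; _≤ᵇ_; _!) renaming (_+_ to _+ℕ_; _*_ to _*ℕ_; _∸_ to _∸ℕ_)
open import Data.Nat.Divisibility using (∣-trans; m∣m*n; m≤n⇒m!∣n!)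
open import Data.Nat.DivMod using (_/_; _%_; m≡m%n+[m/n]*n; m%n<n; m/n*n≡m; m/n≤m; /-monoˡ-≤)
open import Data.Nat.ListAction using (sum)
open import Data.Nat.Tactic.RingSolver using () renaming (solve-∀ to solve-∀ℕ)
open import Data.Product using (_×_; _,_; proj₁; proj₂; Σ)
open import Data.Sum using (_⊎_; inj₁; inj₂)
open import Data.Unit using (tt)
open import Data.Vec using ([]; _∷_; lookup)
open import Function using (_∘_; id)
open import Relation.Binary.PropositionalEquality using (_≡_; refl; sym; trans; cong; cong₂; subst; subst₂; module ≡-Reasoning)
open import Relation.Nullary using (Dec; yes; no)
open import Relation.Nullary.Decidable using (toWitness; _×-dec_)
import Data.Integer as ℤ
import Data.Integer.Properties as ℤ
import Data.Nat.Properties as ℕ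

open ≡-Reasoning

-- The differences f₂ and f₄ are matched to T: X³, X² and X are combinations of the coefficients of
-- q(1-q)⁻⁴, (1-q)⁻³ and (1-q)⁻². A pointwise comparison of T with a cubic polynomial, convolved
-- with f₄, therefore becomes a linear inequality between f, f₁ and f₂ alone; the price is that f₄
-- needs a sign. The interval for β comes from cutting the sum of d (y - d e), y = X, at e = E =
-- ⌊y/4⌋. Up to O(y), the terms with e ≤ E give ζ(2) y³/6 - 2y²/3 with an error between -y²/24 and
-- -7y²/768; those with e > E involve only d = 1, 2, 3 and add 7y²/16. So β stays between 183/768
-- and 13/48, inside the bracket from 56/240 to 66/240 that is proved. Everything is done in
-- integers: the product is cut off at a part size not below the index under study, and ζ(2) is
-- replaced by a fraction that depends on the cutoff. Parts are listed in increasing order, so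
-- larger prefix sums mean a more balanced tuple. This is why log-concavity is the property that
-- makes b win.

+-congˡ : ∀ a {b c} → b ≡ c → a + b ≡ a + c
+-congˡ a = cong (λ t → a + t)

-- Signs of integer expressions

0≤+ : ∀ n → 0ℤ ≤ℤ + n
0≤+ n = ℤ.+≤+ z≤n

+-nonneg : ∀ {a b} → 0ℤ ≤ℤ a → 0ℤ ≤ℤ b → 0ℤ ≤ℤ a + b
+-nonneg = ℤ.+-mono-≤

*-nonneg : ∀ {a b} → 0ℤ ≤ℤ a → 0ℤ ≤ℤ b → 0ℤ ≤ℤ a * b
*-nonneg {+ a} {+ b} _ _ = subst (0ℤ ≤ℤ_) (ℤ.pos-* a b) (0≤+ _)
*-nonneg {+ _} {ℤ.-[1+ _ ]} _ ()
*-nonneg {ℤ.-[1+ _ ]} ()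

-- The pattern behind most inequalities below: `b` is assembled from visibly nonnegative pieces, and
-- a polynomial identity identifies it with `a`. `posit` is the strict counterpart.
nonneg : ∀ {a b} → 0ℤ ≤ℤ b → a ≡ b → 0ℤ ≤ℤ a
nonneg p refl = p

to-nonneg : ∀ {a b} → a ≤ℤ b → 0ℤ ≤ℤ b - a
to-nonneg = ℤ.i≤j⇒0≤j-i

from-nonneg : ∀ {a b} → 0ℤ ≤ℤ b - a → a ≤ℤ b
from-nonneg = ℤ.0≤i-j⇒j≤i

*-cancel-nonneg : ∀ {a b} → 0ℤ <ℤ a → 0ℤ ≤ℤ a * b → 0ℤ ≤ℤ b
*-cancel-nonneg {+ suc a} {b} _ p =
  ℤ.*-cancelˡ-≤-pos 0ℤ b (+ suc a) (subst (_≤ℤ + suc a * b) (sym (ℤ.*-zeroʳ (+ suc a))) p)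
*-cancel-nonneg {+ zero} (ℤ.+<+ ())
*-cancel-nonneg {ℤ.-[1+ _ ]} ()

*-pos : ∀ {a b} → 0ℤ <ℤ a → 0ℤ <ℤ b → 0ℤ <ℤ a * b
*-pos {+ suc a} {+ suc b} _ _ = ℤ.+<+ (s≤s z≤n)
*-pos {+ suc _} {+ zero} _ (ℤ.+<+ ())
*-pos {+ suc _} {ℤ.-[1+ _ ]} _ ()
*-pos {+ zero} (ℤ.+<+ ())
*-pos {ℤ.-[1+ _ ]} ()

*-cancel-pos : ∀ {a b} → 0ℤ ≤ℤ a → 0ℤ <ℤ a * b → 0ℤ <ℤ b
*-cancel-pos {a} {b} p q = ℤ.*-cancelˡ-<-nonNeg a {{ℤ.nonNegative p}}
  (subst (_<ℤ a * b) (sym (ℤ.*-zeroʳ a)) q)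

+-pos : ∀ {a b} → 0ℤ <ℤ a → 0ℤ ≤ℤ b → 0ℤ <ℤ a + b
+-pos = ℤ.+-mono-<-≤

to-pos : ∀ {a b} → a <ℤ b → 0ℤ <ℤ b - a
to-pos {a} {b} p = subst (_<ℤ b - a) (ℤ.+-inverseʳ a) (ℤ.+-monoˡ-< (- a) p)

from-pos : ∀ {a b} → 0ℤ <ℤ b - a → a <ℤ b
from-pos {a} {b} p = subst₂ _<ℤ_ (ℤ.+-identityˡ a) (e a b) (ℤ.+-monoˡ-< a p)
  where
  e : ∀ a b → b - a + a ≡ b
  e = solve-∀

posit : ∀ {a b} → 0ℤ <ℤ b → a ≡ b → 0ℤ <ℤ a
posit p refl = p

square-nonneg : ∀ x → 0ℤ ≤ℤ x * x
square-nonneg (+ n) = *-nonneg (0≤+ n) (0≤+ n)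
square-nonneg ℤ.-[1+ n ] = 0≤+ _

-- One step of Horner's scheme. Nested, it certifies the sign of polynomials whose coefficients have
-- been made nonnegative by a substitution.
horner : ∀ {c t p} → 0ℤ ≤ℤ c → 0ℤ ≤ℤ t → 0ℤ ≤ℤ p → 0ℤ ≤ℤ c + t * p
horner c≥0 t≥0 p≥0 = +-nonneg c≥0 (*-nonneg t≥0 p≥0)

-- An equation enters a polynomial identity as a multiple of the difference of its sides; this
-- discards that multiple.
+-vanish : ∀ a b {x} → x ≡ 0ℤ → a + b * x ≡ a
+-vanish a b refl = trans (cong (λ t → a + t) (ℤ.*-zeroʳ b)) (ℤ.+-identityʳ a)

-- Finite sums of integers

∑ : ℕ → (ℕ → ℤ) → ℤ
∑ zero f = 0ℤ
∑ (suc n) f = ∑ n f + f n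

∑-cong< : ∀ n {f g} → (∀ i → i < n → f i ≡ g i) → ∑ n f ≡ ∑ n g
∑-cong< zero h = refl
∑-cong< (suc n) h = cong₂ _+_ (∑-cong< n λ i i<n → h i (ℕ.m<n⇒m<1+n i<n)) (h n ℕ.≤-refl)

∑-cong : ∀ n {f g} → (∀ i → f i ≡ g i) → ∑ n f ≡ ∑ n g
∑-cong n h = ∑-cong< n λ i _ → h i

∑-zero : ∀ n {f} → (∀ i → i < n → f i ≡ 0ℤ) → ∑ n f ≡ 0ℤ
∑-zero zero h = refl
∑-zero (suc n) h = cong₂ _+_ (∑-zero n λ i i<n → h i (ℕ.m<n⇒m<1+n i<n)) (h n ℕ.≤-refl)

∑-+ : ∀ n f g → ∑ n (λ i → f i + g i) ≡ ∑ n f + ∑ n g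
∑-+ zero f g = refl
∑-+ (suc n) f g = trans (cong (_+ (f n + g n)) (∑-+ n f g)) (e (∑ n f) (∑ n g) (f n) (g n))
  where
  e : ∀ a b c d → a + b + (c + d) ≡ a + c + (b + d)
  e = solve-∀

∑-*ˡ : ∀ n c f → ∑ n (λ i → c * f i) ≡ c * ∑ n f
∑-*ˡ zero c f = sym (ℤ.*-zeroʳ c)
∑-*ˡ (suc n) c f = trans (cong (_+ c * f n) (∑-*ˡ n c f)) (sym (ℤ.*-distribˡ-+ c (∑ n f) (f n)))

∑-swap : ∀ m n (f : ℕ → ℕ → ℤ) → ∑ m (λ i → ∑ n (f i)) ≡ ∑ n (λ j → ∑ m (λ i → f i j))
∑-swap zero n f = sym (∑-zero n λ _ _ → refl)
∑-swap (suc m) n f = trans (cong (_+ ∑ n (f m)) (∑-swap m n f)) (sym (∑-+ n (λ j → ∑ m (λ i → f i j)) (f m)))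

∑-head : ∀ n f → ∑ (suc n) f ≡ f 0 + ∑ n (f ∘ suc)
∑-head zero f = ℤ.+-comm 0ℤ (f 0)
∑-head (suc n) f = trans (cong (_+ f (suc n)) (∑-head n f)) (ℤ.+-assoc (f 0) (∑ n (f ∘ suc)) (f (suc n)))

∑-split : ∀ m n f → ∑ (m +ℕ n) f ≡ ∑ m f + ∑ n (λ i → f (m +ℕ i))
∑-split m zero f = trans (cong (λ k → ∑ k f) (ℕ.+-identityʳ m)) (sym (ℤ.+-identityʳ _))
∑-split m (suc n) f = begin
  ∑ (m +ℕ suc n) f                                   ≡⟨ cong (λ k → ∑ k f) (ℕ.+-suc m n) ⟩
  ∑ (m +ℕ n) f + f (m +ℕ n)                          ≡⟨ cong (_+ f (m +ℕ n)) (∑-split m n f) ⟩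
  ∑ m f + ∑ n (λ i → f (m +ℕ i)) + f (m +ℕ n)        ≡⟨ ℤ.+-assoc (∑ m f) _ _ ⟩
  ∑ m f + (∑ n (λ i → f (m +ℕ i)) + f (m +ℕ n))      ∎

∑-extend : ∀ {m n} f → m ≤ n → (∀ i → m ≤ i → f i ≡ 0ℤ) → ∑ n f ≡ ∑ m f
∑-extend {m} {n} f m≤n z = begin
  ∑ n f                                        ≡⟨ cong (λ k → ∑ k f) (sym (ℕ.m+[n∸m]≡n m≤n)) ⟩
  ∑ (m +ℕ (n ∸ℕ m)) f                          ≡⟨ ∑-split m (n ∸ℕ m) f ⟩
  ∑ m f + ∑ (n ∸ℕ m) (λ i → f (m +ℕ i))        ≡⟨ +-congˡ (∑ m f) (∑-zero (n ∸ℕ m) λ i _ → z (m +ℕ i) (ℕ.m≤m+n m i)) ⟩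
  ∑ m f + 0ℤ                                   ≡⟨ ℤ.+-identityʳ _ ⟩
  ∑ m f                                        ∎

∑-nonneg : ∀ n {f} → (∀ i → i < n → 0ℤ ≤ℤ f i) → 0ℤ ≤ℤ ∑ n f
∑-nonneg zero h = ℤ.≤-refl
∑-nonneg (suc n) h = +-nonneg (∑-nonneg n λ i i<n → h i (ℕ.m<n⇒m<1+n i<n)) (h n ℕ.≤-refl)

-- Power series; sh is multiplication by q, shift d by q^d, and geo d is division by 1 - q^d (for d ≥ 1).

Series : Set
Series = ℕ → ℤ

δ₀ : Series
δ₀ zero = 1ℤ
δ₀ (suc _) = 0ℤ

sh : Series → Series
sh a zero = 0ℤ
sh a (suc n) = a n

shift : ℕ → Series → Series
shift zero a = a
shift (suc d) a = sh (shift d a)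

geo : ℕ → Series → Series
geo d a n = ∑ (suc n) λ c → shift (c *ℕ d) a n

sh-cong : ∀ {a b} → (∀ n → a n ≡ b n) → ∀ n → sh a n ≡ sh b n
sh-cong h zero = refl
sh-cong h (suc n) = h n

shift-cong : ∀ d {a b} → (∀ n → a n ≡ b n) → ∀ n → shift d a n ≡ shift d b n
shift-cong zero h = h
shift-cong (suc d) h = sh-cong (shift-cong d h)

shift-cong< : ∀ d {a b} n → (∀ m → m < n → a m ≡ b m) → shift (suc d) a n ≡ shift (suc d) b n
shift-cong< d zero h = refl
shift-cong< zero (suc n) h = h n ℕ.≤-refl
shift-cong< (suc d) (suc n) h = shift-cong< d n λ m m<n → h m (ℕ.m<n⇒m<1+n m<n)

shift-zero : ∀ d a {n} → n < d → shift d a n ≡ 0ℤ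
shift-zero (suc d) a {zero} _ = refl
shift-zero (suc d) a {suc n} (s≤s p) = shift-zero d a p

shift-0 : ∀ d n → shift d (λ _ → 0ℤ) n ≡ 0ℤ
shift-0 zero n = refl
shift-0 (suc d) zero = refl
shift-0 (suc d) (suc n) = shift-0 d n

shift-+ : ∀ d e a n → shift (d +ℕ e) a n ≡ shift d (shift e a) n
shift-+ zero e a n = refl
shift-+ (suc d) e a = sh-cong (shift-+ d e a)

sh-add : ∀ a b n → sh (λ m → a m + b m) n ≡ sh a n + sh b n
sh-add a b zero = refl
sh-add a b (suc n) = refl

shift-add : ∀ d a b n → shift d (λ m → a m + b m) n ≡ shift d a n + shift d b n
shift-add zero a b n = refl
shift-add (suc d) a b n = trans (sh-cong (shift-add d a b) n) (sh-add (shift d a) (shift d b) n)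

shift-scale : ∀ d c a n → shift d (λ m → c * a m) n ≡ c * shift d a n
shift-scale zero c a n = refl
shift-scale (suc d) c a zero = sym (ℤ.*-zeroʳ c)
shift-scale (suc d) c a (suc n) = shift-scale d c a n

shift-comm : ∀ d e a n → shift d (shift e a) n ≡ shift e (shift d a) n
shift-comm d e a n = begin
  shift d (shift e a) n   ≡⟨ sym (shift-+ d e a n) ⟩
  shift (d +ℕ e) a n      ≡⟨ cong (λ k → shift k a n) (ℕ.+-comm d e) ⟩
  shift (e +ℕ d) a n      ≡⟨ shift-+ e d a n ⟩
  shift e (shift d a) n   ∎

-- The range of the inner sum depends on the coefficient index, so shifting shortens it. As the
-- terms above the diagonal vanish, it can be extended again to the fixed range `n`.
shift-∑ : ∀ d (G : ℕ → Series) → (∀ c j → j < c → G c j ≡ 0ℤ) →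
  ∀ n → shift (suc d) (λ m → ∑ (suc m) (λ c → G c m)) n ≡ ∑ n (λ c → shift (suc d) (G c) n)
shift-∑ d G z zero = refl
shift-∑ zero G z (suc n) = refl
shift-∑ (suc d) G z (suc n) = begin
  shift (suc d) (λ m → ∑ (suc m) (λ c → G c m)) n                ≡⟨ shift-∑ d G z n ⟩
  ∑ n (λ c → shift (suc d) (G c) n)                              ≡⟨ sym (ℤ.+-identityʳ _) ⟩
  ∑ n (λ c → shift (suc d) (G c) n) + 0ℤ                         ≡⟨ cong (λ t → ∑ n (λ c → shift (suc d) (G c) n) + t) (sym last) ⟩
  ∑ (suc n) (λ c → shift (suc d) (G c) n)                        ∎
  where
  last : shift (suc d) (G n) n ≡ 0ℤ
  last = trans (shift-cong< d n λ m m<n → z n m m<n) (shift-0 (suc d) n)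

multiples-zero : ∀ d a c j → j < c → shift (c *ℕ suc d) a j ≡ 0ℤ
multiples-zero d a c j j<c = shift-zero (c *ℕ suc d) a (ℕ.≤-trans j<c (ℕ.m≤m*n c (suc d)))

shift-geo : ∀ d a n → shift (suc d) (geo (suc d) a) n ≡ ∑ n (λ c → shift (suc c *ℕ suc d) a n)
shift-geo d a n = trans (shift-∑ d (λ c → shift (c *ℕ suc d) a) (multiples-zero d a) n)
  (∑-cong n λ c → sym (shift-+ (suc d) (c *ℕ suc d) a n))

geo-unfold : ∀ d a n → geo (suc d) a n ≡ a n + shift (suc d) (geo (suc d) a) n
geo-unfold d a n = trans (∑-head n λ c → shift (c *ℕ suc d) a n) (+-congˡ (a n) (sym (shift-geo d a n)))

<-induction : (P : ℕ → Set) → (∀ n → (∀ m → m < n → P m) → P n) → ∀ n → P n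
<-induction P step n = go (suc n) n ℕ.≤-refl
  where
  go : ∀ b m → m < b → P m
  go (suc b) m (s≤s m≤b) = step m λ j j<m → go b j (ℕ.≤-trans j<m m≤b)

-- A positive shift looks only at smaller indices, so the recursion has a single solution. The laws
-- that relate `geo` to shifts, to other factors, to products and to `θ` are all proved by checking
-- this recursion, not by rearranging double sums.
geo-unique : ∀ d {a b} → (∀ n → b n ≡ a n + shift (suc d) b n) → ∀ n → b n ≡ geo (suc d) a n
geo-unique d {a} {b} h = <-induction (λ n → b n ≡ geo (suc d) a n) λ n ih → begin
  b n                                   ≡⟨ h n ⟩
  a n + shift (suc d) b n               ≡⟨ +-congˡ (a n) (shift-cong< d n ih) ⟩
  a n + shift (suc d) (geo (suc d) a) n ≡⟨ sym (geo-unfold d a n) ⟩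
  geo (suc d) a n                       ∎

geo-cong : ∀ d {a b} → (∀ n → a n ≡ b n) → ∀ n → geo d a n ≡ geo d b n
geo-cong d h n = ∑-cong (suc n) λ c → shift-cong (c *ℕ d) h n

geo-add : ∀ d a b n → geo d (λ m → a m + b m) n ≡ geo d a n + geo d b n
geo-add d a b n = trans (∑-cong (suc n) λ c → shift-add (c *ℕ d) a b n) (∑-+ (suc n) _ _)

geo-scale : ∀ d c a n → geo d (λ m → c * a m) n ≡ c * geo d a n
geo-scale d c a n = trans (∑-cong (suc n) λ i → shift-scale (i *ℕ d) c a n) (∑-*ˡ (suc n) c _)

geo-shift : ∀ d e a n → geo (suc d) (shift e a) n ≡ shift e (geo (suc d) a) n
geo-shift d e a n = sym (geo-unique d {shift e a} {shift e (geo (suc d) a)} eq n)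
  where
  eq : ∀ n → shift e (geo (suc d) a) n ≡ shift e a n + shift (suc d) (shift e (geo (suc d) a)) n
  eq n = begin
    shift e (geo (suc d) a) n                                        ≡⟨ shift-cong e (geo-unfold d a) n ⟩
    shift e (λ m → a m + shift (suc d) (geo (suc d) a) m) n          ≡⟨ shift-add e a _ n ⟩
    shift e a n + shift e (shift (suc d) (geo (suc d) a)) n          ≡⟨ +-congˡ (shift e a n) (shift-comm e (suc d) _ n) ⟩
    shift e a n + shift (suc d) (shift e (geo (suc d) a)) n          ∎

geo-comm : ∀ d e a n → geo (suc d) (geo (suc e) a) n ≡ geo (suc e) (geo (suc d) a) n
geo-comm d e a n = sym (geo-unique d {geo (suc e) a} {geo (suc e) (geo (suc d) a)} eq n)
  where
  eq : ∀ n → geo (suc e) (geo (suc d) a) n ≡ geo (suc e) a n + shift (suc d) (geo (suc e) (geo (suc d) a)) n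
  eq n = begin
    geo (suc e) (geo (suc d) a) n                                            ≡⟨ geo-cong (suc e) (geo-unfold d a) n ⟩
    geo (suc e) (λ m → a m + shift (suc d) (geo (suc d) a) m) n              ≡⟨ geo-add (suc e) a _ n ⟩
    geo (suc e) a n + geo (suc e) (shift (suc d) (geo (suc d) a)) n          ≡⟨ +-congˡ (geo (suc e) a n) (geo-shift e (suc d) _ n) ⟩
    geo (suc e) a n + shift (suc d) (geo (suc e) (geo (suc d) a)) n          ∎

shift-nonneg : ∀ d {a} → (∀ n → 0ℤ ≤ℤ a n) → ∀ n → 0ℤ ≤ℤ shift d a n
shift-nonneg zero h n = h n
shift-nonneg (suc d) h zero = ℤ.≤-refl
shift-nonneg (suc d) h (suc n) = shift-nonneg d h n

geo-nonneg : ∀ d {a} → (∀ n → 0ℤ ≤ℤ a n) → ∀ n → 0ℤ ≤ℤ geo d a n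
geo-nonneg d h n = ∑-nonneg (suc n) λ c _ → shift-nonneg (c *ℕ d) h n

-- The Cauchy product

conv : Series → Series → Series
conv a b n = ∑ (suc n) λ i → a i * b (n ∸ℕ i)

conv-suc : ∀ a b n → conv a b (suc n) ≡ a 0 * b (suc n) + conv (a ∘ suc) b n
conv-suc a b n = ∑-head (suc n) λ i → a i * b (suc n ∸ℕ i)

conv-congˡ : ∀ {a a'} b → (∀ n → a n ≡ a' n) → ∀ n → conv a b n ≡ conv a' b n
conv-congˡ b h n = ∑-cong (suc n) λ i → cong (_* b (n ∸ℕ i)) (h i)

conv-congʳ : ∀ a {b b'} → (∀ n → b n ≡ b' n) → ∀ n → conv a b n ≡ conv a b' n
conv-congʳ a h n = ∑-cong (suc n) λ i → cong (λ t → a i * t) (h (n ∸ℕ i))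

conv-shˡ : ∀ a b n → conv (sh a) b n ≡ sh (conv a b) n
conv-shˡ a b zero = e (b 0)
  where
  e : ∀ x → 0ℤ + 0ℤ * x ≡ 0ℤ
  e = solve-∀
conv-shˡ a b (suc n) = trans (conv-suc (sh a) b n) (e (b (suc n)) (conv a b n))
  where
  e : ∀ x y → 0ℤ * x + y ≡ y
  e = solve-∀

conv-shʳ : ∀ a b n → conv a (sh b) n ≡ sh (conv a b) n
conv-shʳ a b zero = e (a 0)
  where
  e : ∀ x → 0ℤ + x * 0ℤ ≡ 0ℤ
  e = solve-∀
conv-shʳ a b (suc zero) = e (a 0) (a 1) (b 0)
  where
  e : ∀ x y z → 0ℤ + x * z + y * 0ℤ ≡ 0ℤ + x * z
  e = solve-∀
conv-shʳ a b (suc (suc n)) = trans (conv-suc a (sh b) (suc n))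
  (trans (+-congˡ (a 0 * b (suc n)) (conv-shʳ (a ∘ suc) b (suc n))) (sym (conv-suc a b n)))

conv-shiftˡ : ∀ d a b n → conv (shift d a) b n ≡ shift d (conv a b) n
conv-shiftˡ zero a b n = refl
conv-shiftˡ (suc d) a b n = trans (conv-shˡ (shift d a) b n) (sh-cong (conv-shiftˡ d a b) n)

conv-shiftʳ : ∀ d a b n → conv a (shift d b) n ≡ shift d (conv a b) n
conv-shiftʳ zero a b n = refl
conv-shiftʳ (suc d) a b n = trans (conv-shʳ a (shift d b) n) (sh-cong (conv-shiftʳ d a b) n)

conv-addˡ : ∀ a a' b n → conv (λ m → a m + a' m) b n ≡ conv a b n + conv a' b n
conv-addˡ a a' b n = trans (∑-cong (suc n) λ i → ℤ.*-distribʳ-+ (b (n ∸ℕ i)) (a i) (a' i)) (∑-+ (suc n) _ _)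

conv-addʳ : ∀ a b b' n → conv a (λ m → b m + b' m) n ≡ conv a b n + conv a b' n
conv-addʳ a b b' n = trans (∑-cong (suc n) λ i → ℤ.*-distribˡ-+ (a i) (b (n ∸ℕ i)) (b' (n ∸ℕ i))) (∑-+ (suc n) _ _)

conv-scaleˡ : ∀ c a b n → conv (λ m → c * a m) b n ≡ c * conv a b n
conv-scaleˡ c a b n = trans (∑-cong (suc n) λ i → ℤ.*-assoc c (a i) (b (n ∸ℕ i))) (∑-*ˡ (suc n) c _)

conv-geoˡ : ∀ d a b n → conv (geo (suc d) a) b n ≡ geo (suc d) (conv a b) n
conv-geoˡ d a b = geo-unique d λ n → begin
  conv (geo (suc d) a) b n                                              ≡⟨ conv-congˡ b (geo-unfold d a) n ⟩
  conv (λ m → a m + shift (suc d) (geo (suc d) a) m) b n                ≡⟨ conv-addˡ a _ b n ⟩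
  conv a b n + conv (shift (suc d) (geo (suc d) a)) b n                 ≡⟨ +-congˡ (conv a b n) (conv-shiftˡ (suc d) _ b n) ⟩
  conv a b n + shift (suc d) (conv (geo (suc d) a) b) n                 ∎

conv-geoʳ : ∀ d a b n → conv a (geo (suc d) b) n ≡ geo (suc d) (conv a b) n
conv-geoʳ d a b = geo-unique d λ n → begin
  conv a (geo (suc d) b) n                                              ≡⟨ conv-congʳ a (geo-unfold d b) n ⟩
  conv a (λ m → b m + shift (suc d) (geo (suc d) b) m) n                ≡⟨ conv-addʳ a b (shift (suc d) (geo (suc d) b)) n ⟩
  conv a b n + conv a (shift (suc d) (geo (suc d) b)) n                 ≡⟨ +-congˡ (conv a b n) (conv-shiftʳ (suc d) a _ n) ⟩
  conv a b n + shift (suc d) (conv a (geo (suc d) b)) n                 ∎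

conv-δˡ : ∀ b n → conv δ₀ b n ≡ b n
conv-δˡ b zero = trans (ℤ.+-identityˡ _) (ℤ.*-identityˡ (b 0))
conv-δˡ b (suc n) = begin
  conv δ₀ b (suc n)                              ≡⟨ conv-suc δ₀ b n ⟩
  1ℤ * b (suc n) + conv (λ _ → 0ℤ) b n           ≡⟨ cong₂ _+_ (ℤ.*-identityˡ (b (suc n))) (∑-zero (suc n) λ _ _ → refl) ⟩
  b (suc n) + 0ℤ                                 ≡⟨ ℤ.+-identityʳ _ ⟩
  b (suc n)                                      ∎

conv-δʳ : ∀ a n → conv a δ₀ n ≡ a n
conv-δʳ a zero = trans (ℤ.+-identityˡ _) (ℤ.*-identityʳ (a 0))
conv-δʳ a (suc n) = begin
  conv a δ₀ (suc n)                              ≡⟨ conv-suc a δ₀ n ⟩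
  a 0 * 0ℤ + conv (a ∘ suc) δ₀ n                 ≡⟨ cong₂ _+_ (ℤ.*-zeroʳ (a 0)) (conv-δʳ (a ∘ suc) n) ⟩
  0ℤ + a (suc n)                                 ≡⟨ ℤ.+-identityˡ _ ⟩
  a (suc n)                                      ∎

conv-nonneg : ∀ {a b} n → (∀ i → i ≤ n → 0ℤ ≤ℤ a i) → (∀ i → i ≤ n → 0ℤ ≤ℤ b i) → 0ℤ ≤ℤ conv a b n
conv-nonneg n h k = ∑-nonneg (suc n) λ { i (s≤s i≤n) → *-nonneg (h i i≤n) (k (n ∸ℕ i) (ℕ.m∸n≤m n i)) }

-- Products of factors 1/(1 - q^(d+1)) for d in a list; dlog L is multiplication by the logarithmic derivative of prod L.

prod : List ℕ → Series
prod [] = δ₀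
prod (d ∷ L) = geo (suc d) (prod L)

dlog : List ℕ → Series → Series
dlog [] a n = 0ℤ
dlog (d ∷ L) a n = + suc d * shift (suc d) (geo (suc d) a) n + dlog L a n

-- The operator q d/dq.
θ : Series → Series
θ a n = + n * a n

shift-θ : ∀ d a n → + n * shift d a n ≡ shift d (θ a) n + + d * shift d a n
shift-θ zero a n = sym (ℤ.+-identityʳ _)
shift-θ (suc d) a zero = sym (trans (ℤ.+-identityˡ _) (ℤ.*-zeroʳ (+ suc d)))
shift-θ (suc d) a (suc n) = begin
  + suc n * shift d a n                                      ≡⟨ cong (_* shift d a n) (ℤ.pos-+ 1 n) ⟩
  (1ℤ + + n) * shift d a n                                   ≡⟨ e₁ (+ n) (shift d a n) ⟩
  + n * shift d a n + shift d a n                            ≡⟨ cong (_+ shift d a n) (shift-θ d a n) ⟩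
  shift d (θ a) n + + d * shift d a n + shift d a n          ≡⟨ e₂ (shift d (θ a) n) (+ d) (shift d a n) ⟩
  shift d (θ a) n + (1ℤ + + d) * shift d a n                 ≡⟨ cong (λ t → shift d (θ a) n + t * shift d a n) (sym (ℤ.pos-+ 1 d)) ⟩
  shift d (θ a) n + + suc d * shift d a n                    ∎
  where
  e₁ : ∀ n x → (1ℤ + n) * x ≡ n * x + x
  e₁ = solve-∀
  e₂ : ∀ y d x → y + d * x + x ≡ y + (1ℤ + d) * x
  e₂ = solve-∀

-- The quotient rule for a/(1 - q^(d+1)), obtained by applying `θ` to the recursion that defines the
-- quotient.
geo-θ : ∀ d a n → θ (geo (suc d) a) n ≡ geo (suc d) (θ a) n + + suc d * shift (suc d) (geo (suc d) (geo (suc d) a)) n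
geo-θ d a n = begin
  θ g n                                                               ≡⟨ geo-unique d {λ m → θ a m + + suc d * shift (suc d) g m} {θ g} eq n ⟩
  geo (suc d) (λ m → θ a m + + suc d * shift (suc d) g m) n           ≡⟨ geo-add (suc d) (θ a) _ n ⟩
  geo (suc d) (θ a) n + geo (suc d) (λ m → + suc d * shift (suc d) g m) n
    ≡⟨ +-congˡ (geo (suc d) (θ a) n) (geo-scale (suc d) (+ suc d) (shift (suc d) g) n) ⟩
  geo (suc d) (θ a) n + + suc d * geo (suc d) (shift (suc d) g) n
    ≡⟨ cong (λ t → geo (suc d) (θ a) n + + suc d * t) (geo-shift d (suc d) g n) ⟩
  geo (suc d) (θ a) n + + suc d * shift (suc d) (geo (suc d) g) n     ∎
  where
  g : Series
  g = geo (suc d) a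
  e : ∀ x y D z → x + (y + D * z) ≡ (x + D * z) + y
  e = solve-∀
  eq : ∀ n → θ g n ≡ (θ a n + + suc d * shift (suc d) g n) + shift (suc d) (θ g) n
  eq n = begin
    + n * g n                                                     ≡⟨ cong (λ t → + n * t) (geo-unfold d a n) ⟩
    + n * (a n + shift (suc d) g n)                               ≡⟨ ℤ.*-distribˡ-+ (+ n) (a n) _ ⟩
    + n * a n + + n * shift (suc d) g n                           ≡⟨ +-congˡ (+ n * a n) (shift-θ (suc d) g n) ⟩
    + n * a n + (shift (suc d) (θ g) n + + suc d * shift (suc d) g n)
      ≡⟨ e (θ a n) (shift (suc d) (θ g) n) (+ suc d) (shift (suc d) g n) ⟩
    (θ a n + + suc d * shift (suc d) g n) + shift (suc d) (θ g) n ∎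

geo-zero : ∀ d n → geo d (λ _ → 0ℤ) n ≡ 0ℤ
geo-zero d n = ∑-zero (suc n) λ c _ → shift-0 (c *ℕ d) n

geo-dlog : ∀ e L a n → geo (suc e) (dlog L a) n ≡ dlog L (geo (suc e) a) n
geo-dlog e [] a n = geo-zero (suc e) n
geo-dlog e (d ∷ L) a n = begin
  geo (suc e) (λ m → + suc d * shift (suc d) (geo (suc d) a) m + dlog L a m) n
    ≡⟨ geo-add (suc e) _ (dlog L a) n ⟩
  geo (suc e) (λ m → + suc d * shift (suc d) (geo (suc d) a) m) n + geo (suc e) (dlog L a) n
    ≡⟨ cong₂ _+_ (geo-scale (suc e) (+ suc d) _ n) (geo-dlog e L a n) ⟩
  + suc d * geo (suc e) (shift (suc d) (geo (suc d) a)) n + dlog L (geo (suc e) a) n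
    ≡⟨ cong (λ t → + suc d * t + dlog L (geo (suc e) a) n) (trans (geo-shift e (suc d) _ n) (shift-cong (suc d) (geo-comm e d a) n)) ⟩
  + suc d * shift (suc d) (geo (suc d) (geo (suc e) a)) n + dlog L (geo (suc e) a) n ∎

θ-prod : ∀ L n → θ (prod L) n ≡ dlog L (prod L) n
θ-prod [] zero = refl
θ-prod [] (suc n) = ℤ.*-zeroʳ (+ suc n)
θ-prod (d ∷ L) n = begin
  θ (geo (suc d) (prod L)) n
    ≡⟨ geo-θ d (prod L) n ⟩
  geo (suc d) (θ (prod L)) n + + suc d * shift (suc d) (geo (suc d) (prod (d ∷ L))) n
    ≡⟨ cong (_+ + suc d * shift (suc d) (geo (suc d) (prod (d ∷ L))) n) (trans (geo-cong (suc d) (θ-prod L) n) (geo-dlog d L (prod L) n)) ⟩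
  dlog L (prod (d ∷ L)) n + + suc d * shift (suc d) (geo (suc d) (prod (d ∷ L))) n
    ≡⟨ ℤ.+-comm (dlog L (prod (d ∷ L)) n) _ ⟩
  dlog (d ∷ L) (prod (d ∷ L)) n ∎

dlog-replicate : ∀ k d L a n →
  dlog (replicate k d ++ L) a n ≡ + k * (+ suc d * shift (suc d) (geo (suc d) a) n) + dlog L a n
dlog-replicate zero d L a n = sym (ℤ.+-identityˡ _)
dlog-replicate (suc k) d L a n = trans (+-congˡ x (dlog-replicate k d L a n))
  (trans (e x (+ k) (dlog L a n)) (cong (λ t → t * x + dlog L a n) (sym (ℤ.pos-+ 1 k))))
  where
  x : ℤ
  x = + suc d * shift (suc d) (geo (suc d) a) n
  e : ∀ x k y → x + (k * x + y) ≡ (1ℤ + k) * x + y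
  e = solve-∀

-- k colours of each of the parts 2, …, M+1

bigParts : ℕ → ℕ → List ℕ
bigParts k zero = []
bigParts k (suc M) = replicate k (suc M) ++ bigParts k M

colouredParts : ℕ → ℕ → List ℕ
colouredParts k M = replicate k 0 ++ bigParts k M

dlog-bigParts : ∀ k M a n →
  dlog (bigParts k M) a n ≡ + k * ∑ M (λ j → + (2 +ℕ j) * shift (2 +ℕ j) (geo (2 +ℕ j) a) n)
dlog-bigParts k zero a n = sym (ℤ.*-zeroʳ (+ k))
dlog-bigParts k (suc M) a n = begin
  dlog (replicate k (suc M) ++ bigParts k M) a n      ≡⟨ dlog-replicate k (suc M) (bigParts k M) a n ⟩
  + k * w M + dlog (bigParts k M) a n                 ≡⟨ +-congˡ (+ k * w M) (dlog-bigParts k M a n) ⟩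
  + k * w M + + k * ∑ M w                             ≡⟨ e (+ k) (w M) (∑ M w) ⟩
  + k * (∑ M w + w M)                                 ∎
  where
  w : ℕ → ℤ
  w j = + (2 +ℕ j) * shift (2 +ℕ j) (geo (2 +ℕ j) a) n
  e : ∀ k x y → k * x + k * y ≡ k * (y + x)
  e = solve-∀

-- The list has two factors 1/(1-q) fewer than 2 + k colours require, so `a` is (1-q)² times the
-- generating function. Completing the sum to include the part 1 in every colour adds two terms
-- q/(1-q), which the last summand takes away again.
θ-colouredParts : ∀ k M n → let a = prod (replicate k 0 ++ bigParts (2 +ℕ k) M) in
  + n * a n ≡ + (2 +ℕ k) * ∑ (suc M) (λ j → + suc j * shift (suc j) (geo (suc j) a) n) - + 2 * sh (geo 1 a) n
θ-colouredParts k M n = begin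
  + n * a n                                                        ≡⟨ θ-prod (replicate k 0 ++ bigParts (2 +ℕ k) M) n ⟩
  dlog (replicate k 0 ++ bigParts (2 +ℕ k) M) a n                  ≡⟨ dlog-replicate k 0 (bigParts (2 +ℕ k) M) a n ⟩
  + k * (1ℤ * s) + dlog (bigParts (2 +ℕ k) M) a n                  ≡⟨ +-congˡ (+ k * (1ℤ * s)) (dlog-bigParts (2 +ℕ k) M a n) ⟩
  + k * (1ℤ * s) + + (2 +ℕ k) * r                                  ≡⟨ cong (λ t → + k * (1ℤ * s) + t * r) (ℤ.pos-+ 2 k) ⟩
  + k * (1ℤ * s) + (+ 2 + + k) * r                                 ≡⟨ e (+ k) s r ⟩
  (+ 2 + + k) * (1ℤ * s + r) - + 2 * s                             ≡⟨ cong (λ t → t * (1ℤ * s + r) - + 2 * s) (sym (ℤ.pos-+ 2 k)) ⟩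
  + (2 +ℕ k) * (1ℤ * s + r) - + 2 * s                              ≡⟨ cong (λ t → + (2 +ℕ k) * t - + 2 * s) (sym (∑-head M w)) ⟩
  + (2 +ℕ k) * ∑ (suc M) w - + 2 * s                               ∎
  where
  a : Series
  a = prod (replicate k 0 ++ bigParts (2 +ℕ k) M)
  w : ℕ → ℤ
  w j = + suc j * shift (suc j) (geo (suc j) a) n
  s r : ℤ
  s = sh (geo 1 a) n
  r = ∑ M (w ∘ suc)
  e : ∀ k s r → k * (1ℤ * s) + (+ 2 + k) * r ≡ (+ 2 + k) * (1ℤ * s + r) - + 2 * s
  e = solve-∀

-- The series of pparts and p

geos : ℕ → ℕ → Series → Series
geos zero d a = a
geos (suc k) d a = geo (suc d) (geos k d a)

prod-replicate : ∀ k d L n → prod (replicate k d ++ L) n ≡ geos k d (prod L) n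
prod-replicate zero d L n = refl
prod-replicate (suc k) d L = geo-cong (suc d) (prod-replicate k d L)

-- Adds one colour: division by (1-q)(1-q²)⋯(1-q^(M+1)).
single : ℕ → Series → Series
single zero a = geo 1 a
single (suc M) a = geo (2 +ℕ M) (single M a)

geos-cong : ∀ k d {a b} → (∀ n → a n ≡ b n) → ∀ n → geos k d a n ≡ geos k d b n
geos-cong zero d h = h
geos-cong (suc k) d h = geo-cong (suc d) (geos-cong k d h)

single-cong : ∀ M {a b} → (∀ n → a n ≡ b n) → ∀ n → single M a n ≡ single M b n
single-cong zero h = geo-cong 1 h
single-cong (suc M) h = geo-cong (2 +ℕ M) (single-cong M h)

geo-geos : ∀ d k e a n → geo (suc d) (geos k e a) n ≡ geos k e (geo (suc d) a) n
geo-geos d zero e a n = refl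
geo-geos d (suc k) e a n = trans (geo-comm d e (geos k e a) n) (geo-cong (suc e) (geo-geos d k e a) n)

geos-comm : ∀ j d k e a n → geos j d (geos k e a) n ≡ geos k e (geos j d a) n
geos-comm zero d k e a n = refl
geos-comm (suc j) d k e a n = trans (geo-cong (suc d) (geos-comm j d k e a) n) (geo-geos d k e (geos j d a) n)

single-geos : ∀ M k e a n → single M (geos k e a) n ≡ geos k e (single M a) n
single-geos zero k e a n = geo-geos 0 k e a n
single-geos (suc M) k e a n = trans (geo-cong (2 +ℕ M) (single-geos M k e a) n) (geo-geos (suc M) k e (single M a) n)

-- The factors of the new colour have to be sorted into the blocks of equal part size, which is what
-- the commutation laws are for.
single-prod : ∀ k M n → single M (prod (colouredParts k M)) n ≡ prod (colouredParts (suc k) M) n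
single-prod k zero n = refl
single-prod k (suc M) n = begin
  geo (2 +ℕ M) (single M (prod (replicate k 0 ++ (replicate k (suc M) ++ bigParts k M)))) n
    ≡⟨ geo-cong (2 +ℕ M) (λ m → trans (single-cong M (λ i →
         trans (prod-replicate k 0 _ i) (trans (geos-cong k 0 (prod-replicate k (suc M) (bigParts k M)) i)
         (trans (geos-comm k 0 k (suc M) _ i) (geos-cong k (suc M) (λ j → sym (prod-replicate k 0 (bigParts k M) j)) i)))) m)
         (single-geos M k (suc M) _ m)) n ⟩
  geos (suc k) (suc M) (single M (prod (colouredParts k M))) n
    ≡⟨ geos-cong (suc k) (suc M) (λ m → trans (single-prod k M m) (prod-replicate (suc k) 0 (bigParts (suc k) M) m)) n ⟩
  geos (suc k) (suc M) (geos (suc k) 0 (prod (bigParts (suc k) M))) n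
    ≡⟨ geos-comm (suc k) (suc M) (suc k) 0 (prod (bigParts (suc k) M)) n ⟩
  geos (suc k) 0 (geos (suc k) (suc M) (prod (bigParts (suc k) M))) n
    ≡⟨ geos-cong (suc k) 0 (λ m → sym (prod-replicate (suc k) (suc M) (bigParts (suc k) M) m)) n ⟩
  geos (suc k) 0 (prod (bigParts (suc k) (suc M))) n
    ≡⟨ sym (prod-replicate (suc k) 0 (bigParts (suc k) (suc M)) n) ⟩
  prod (colouredParts (suc k) (suc M)) n ∎

conv-single : ∀ M a b n → conv a (single M b) n ≡ single M (conv a b) n
conv-single zero a b n = conv-geoʳ 0 a b n
conv-single (suc M) a b n = trans (conv-geoʳ (suc M) a (single M b) n) (geo-cong (2 +ℕ M) (conv-single M a b) n)

sum-upTo : ∀ f n → + sum (map f (upTo n)) ≡ ∑ n (λ i → + f i)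
sum-upTo f n = trans (cong (λ l → + sum l) (map-applyUpTo id f n)) (go f n)
  where
  go : ∀ f n → + sum (applyUpTo f n) ≡ ∑ n (λ i → + f i)
  go f zero = refl
  go f (suc n) = trans (ℤ.pos-+ (f 0) _) (trans (+-congˡ (+ f 0) (go (f ∘ suc) n)) (sym (∑-head n λ i → + f i)))

pparts-geo : ∀ j n → + pparts (suc j) n ≡ geo (suc j) (λ m → + pparts j m) n
pparts-geo j n = trans (sum-upTo _ (suc n)) (∑-cong (suc n) λ c → term (c *ℕ suc j) n)
  where
  term : ∀ d m → + (if d ≤ᵇ m then pparts j (m ∸ℕ d) else 0) ≡ shift d (λ m → + pparts j m) m
  term zero m = refl
  term (suc d) zero = refl
  term (suc zero) (suc m) = refl
  term (suc (suc d)) (suc m) = term (suc d) m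

pparts-single : ∀ M n → + pparts (suc M) n ≡ single M δ₀ n
pparts-single zero n = trans (pparts-geo 0 n) (geo-cong 1 (λ { zero → refl ; (suc _) → refl }) n)
pparts-single (suc M) n = trans (pparts-geo (suc M) n) (geo-cong (2 +ℕ M) (pparts-single M) n)

pparts-stable : ∀ t m → + pparts (t +ℕ m) m ≡ + p1 m
pparts-stable zero m = refl
pparts-stable (suc t) m = begin
  + pparts (suc t +ℕ m) m                                     ≡⟨ pparts-geo (t +ℕ m) m ⟩
  geo (suc (t +ℕ m)) (λ i → + pparts (t +ℕ m) i) m            ≡⟨ geo-unfold (t +ℕ m) _ m ⟩
  + pparts (t +ℕ m) m + shift (suc (t +ℕ m)) (geo (suc (t +ℕ m)) (λ i → + pparts (t +ℕ m) i)) m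
    ≡⟨ +-congˡ (+ pparts (t +ℕ m) m) (shift-zero (suc (t +ℕ m)) _ (s≤s (ℕ.m≤n+m m t))) ⟩
  + pparts (t +ℕ m) m + 0ℤ                                    ≡⟨ ℤ.+-identityʳ _ ⟩
  + pparts (t +ℕ m) m                                         ≡⟨ pparts-stable t m ⟩
  + p1 m                                                      ∎

p1-single : ∀ M m → m ≤ suc M → + p1 m ≡ single M δ₀ m
p1-single M m m≤ = trans (sym (pparts-stable (suc M ∸ℕ m) m))
  (trans (cong (λ j → + pparts j m) (ℕ.m∸n+n≡m m≤)) (pparts-single M m))

conv-cong≤ : ∀ {a a' b b'} n → (∀ i → i ≤ n → a i ≡ a' i) → (∀ i → i ≤ n → b i ≡ b' i) → conv a b n ≡ conv a' b' n
conv-cong≤ n h k = ∑-cong< (suc n) λ { i (s≤s i≤n) → cong₂ _*_ (h i i≤n) (k (n ∸ℕ i) (ℕ.m∸n≤m n i)) }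

p-suc : ∀ k n → + p (suc k) n ≡ conv (λ i → + p k i) (λ i → + p1 i) n
p-suc k n = trans (sum-upTo _ (suc n)) (∑-cong (suc n) λ i → ℤ.pos-* (p k i) (p1 (n ∸ℕ i)))

noParts : ∀ M n → prod (bigParts 0 M) n ≡ δ₀ n
noParts zero n = refl
noParts (suc M) n = noParts M n

-- Parts above `M + 1` cannot occur in degrees up to `M + 1`, so a finite product stands in for the
-- infinite one. The analysis is carried out on it, and `M` is chosen at the end in terms of the
-- index.
p-prod : ∀ k M n → n ≤ suc M → + p k n ≡ prod (colouredParts k M) n
p-prod zero M n _ = trans (p-zero n) (sym (noParts M n))
  where
  p-zero : ∀ n → + p 0 n ≡ δ₀ n
  p-zero zero = refl
  p-zero (suc n) = refl
p-prod (suc k) M n n≤ = begin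
  + p (suc k) n                                                      ≡⟨ p-suc k n ⟩
  conv (λ i → + p k i) (λ i → + p1 i) n
    ≡⟨ conv-cong≤ n (λ i i≤n → p-prod k M i (ℕ.≤-trans i≤n n≤)) (λ i i≤n → p1-single M i (ℕ.≤-trans i≤n n≤)) ⟩
  conv (prod (colouredParts k M)) (single M δ₀) n                    ≡⟨ conv-single M (prod (colouredParts k M)) δ₀ n ⟩
  single M (conv (prod (colouredParts k M)) δ₀) n                    ≡⟨ single-cong M (conv-δʳ (prod (colouredParts k M))) n ⟩
  single M (prod (colouredParts k M)) n                              ≡⟨ single-prod k M n ⟩
  prod (colouredParts (suc k) M) n                                   ∎

-- Adding colours multiplies generating functions; the induction on the number of colours proceeds
-- three at a time.
p-3+ : ∀ k n → + p (3 +ℕ k) n ≡ conv (λ i → + p k i) (λ i → + p 3 i) n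
p-3+ k n = sym (begin
  conv (λ i → + p k i) (λ i → + p 3 i) n
    ≡⟨ conv-cong≤ n (λ i i≤n → p-prod k n i (ℕ.m≤n⇒m≤1+n i≤n)) (λ i i≤n → p-prod 3 n i (ℕ.m≤n⇒m≤1+n i≤n)) ⟩
  conv a (prod (colouredParts 3 n)) n
    ≡⟨ conv-congʳ a (λ m → sym (thrice 0 m)) n ⟩
  conv a (single n (single n (single n (prod (colouredParts 0 n))))) n
    ≡⟨ conv-single n a _ n ⟩
  single n (conv a (single n (single n (prod (colouredParts 0 n))))) n
    ≡⟨ single-cong n (λ m → trans (conv-single n a _ m) (single-cong n (conv-single n a _) m)) n ⟩
  single n (single n (single n (conv a (prod (colouredParts 0 n))))) n
    ≡⟨ single-cong n (single-cong n (single-cong n λ m →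
         trans (conv-congʳ a (noParts n) m) (conv-δʳ a m))) n ⟩
  single n (single n (single n a)) n
    ≡⟨ thrice k n ⟩
  prod (colouredParts (3 +ℕ k) n) n
    ≡⟨ sym (p-prod (3 +ℕ k) n n (ℕ.n≤1+n n)) ⟩
  + p (3 +ℕ k) n ∎)
  where
  a : Series
  a = prod (colouredParts k n)
  thrice : ∀ k m → single n (single n (single n (prod (colouredParts k n)))) m ≡ prod (colouredParts (3 +ℕ k) n) m
  thrice k m = trans (single-cong n (λ i → trans (single-cong n (single-prod k n) i) (single-prod (suc k) n i)) m)
    (single-prod (2 +ℕ k) n m)

-- Polynomial sequences and their convolutions

X : Series
X x = + suc x

geo-one : ∀ a n → geo 1 a n ≡ a n + sh (geo 1 a) n
geo-one = geo-unfold 0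

conv-1 : ∀ a n → conv (λ _ → 1ℤ) a n ≡ geo 1 a n
conv-1 a n = begin
  conv (λ _ → 1ℤ) a n    ≡⟨ conv-congˡ a (geo-unique 0 {δ₀} {λ _ → 1ℤ} λ { zero → refl ; (suc _) → refl }) n ⟩
  conv (geo 1 δ₀) a n    ≡⟨ conv-geoˡ 0 δ₀ a n ⟩
  geo 1 (conv δ₀ a) n    ≡⟨ geo-cong 1 (conv-δˡ a) n ⟩
  geo 1 a n              ∎

conv-X : ∀ a n → conv X a n ≡ geo 1 (geo 1 a) n
conv-X a n = begin
  conv X a n                        ≡⟨ conv-congˡ a (geo-unique 0 {λ _ → 1ℤ} {X} λ { zero → refl ; (suc x) → refl }) n ⟩
  conv (geo 1 (λ _ → 1ℤ)) a n       ≡⟨ conv-geoˡ 0 (λ _ → 1ℤ) a n ⟩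
  geo 1 (conv (λ _ → 1ℤ) a) n       ≡⟨ geo-cong 1 (conv-1 a) n ⟩
  geo 1 (geo 1 a) n                 ∎

-- In terms of binomial coefficients, `X²+X` is 2 C(x+2, 2) and `X³-X` is 6 C(x+2, 3): the
-- coefficients of 2/(1-q)³ and of 6q/(1-q)⁴.
X²+X : Series
X²+X x = X x * X x + X x

X³-X : Series
X³-X x = X x * X x * X x - X x

conv-X²+X : ∀ a n → conv X²+X a n ≡ + 2 * geo 1 (geo 1 (geo 1 a)) n
conv-X²+X a n = begin
  conv X²+X a n                             ≡⟨ conv-congˡ a (geo-unique 0 {λ x → + 2 * X x} eq) n ⟩
  conv (geo 1 (λ x → + 2 * X x)) a n        ≡⟨ conv-geoˡ 0 _ a n ⟩
  geo 1 (conv (λ x → + 2 * X x) a) n        ≡⟨ geo-cong 1 (λ m → trans (conv-scaleˡ (+ 2) X a m) (cong (λ t → + 2 * t) (conv-X a m))) n ⟩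
  geo 1 (λ m → + 2 * geo 1 (geo 1 a) m) n   ≡⟨ geo-scale 1 (+ 2) _ n ⟩
  + 2 * geo 1 (geo 1 (geo 1 a)) n           ∎
  where
  e : ∀ y → (1ℤ + y) * (1ℤ + y) + (1ℤ + y) ≡ + 2 * (1ℤ + y) + (y * y + y)
  e = solve-∀
  eq : ∀ x → X²+X x ≡ + 2 * X x + sh X²+X x
  eq zero = refl
  eq (suc x) = e (X x)

conv-X³-X : ∀ a n → conv X³-X a n ≡ + 6 * sh (geo 1 (geo 1 (geo 1 (geo 1 a)))) n
conv-X³-X a n = begin
  conv X³-X a n                                   ≡⟨ conv-congˡ a (geo-unique 0 {λ x → sh (λ y → + 3 * X²+X y) x} eq) n ⟩
  conv (geo 1 (sh (λ y → + 3 * X²+X y))) a n      ≡⟨ conv-geoˡ 0 _ a n ⟩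
  geo 1 (conv (sh (λ y → + 3 * X²+X y)) a) n      ≡⟨ geo-cong 1 (λ m → trans (conv-shˡ _ a m) (sh-cong inner m)) n ⟩
  geo 1 (sh (λ i → + 6 * f₁ i)) n                 ≡⟨ geo-shift 0 1 _ n ⟩
  sh (geo 1 (λ i → + 6 * f₁ i)) n                 ≡⟨ sh-cong (geo-scale 1 (+ 6) f₁) n ⟩
  sh (λ i → + 6 * geo 1 f₁ i) n                   ≡⟨ shift-scale 1 (+ 6) (geo 1 f₁) n ⟩
  + 6 * sh (geo 1 f₁) n                           ∎
  where
  f₁ : Series
  f₁ = geo 1 (geo 1 (geo 1 a))
  six : ∀ x → + 3 * (+ 2 * x) ≡ + 6 * x
  six = solve-∀
  inner : ∀ i → conv (λ y → + 3 * X²+X y) a i ≡ + 6 * f₁ i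
  inner i = trans (conv-scaleˡ (+ 3) X²+X a i) (trans (cong (λ t → + 3 * t) (conv-X²+X a i)) (six (f₁ i)))
  e : ∀ y → (1ℤ + y) * (1ℤ + y) * (1ℤ + y) - (1ℤ + y) ≡ + 3 * (y * y + y) + (y * y * y - y)
  e = solve-∀
  eq : ∀ x → X³-X x ≡ sh (λ y → + 3 * X²+X y) x + sh X³-X x
  eq zero = refl
  eq (suc x) = e (X x)

-- The coefficients of (1-q)⁻² Σ_{d≤R} d q^d/(1-q^d).

T : ℕ → Series
T R x = ∑ R λ j → + suc j * shift (suc j) (geo (suc j) X) x

conv-∑ : ∀ R (G : ℕ → Series) b n → conv (λ x → ∑ R λ j → G j x) b n ≡ ∑ R (λ j → conv (G j) b n)
conv-∑ zero G b n = ∑-zero (suc n) λ _ _ → refl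
conv-∑ (suc R) G b n = trans (conv-addˡ (λ x → ∑ R λ j → G j x) (G R) b n) (cong (_+ conv (G R) b n) (conv-∑ R G b n))

-- For a = f₄ this is the sum in the logarithmic derivative of f₂: the factor (1-q)⁻² built into `T`
-- turns f₄ into f₂.
conv-T : ∀ R a n → conv (T R) a n ≡ ∑ R (λ j → + suc j * shift (suc j) (geo (suc j) (geo 1 (geo 1 a))) n)
conv-T R a n = trans (conv-∑ R (λ j x → + suc j * shift (suc j) (geo (suc j) X) x) a n) (∑-cong R λ j →
  trans (conv-scaleˡ (+ suc j) (shift (suc j) (geo (suc j) X)) a n) (cong (λ t → + suc j * t)
    (trans (conv-shiftˡ (suc j) (geo (suc j) X) a n) (shift-cong (suc j) (λ m →
      trans (conv-geoˡ j X a m) (geo-cong (suc j) (conv-X a) m)) n))))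

weight : ℤ → ℤ → ℤ → ℤ → ℕ → Series
weight a b c d R x = a * X³-X x + b * X x + c * X²+X x + d * T R x

conv-weight : ∀ a b c d R g n → conv (weight a b c d R) g n ≡
  + 6 * a * sh (geo 1 (geo 1 (geo 1 (geo 1 g)))) n + b * geo 1 (geo 1 g) n
  + + 2 * c * geo 1 (geo 1 (geo 1 g)) n + d * conv (T R) g n
conv-weight a b c d R g n = begin
  conv (weight a b c d R) g n
    ≡⟨ conv-addˡ (λ x → a * X³-X x + b * X x + c * X²+X x) (λ x → d * T R x) g n ⟩
  conv (λ x → a * X³-X x + b * X x + c * X²+X x) g n + conv (λ x → d * T R x) g n
    ≡⟨ cong₂ _+_ (trans (conv-addˡ (λ x → a * X³-X x + b * X x) (λ x → c * X²+X x) g n)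
         (cong₂ _+_ (conv-addˡ (λ x → a * X³-X x) (λ x → b * X x) g n) (conv-scaleˡ c X²+X g n))) (conv-scaleˡ d (T R) g n) ⟩
  conv (λ x → a * X³-X x) g n + conv (λ x → b * X x) g n + c * conv X²+X g n + d * conv (T R) g n
    ≡⟨ cong (_+ d * conv (T R) g n) (cong₂ _+_ (cong₂ _+_
         (trans (conv-scaleˡ a X³-X g n) (trans (cong (λ t → a * t) (conv-X³-X g n)) (e₁ a _)))
         (trans (conv-scaleˡ b X g n) (cong (λ t → b * t) (conv-X g n))))
         (trans (cong (λ t → c * t) (conv-X²+X g n)) (e₂ c _))) ⟩
  + 6 * a * sh (geo 1 (geo 1 (geo 1 (geo 1 g)))) n + b * geo 1 (geo 1 g) n
    + + 2 * c * geo 1 (geo 1 (geo 1 g)) n + d * conv (T R) g n ∎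
  where
  e₁ : ∀ a x → a * (+ 6 * x) ≡ + 6 * a * x
  e₁ = solve-∀
  e₂ : ∀ a x → a * (+ 2 * x) ≡ + 2 * a * x
  e₂ = solve-∀

-- T = ζ(2) X³/6 - X²/4 + …, with an oscillating error of order X²/I if the divisor sum is split at X/I; the slopes 56/240 and
-- 66/240 bracket 1/4 closely enough for up to five colours, and Z/Q stands for ζ(2).
upperWeight lowerWeight : ℤ → ℤ → ℕ → Series
upperWeight Q Z = weight (+ 40 * Z) (+ 40 * Z + + 56 * Q) (- (+ 56 * Q)) (- (+ 240 * Q))
lowerWeight Q Z = weight (- (+ 40 * Z)) (- (+ 40 * Z) - + 51 * Q) (+ 66 * Q) (+ 240 * Q)

-- The cubic terms and the divisor sums cancel, which leaves an explicit quadratic. It bounds the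
-- damage done by the one negative coefficient of f₄ for three colours.
weights-sum : ∀ Q Z R x → upperWeight Q Z R x + lowerWeight Q Z R x ≡ Q * (+ 10 * X x * X x + + 15 * X x)
weights-sum Q Z R x = e Q Z (X x) (T R x)
  where
  e : ∀ Q Z X T → (+ 40 * Z * (X * X * X - X) + (+ 40 * Z + + 56 * Q) * X + - (+ 56 * Q) * (X * X + X) + - (+ 240 * Q) * T)
    + (- (+ 40 * Z) * (X * X * X - X) + (- (+ 40 * Z) - + 51 * Q) * X + + 66 * Q * (X * X + X) + + 240 * Q * T)
    ≡ Q * (+ 10 * X * X + + 15 * X)
  e = solve-∀

-- Read F = f₀(n-1), u = f₁(n-1), v = f₂(n) and m = n, where fᵢ = (1-q)ⁱ f₀; c makes up for negative coefficients of f₄.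

module _ (Q Z k m F u v τ c : ℤ) (Q≥0 : 0ℤ ≤ℤ Q) (k≥0 : 0ℤ ≤ℤ k) (v≥0 : 0ℤ ≤ℤ v)
  (rec : m * v ≡ k * τ - + 2 * u) where

  -- Multiplying by k and eliminating τ by the recurrence leaves (40 Z - 56 Q) k v; the bound 1.65
  -- for Z/Q makes this at most 10 Q k v.
  upper-difference : + 100 * Z ≤ℤ + 165 * Q →
    0ℤ ≤ℤ + 6 * (+ 40 * Z) * F + (+ 40 * Z + + 56 * Q) * v + + 2 * - (+ 56 * Q) * (u + v) + - (+ 240 * Q) * τ + c →
    0ℤ ≤ℤ + 240 * k * Z * F - (+ 112 * k + + 480) * Q * u - (+ 240 * m - + 10 * k) * Q * v + k * c
  upper-difference Z≤ h = *-cancel-nonneg {+ 5} (ℤ.+<+ (s≤s z≤n)) (nonneg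
    (+-nonneg (*-nonneg (*-nonneg (0≤+ 5) k≥0) h) (*-nonneg (*-nonneg (*-nonneg (0≤+ 2) k≥0) v≥0) (to-nonneg Z≤)))
    (trans (ring Q Z k m F u v τ c) (+-vanish _ (+ 1200 * Q) (ℤ.i≡j⇒i-j≡0 (sym rec)))))
    where
    ring : ∀ Q Z k m F u v τ c → + 5 * (+ 240 * k * Z * F - (+ 112 * k + + 480) * Q * u - (+ 240 * m - + 10 * k) * Q * v + k * c)
       ≡ + 5 * k * (+ 6 * (+ 40 * Z) * F + (+ 40 * Z + + 56 * Q) * v + + 2 * - (+ 56 * Q) * (u + v) + - (+ 240 * Q) * τ + c)
       + + 2 * k * v * (+ 165 * Q - + 100 * Z) + + 1200 * Q * (k * τ - + 2 * u - m * v)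
    ring = solve-∀

  -- Here (81 Q - 40 Z) k v remains; the bound 1.64 for Z/Q makes it at most 15.4 Q k v, which is
  -- rounded up to 16.
  lower-difference : + 164 * Q ≤ℤ + 100 * Z →
    0ℤ ≤ℤ + 6 * - (+ 40 * Z) * F + (- (+ 40 * Z) - + 51 * Q) * v + + 2 * (+ 66 * Q) * (u + v) + + 240 * Q * τ + c →
    0ℤ ≤ℤ (+ 132 * k + + 480) * Q * u + (+ 240 * m + + 16 * k) * Q * v - + 240 * k * Z * F + k * c
  lower-difference Z≥ h = *-cancel-nonneg {+ 5} (ℤ.+<+ (s≤s z≤n)) (nonneg
    (+-nonneg (+-nonneg (*-nonneg (*-nonneg (0≤+ 5) k≥0) h) (*-nonneg (*-nonneg (*-nonneg (0≤+ 2) k≥0) v≥0) (to-nonneg Z≥)))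
      (*-nonneg (*-nonneg (*-nonneg (0≤+ 3) k≥0) Q≥0) v≥0))
    (trans (ring Q Z k m F u v τ c) (+-vanish _ (+ 1200 * Q) (ℤ.i≡j⇒i-j≡0 rec))))
    where
    ring : ∀ Q Z k m F u v τ c → + 5 * ((+ 132 * k + + 480) * Q * u + (+ 240 * m + + 16 * k) * Q * v - + 240 * k * Z * F + k * c)
       ≡ + 5 * k * (+ 6 * - (+ 40 * Z) * F + (- (+ 40 * Z) - + 51 * Q) * v + + 2 * (+ 66 * Q) * (u + v) + + 240 * Q * τ + c)
       + + 2 * k * v * (+ 100 * Z - + 164 * Q) + + 3 * k * Q * v + + 1200 * Q * (m * v - (k * τ - + 2 * u))
    ring = solve-∀

-- A rational substitute Z/Q for ζ(2), exact enough up to R: with E = e + 1, Z/Q minus the sum of 1/i² over i ≤ E lies between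
-- 1/E - 1/(2E²) and 1/E - 1/(2E²) + 1/(6E³). Here g e / Q = 1/(2E²).

record Zeta (R : ℕ) : Set where
  field
    Q Z : ℤ
    g : ℕ → ℤ
    Q-pos : 0ℤ <ℤ Q
    g-nonneg : ∀ e → 0ℤ ≤ℤ g e
    g-eq : ∀ e → e < R → + 2 * X e * X e * g e ≡ Q
    lower : ∀ e → e < R → ∑ (suc e) (λ i → + 2 * g i) + g e * (+ 2 * X e - 1ℤ) ≤ℤ Z
    upper : ∀ e → e < R → + 3 * X e * Z ≤ℤ
      + 3 * X e * ∑ (suc e) (λ i → + 2 * g i) + g e * (+ 6 * X e * X e - + 3 * X e + 1ℤ)

backward : ∀ {R} (P : ℕ → Set) → P R → (∀ e → e < R → P (suc e) → P e) → ∀ e → e ≤ R → P e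
backward {R} P base step e e≤R = subst P (ℕ.m∸[m∸n]≡n e≤R) (go (R ∸ℕ e) (ℕ.m∸n≤m R e))
  where
  go : ∀ t → t ≤ R → P (R ∸ℕ t)
  go zero _ = base
  go (suc t) t<R = step (R ∸ℕ suc t) (ℕ.∸-monoʳ-< {o = 0} (s≤s z≤n) t<R)
    (subst P (ℕ.+-∸-assoc 1 t<R) (go t (ℕ.<⇒≤ t<R)))

-- The factorial makes every 1/i² integral after scaling. `Z` is chosen so that the lower bound is
-- an equality at the last index. Both bounds then descend from E + 1 to E, because in each step the
-- two sides differ by a nonnegative remainder, `g (suc e)` after clearing denominators.
zeta : ∀ R → Zeta (suc R)
zeta R = record
  { Q = + 2 * (H * H) ; Z = Z ; g = g ; Q-pos = Q-pos ; g-nonneg = g-nonneg ; g-eq = g-eq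
  ; lower = λ { e (s≤s e≤R) → backward Lower lower-base lower-step e e≤R }
  ; upper = λ { e (s≤s e≤R) → backward Upper upper-base upper-step e e≤R } }
  where
  H : ℤ
  H = + (suc R !)
  r : ℕ → ℕ
  r e = suc R ! / suc e
  g : ℕ → ℤ
  g e = + r e * + r e
  S : ℕ → ℤ
  S n = ∑ n (λ i → + 2 * g i)
  Z : ℤ
  Z = S (suc R) + g R * (+ 2 * X R - 1ℤ)
  r-eq : ∀ e → e ≤ R → + r e * X e ≡ H
  r-eq e e≤R = trans (sym (ℤ.pos-* (r e) (suc e))) (cong +_ (m/n*n≡m (∣-trans (m∣m*n (e !)) (m≤n⇒m!∣n! (s≤s e≤R)))))
  G-eq : ∀ e → e ≤ R → X e * X e * g e ≡ H * H
  G-eq e e≤R = trans (sq (X e) (+ r e)) (cong₂ _*_ (r-eq e e≤R) (r-eq e e≤R))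
    where
    sq : ∀ x r → x * x * (r * r) ≡ (r * x) * (r * x)
    sq = solve-∀
  g-eq : ∀ e → e < suc R → + 2 * X e * X e * g e ≡ + 2 * (H * H)
  g-eq e (s≤s e≤R) = trans (as (X e) (g e)) (cong (λ t → + 2 * t) (G-eq e e≤R))
    where
    as : ∀ x g → + 2 * x * x * g ≡ + 2 * (x * x * g)
    as = solve-∀
  g-nonneg : ∀ e → 0ℤ ≤ℤ g e
  g-nonneg e = *-nonneg (0≤+ (r e)) (0≤+ (r e))
  Q-pos : 0ℤ <ℤ + 2 * (H * H)
  Q-pos = *-pos {+ 2} {H * H} (ℤ.+<+ (s≤s z≤n)) (*-pos {H} {H} H-pos H-pos)
    where
    H-pos : 0ℤ <ℤ H
    H-pos = ℤ.+<+ (ℕ.1≤n! (suc R))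
  Lower Upper : ℕ → Set
  Lower e = S (suc e) + g e * (+ 2 * X e - 1ℤ) ≤ℤ Z
  Upper e = + 3 * X e * Z ≤ℤ + 3 * X e * S (suc e) + g e * (+ 6 * X e * X e - + 3 * X e + 1ℤ)
  lower-base : Lower R
  lower-base = ℤ.≤-refl
  upper-base : Upper R
  upper-base = from-nonneg (nonneg (g-nonneg R) (e (X R) (S (suc R)) (g R)))
    where
    e : ∀ x S g → + 3 * x * S + g * (+ 6 * x * x - + 3 * x + 1ℤ) - + 3 * x * (S + g * (+ 2 * x - 1ℤ)) ≡ g
    e = solve-∀
  eqs : ∀ e → e < R → X e * X e * g e ≡ (1ℤ + X e) * (1ℤ + X e) * g (suc e)
  eqs e e<R = trans (G-eq e (ℕ.<⇒≤ e<R)) (sym (G-eq (suc e) e<R))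
  X>0 : ∀ e → 0ℤ <ℤ X e
  X>0 e = ℤ.+<+ (s≤s z≤n)
  X≥0 : ∀ e → 0ℤ ≤ℤ X e
  X≥0 e = 0≤+ _
  lower-step : ∀ e → e < R → Lower (suc e) → Lower e
  lower-step e e<R h = from-nonneg (*-cancel-nonneg (*-pos (X>0 e) (X>0 e)) (nonneg
    (+-nonneg (*-nonneg (*-nonneg (X≥0 e) (X≥0 e)) (to-nonneg h)) (g-nonneg (suc e)))
    (trans (ring (X e) (S (suc e)) (g e) (g (suc e)) Z) (+-vanish _ (+ 2 * X e - 1ℤ) (ℤ.i≡j⇒i-j≡0 (sym (eqs e e<R)))))))
    where
    ring : ∀ x S g g' Z → x * x * (Z - (S + g * (+ 2 * x - 1ℤ))) ≡
      x * x * (Z - (S + + 2 * g' + g' * (+ 2 * (1ℤ + x) - 1ℤ))) + g' + (+ 2 * x - 1ℤ) * ((1ℤ + x) * (1ℤ + x) * g' - x * x * g)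
    ring = solve-∀
  upper-step : ∀ e → e < R → Upper (suc e) → Upper e
  upper-step e e<R h = from-nonneg (*-cancel-nonneg (*-pos (*-pos (X>0 e) (X>0 e)) (X>0 (suc e))) (nonneg
    (+-nonneg (*-nonneg (*-nonneg (*-nonneg (X≥0 e) (X≥0 e)) (X≥0 e)) (to-nonneg h)) (g-nonneg (suc e)))
    (trans (ring (X e) (S (suc e)) (g e) (g (suc e)) Z) (+-vanish _ (- ((1ℤ + X e) * (+ 6 * X e * X e - + 3 * X e + 1ℤ))) (ℤ.i≡j⇒i-j≡0 (sym (eqs e e<R)))))))
    where
    ring : ∀ x S g g' Z → x * x * (1ℤ + x) * (+ 3 * x * S + g * (+ 6 * x * x - + 3 * x + 1ℤ) - + 3 * x * Z) ≡
      x * x * x * (+ 3 * (1ℤ + x) * (S + + 2 * g') + g' * (+ 6 * (1ℤ + x) * (1ℤ + x) - + 3 * (1ℤ + x) + 1ℤ) - + 3 * (1ℤ + x) * Z)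
      + g' + - ((1ℤ + x) * (+ 6 * x * x - + 3 * x + 1ℤ)) * ((1ℤ + x) * (1ℤ + x) * g' - x * x * g)
    ring = solve-∀

rescale-≤ : ∀ a b c d {Q Z} → 0ℤ ≤ℤ Q → 0 < a → b *ℕ c ≤ d *ℕ a → + a * Z ≤ℤ + b * Q → + c * Z ≤ℤ + d * Q
rescale-≤ a b c d {Q} {Z} Q≥0 a>0 bc≤da h = from-nonneg (*-cancel-nonneg {+ a} (ℤ.+<+ a>0) (nonneg
  (+-nonneg (*-nonneg (0≤+ c) (to-nonneg h)) (*-nonneg Q≥0 (to-nonneg (subst₂ _≤ℤ_ (ℤ.pos-* b c) (ℤ.pos-* d a) (ℤ.+≤+ bc≤da)))))
  (e (+ a) (+ b) (+ c) (+ d) Q Z)))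
  where
  e : ∀ a b c d Q Z → a * (d * Q - c * Z) ≡ c * (b * Q - a * Z) + Q * (d * a - b * c)
  e = solve-∀

rescale-≥ : ∀ a b c d {Q Z} → 0ℤ ≤ℤ Q → 0 < a → d *ℕ a ≤ b *ℕ c → + b * Q ≤ℤ + a * Z → + d * Q ≤ℤ + c * Z
rescale-≥ a b c d {Q} {Z} Q≥0 a>0 da≤bc h = from-nonneg (*-cancel-nonneg {+ a} (ℤ.+<+ a>0) (nonneg
  (+-nonneg (*-nonneg (0≤+ c) (to-nonneg h)) (*-nonneg Q≥0 (to-nonneg (subst₂ _≤ℤ_ (ℤ.pos-* d a) (ℤ.pos-* b c) (ℤ.+≤+ da≤bc)))))
  (e (+ a) (+ b) (+ c) (+ d) Q Z)))
  where
  e : ∀ a b c d Q Z → a * (c * Z - d * Q) ≡ c * (a * Z - b * Q) + Q * (b * c - d * a)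
  e = solve-∀

module ZetaBounds {R : ℕ} (ζ : Zeta R) (4≤R : 4 ≤ R) where
  open Zeta ζ

  Q≥0 : 0ℤ ≤ℤ Q
  Q≥0 = ℤ.<⇒≤ Q-pos

  private
    S : ℤ
    S = ∑ 4 (λ i → + 2 * g i)

    scaled-g : ∀ e c → e < 4 → + 144 ≡ c * (X e * X e) → + 144 * (+ 2 * g e) ≡ c * Q
    scaled-g e c e<4 exact = begin
      + 144 * (+ 2 * g e)              ≡⟨ cong (λ t → t * (+ 2 * g e)) exact ⟩
      c * (X e * X e) * (+ 2 * g e)    ≡⟨ as c (X e) (g e) ⟩
      c * (+ 2 * X e * X e * g e)      ≡⟨ cong (λ t → c * t) (g-eq e (ℕ.≤-trans e<4 4≤R)) ⟩
      c * Q                            ∎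
      where
      as : ∀ c x g → c * (x * x) * (+ 2 * g) ≡ c * (+ 2 * x * x * g)
      as = solve-∀

    scaled-g₃ : + 144 * (+ 2 * g 3) ≡ + 9 * Q
    scaled-g₃ = scaled-g 3 (+ 9) (s≤s (s≤s (s≤s (s≤s z≤n)))) refl

    scaled-S : + 144 * S ≡ + 205 * Q
    scaled-S = trans (distrib (+ 2 * g 0) (+ 2 * g 1) (+ 2 * g 2) (+ 2 * g 3))
      (trans (cong₂ _+_ (cong₂ _+_ (cong₂ _+_ (scaled-g 0 (+ 144) (s≤s z≤n) refl) (scaled-g 1 (+ 36) (s≤s (s≤s z≤n)) refl))
        (scaled-g 2 (+ 16) (s≤s (s≤s (s≤s z≤n))) refl)) scaled-g₃) (total Q))
      where
      distrib : ∀ a b c d → + 144 * (0ℤ + a + b + c + d) ≡ + 144 * a + + 144 * b + + 144 * c + + 144 * d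
      distrib = solve-∀
      total : ∀ Q → + 144 * Q + + 36 * Q + + 16 * Q + + 9 * Q ≡ + 205 * Q
      total = solve-∀

  -- The sum of 1/i² over i ≤ 4 is 205/144. Adding 1/4 - 1/32 gives 473/288, and a further 1/384
  -- gives the 1895/1152 of `Z-upper`.
  Z-lower : + 473 * Q ≤ℤ + 288 * Z
  Z-lower = from-nonneg (nonneg (*-nonneg (0≤+ 288) (to-nonneg (lower 3 4≤R)))
    (trans (trans (ring₁ Q Z) (cong₂ (λ s c → + 288 * Z - (+ 2 * s + + 7 * c)) (sym scaled-S) (sym scaled-g₃))) (ring₂ Z S (g 3))))
    where
    ring₁ : ∀ Q Z → + 288 * Z - + 473 * Q ≡ + 288 * Z - (+ 2 * (+ 205 * Q) + + 7 * (+ 9 * Q))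
    ring₁ = solve-∀
    ring₂ : ∀ Z S g → + 288 * Z - (+ 2 * (+ 144 * S) + + 7 * (+ 144 * (+ 2 * g))) ≡ + 288 * (Z - (S + g * + 7))
    ring₂ = solve-∀

  Z-upper : + 1152 * Z ≤ℤ + 1895 * Q
  Z-upper = from-nonneg (*-cancel-nonneg {+ 3} (ℤ.+<+ (s≤s z≤n)) (nonneg (*-nonneg (0≤+ 288) (to-nonneg (upper 3 4≤R)))
    (trans (ring₁ Q Z) (trans (cong₂ (λ s c → + 24 * s + + 85 * c - + 3456 * Z) (sym scaled-S) (sym scaled-g₃)) (ring₂ Z S (g 3))))))
    where
    ring₁ : ∀ Q Z → + 3 * (+ 1895 * Q - + 1152 * Z) ≡ + 24 * (+ 205 * Q) + + 85 * (+ 9 * Q) - + 3456 * Z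
    ring₁ = solve-∀
    ring₂ : ∀ Z S g → + 24 * (+ 144 * S) + + 85 * (+ 144 * (+ 2 * g)) - + 3456 * Z ≡ + 288 * (+ 12 * S + g * + 85 - + 12 * Z)
    ring₂ = solve-∀

-- Lattice sums with truncated subtraction

shift-X : ∀ d x → shift d X x ≡ + (suc x ∸ℕ d)
shift-X zero x = refl
shift-X (suc d) zero = cong +_ (sym (ℕ.0∸n≡0 d))
shift-X (suc d) (suc x) = shift-X d x

lattice : ℕ → ℕ → ℕ → ℤ
lattice R S y = ∑ R λ j → ∑ S λ c → + suc j * + (y ∸ℕ suc c *ℕ suc j)

T-lattice : ∀ R S x → x ≤ S → T R x ≡ lattice R S (suc x)
T-lattice R S x x≤S = ∑-cong R λ j → begin
  + suc j * shift (suc j) (geo (suc j) X) x                        ≡⟨ cong (λ t → + suc j * t) (shift-geo j X x) ⟩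
  + suc j * ∑ x (λ c → shift (suc c *ℕ suc j) X x)                 ≡⟨ cong (λ t → + suc j * t) (∑-cong x λ c → shift-X (suc c *ℕ suc j) x) ⟩
  + suc j * ∑ x (λ c → + (suc x ∸ℕ suc c *ℕ suc j))
    ≡⟨ cong (λ t → + suc j * t) (sym (∑-extend _ x≤S λ c x≤c → cong +_ (ℕ.m≤n⇒m∸n≡0 (ℕ.≤-trans (s≤s x≤c) (ℕ.m≤m*n (suc c) (suc j)))))) ⟩
  + suc j * ∑ S (λ c → + (suc x ∸ℕ suc c *ℕ suc j))                ≡⟨ sym (∑-*ˡ S (+ suc j) _) ⟩
  ∑ S (λ c → + suc j * + (suc x ∸ℕ suc c *ℕ suc j))                ∎

lattice-extend : ∀ {R R'} S y → y ≤ suc R → R ≤ R' → lattice R' S y ≡ lattice R S y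
lattice-extend S y y≤ R≤ = ∑-extend _ R≤ λ j R≤j → ∑-zero S λ c _ →
  trans (cong (λ t → + suc j * + t) (ℕ.m≤n⇒m∸n≡0 (ℕ.≤-trans y≤ (ℕ.≤-trans (s≤s R≤j) (ℕ.m≤n*m (suc j) (suc c)))))) (ℤ.*-zeroʳ (+ suc j))

∸-exact : ∀ {m n} → n ≤ m → + (m ∸ℕ n) ≡ + m - + n
∸-exact {m} {n} n≤m = sym (trans (ℤ.m-n≡m⊖n m n) (ℤ.⊖-≥ n≤m))

-- From index i on the subtraction is cut off at zero, because (i + 1) d exceeds i d + r; before
-- that the cutoff has no effect.
truncate : ∀ (w : ℕ → ℤ) N i d r → r < d → i ≤ N →
  ∑ N (λ m → w m * + ((i *ℕ d +ℕ r) ∸ℕ suc m *ℕ d)) ≡ ∑ i (λ m → w m * (+ (i *ℕ d +ℕ r) - + suc m * + d))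
truncate w N i d r r<d i≤N = trans (∑-extend _ i≤N beyond) (∑-cong< i λ m m<i → cong (λ t → w m * t)
  (trans (∸-exact (ℕ.≤-trans (ℕ.*-monoˡ-≤ d m<i) (ℕ.m≤m+n _ r))) (cong (λ t → + (i *ℕ d +ℕ r) - t) (ℤ.pos-* (suc m) d))))
  where
  beyond : ∀ m → i ≤ m → w m * + ((i *ℕ d +ℕ r) ∸ℕ suc m *ℕ d) ≡ 0ℤ
  beyond m i≤m = trans (cong (λ t → w m * + t) (ℕ.m≤n⇒m∸n≡0 (ℕ.≤-trans
    (subst (i *ℕ d +ℕ r ≤_) (ℕ.+-comm (i *ℕ d) d) (ℕ.+-monoʳ-≤ (i *ℕ d) (ℕ.<⇒≤ r<d)))
    (ℕ.*-monoˡ-≤ d (s≤s i≤m))))) (ℤ.*-zeroʳ (w m))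

linear-sum : ∀ i y d → + 2 * ∑ i (λ m → 1ℤ * (y - + suc m * d)) ≡ + i * (+ 2 * y - (1ℤ + + i) * d)
linear-sum zero y d = refl
linear-sum (suc i) y d = trans (ℤ.*-distribˡ-+ (+ 2) (∑ i (λ m → 1ℤ * (y - + suc m * d))) (1ℤ * (y - + suc i * d)))
  (trans (cong (_+ + 2 * (1ℤ * (y - + suc i * d))) (linear-sum i y d)) (e (+ i) y d))
  where
  e : ∀ i y d → i * (+ 2 * y - (1ℤ + i) * d) + + 2 * (1ℤ * (y - (1ℤ + i) * d)) ≡ (1ℤ + i) * (+ 2 * y - (1ℤ + (1ℤ + i)) * d)
  e = solve-∀

quadratic-sum : ∀ i y d → + 6 * ∑ i (λ m → + suc m * (y - + suc m * d)) ≡ + i * (1ℤ + + i) * (+ 3 * y - (+ 2 * + i + 1ℤ) * d)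
quadratic-sum zero y d = refl
quadratic-sum (suc i) y d = trans (ℤ.*-distribˡ-+ (+ 6) (∑ i (λ m → + suc m * (y - + suc m * d))) (+ suc i * (y - + suc i * d)))
  (trans (cong (_+ + 6 * (+ suc i * (y - + suc i * d))) (quadratic-sum i y d)) (e (+ i) y d))
  where
  e : ∀ i y d → i * (1ℤ + i) * (+ 3 * y - (+ 2 * i + 1ℤ) * d) + + 6 * ((1ℤ + i) * (y - (1ℤ + i) * d))
    ≡ (1ℤ + i) * (1ℤ + (1ℤ + i)) * (+ 3 * y - (+ 2 * (1ℤ + i) + 1ℤ) * d)
  e = solve-∀

pos-*+ : ∀ i d r → + (i *ℕ d +ℕ r) ≡ + i * + d + + r
pos-*+ i d r = trans (ℤ.pos-+ (i *ℕ d) r) (cong (_+ + r) (ℤ.pos-* i d))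

div-decompose : ∀ y d → y ≡ (y / suc d) *ℕ suc d +ℕ y % suc d
div-decompose y d = trans (m≡m%n+[m/n]*n y (suc d)) (ℕ.+-comm (y % suc d) _)

-- Splitting the divisor as d = r + s, the remainder and its complement, turns the bounds below into
-- positivity of polynomials in the nonnegative variables i, r, s.
module Division (e y : ℕ) where
  d i r s : ℕ
  d = suc e
  i = y / d
  r = y % d
  s = d ∸ℕ r
  y-eq : y ≡ i *ℕ d +ℕ r
  y-eq = div-decompose y e
  d-eq : + d ≡ + r + + s
  d-eq = trans (cong +_ (sym (ℕ.m+[n∸m]≡n (ℕ.<⇒≤ (m%n<n y d))))) (ℤ.pos-+ r s)
  y-eqℤ : + y ≡ + i * (+ r + + s) + + r
  y-eqℤ = trans (cong +_ y-eq) (trans (pos-*+ i d r) (cong (λ t → + i * t + + r) d-eq))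

-- The terms of the divisor sum with cofactor `e`, about y³/(6e²) in total.
column : ℕ → ℕ → ℕ → ℤ
column R e y = ∑ R λ j → + suc j * + (y ∸ℕ suc j *ℕ e)

module _ (R e y : ℕ) (y≤R : y ≤ R) where
  open Division e y
  private
    i≤R : i ≤ R
    i≤R = ℕ.≤-trans (m/n≤m y d) y≤R
    closed : + 6 * column R d y ≡ + i * (1ℤ + + i) * (+ 3 * (+ i * (+ r + + s) + + r) - (+ 2 * + i + 1ℤ) * (+ r + + s))
    closed = begin
      + 6 * column R d y
        ≡⟨ cong (λ z → + 6 * column R d z) y-eq ⟩
      + 6 * column R d (i *ℕ d +ℕ r)
        ≡⟨ cong (λ t → + 6 * t) (truncate (λ j → + suc j) R i d r (m%n<n y d) i≤R) ⟩
      + 6 * ∑ i (λ m → + suc m * (+ (i *ℕ d +ℕ r) - + suc m * + d))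
        ≡⟨ quadratic-sum i (+ (i *ℕ d +ℕ r)) (+ d) ⟩
      + i * (1ℤ + + i) * (+ 3 * + (i *ℕ d +ℕ r) - (+ 2 * + i + 1ℤ) * + d)
        ≡⟨ cong₂ (λ a b → + i * (1ℤ + + i) * (+ 3 * a - (+ 2 * + i + 1ℤ) * b)) (trans (cong +_ (sym y-eq)) y-eqℤ) d-eq ⟩
      + i * (1ℤ + + i) * (+ 3 * (+ i * (+ r + + s) + + r) - (+ 2 * + i + 1ℤ) * (+ r + + s)) ∎
    i≥0 : 0ℤ ≤ℤ + i
    i≥0 = 0≤+ i
    r≥0 : 0ℤ ≤ℤ + r
    r≥0 = 0≤+ r
    s≥0 : 0ℤ ≤ℤ + s
    s≥0 = 0≤+ s

  -- The error oscillates with the remainder. Equality holds at r = 0, where d divides y; the upper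
  -- bound is closest near r = s, halfway between two multiples.
  column-lower : 0ℤ ≤ℤ + 6 * (X e * X e) * column R d y - (+ y * + y * + y - X e * X e * + y)
  column-lower = nonneg (*-nonneg (*-nonneg r≥0 s≥0)
      (+-nonneg (*-nonneg (*-nonneg (0≤+ 3) i≥0) d≥0) (+-nonneg d≥0 r≥0)))
    (trans (as (X e) (+ y) (column R d y)) (trans (cong₂ (λ t p → p * p * t - (+ y * + y * + y - p * p * + y)) closed d-eq)
      (trans (cong (λ z → (+ r + + s) * (+ r + + s) * c - (z * z * z - (+ r + + s) * (+ r + + s) * z)) y-eqℤ) (ring (+ i) (+ r) (+ s)))))
    where
    c : ℤ
    c = + i * (1ℤ + + i) * (+ 3 * (+ i * (+ r + + s) + + r) - (+ 2 * + i + 1ℤ) * (+ r + + s))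
    d≥0 : 0ℤ ≤ℤ + r + + s
    d≥0 = +-nonneg r≥0 s≥0
    as : ∀ x y t → + 6 * (x * x) * t - (y * y * y - x * x * y) ≡ x * x * (+ 6 * t) - (y * y * y - x * x * y)
    as = solve-∀
    ring : ∀ i r s → (r + s) * (r + s) * (i * (1ℤ + i) * (+ 3 * (i * (r + s) + r) - (+ 2 * i + 1ℤ) * (r + s)))
      - ((i * (r + s) + r) * (i * (r + s) + r) * (i * (r + s) + r) - (r + s) * (r + s) * (i * (r + s) + r))
      ≡ r * s * (+ 3 * i * (r + s) + (r + s + r))
    ring = solve-∀

  column-upper : 0ℤ ≤ℤ + 4 * (+ y * + y * + y) - X e * X e * + y + X e * X e * X e - + 24 * (X e * X e) * column R d y
  column-upper = nonneg (+-nonneg (+-nonneg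
      (*-nonneg (*-nonneg (*-nonneg (0≤+ 3) i≥0) d≥0) (square-nonneg (+ r - + s)))
      (*-nonneg (*-nonneg (0≤+ 2) (*-nonneg d≥0 d≥0)) r≥0))
      (*-nonneg (square-nonneg (+ r - + s)) (+-nonneg d≥0 r≥0)))
    (trans (as (X e) (+ y) (column R d y)) (trans (cong₂ (λ t p → + 4 * (+ y * + y * + y) - p * p * + y + p * p * p - + 4 * (p * p * t)) closed d-eq)
      (trans (cong (λ z → + 4 * (z * z * z) - (+ r + + s) * (+ r + + s) * z + (+ r + + s) * (+ r + + s) * (+ r + + s) - + 4 * ((+ r + + s) * (+ r + + s) * c)) y-eqℤ) (ring (+ i) (+ r) (+ s)))))
    where
    c : ℤ
    c = + i * (1ℤ + + i) * (+ 3 * (+ i * (+ r + + s) + + r) - (+ 2 * + i + 1ℤ) * (+ r + + s))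
    d≥0 : 0ℤ ≤ℤ + r + + s
    d≥0 = +-nonneg r≥0 s≥0
    as : ∀ x y t → + 4 * (y * y * y) - x * x * y + x * x * x - + 24 * (x * x) * t ≡ + 4 * (y * y * y) - x * x * y + x * x * x - + 4 * (x * x * (+ 6 * t))
    as = solve-∀
    ring : ∀ i r s → + 4 * ((i * (r + s) + r) * (i * (r + s) + r) * (i * (r + s) + r)) - (r + s) * (r + s) * (i * (r + s) + r) + (r + s) * (r + s) * (r + s)
      - + 4 * ((r + s) * (r + s) * (i * (1ℤ + i) * (+ 3 * (i * (r + s) + r) - (+ 2 * i + 1ℤ) * (r + s))))
      ≡ + 3 * i * (r + s) * ((r - s) * (r - s)) + + 2 * ((r + s) * (r + s)) * r + (r - s) * (r - s) * (r + s + r)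
    ring = solve-∀

row : ℕ → ℕ → ℕ → ℤ
row N d y = ∑ N λ m → 1ℤ * + (y ∸ℕ suc m *ℕ d)

module _ (N e y : ℕ) (y≤N : y ≤ N) where
  open Division e y
  private
    i≤N : i ≤ N
    i≤N = ℕ.≤-trans (m/n≤m y d) y≤N
    closed : + 2 * row N d y ≡ + i * (+ 2 * (+ i * (+ r + + s) + + r) - (1ℤ + + i) * (+ r + + s))
    closed = begin
      + 2 * row N d y
        ≡⟨ cong (λ z → + 2 * row N d z) y-eq ⟩
      + 2 * row N d (i *ℕ d +ℕ r)
        ≡⟨ cong (λ t → + 2 * t) (truncate (λ _ → 1ℤ) N i d r (m%n<n y d) i≤N) ⟩
      + 2 * ∑ i (λ m → 1ℤ * (+ (i *ℕ d +ℕ r) - + suc m * + d))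
        ≡⟨ linear-sum i (+ (i *ℕ d +ℕ r)) (+ d) ⟩
      + i * (+ 2 * + (i *ℕ d +ℕ r) - (1ℤ + + i) * + d)
        ≡⟨ cong₂ (λ a b → + i * (+ 2 * a - (1ℤ + + i) * b)) (trans (cong +_ (sym y-eq)) y-eqℤ) d-eq ⟩
      + i * (+ 2 * (+ i * (+ r + + s) + + r) - (1ℤ + + i) * (+ r + + s)) ∎
    excess : + 2 * + d * row N d y - + y * (+ y - + d) ≡ + r * + s
    excess = trans (as (+ d) (+ y) (row N d y)) (trans (cong₂ (λ t p → p * t - + y * (+ y - p)) closed d-eq)
      (trans (cong (λ z → (+ r + + s) * c - z * (z - (+ r + + s))) y-eqℤ) (ring (+ i) (+ r) (+ s))))
      where
      c : ℤ
      c = + i * (+ 2 * (+ i * (+ r + + s) + + r) - (1ℤ + + i) * (+ r + + s))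
      as : ∀ d y t → + 2 * d * t - y * (y - d) ≡ d * (+ 2 * t) - y * (y - d)
      as = solve-∀
      ring : ∀ i r s → (r + s) * (i * (+ 2 * (i * (r + s) + r) - (1ℤ + i) * (r + s))) - (i * (r + s) + r) * (i * (r + s) + r - (r + s)) ≡ r * s
      ring = solve-∀

  -- By `excess` the deviation is exactly r s, which lies between 0 and d²/4; the second bound is
  -- used in `row-upper`.
  row-lower : 0ℤ ≤ℤ + 2 * + d * row N d y - + y * (+ y - + d)
  row-lower = nonneg (*-nonneg (0≤+ r) (0≤+ s)) excess

  row-upper : 0ℤ ≤ℤ + 4 * (+ y * (+ y - + d)) + + d * + d - + 8 * + d * row N d y
  row-upper = nonneg (square-nonneg (+ r - + s)) (trans (as (+ d) (+ y) (row N d y))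
    (trans (cong₂ (λ p q → p * p - + 4 * q) d-eq excess) (ring (+ r) (+ s))))
    where
    as : ∀ d y t → + 4 * (y * (y - d)) + d * d - + 8 * d * t ≡ d * d - + 4 * (+ 2 * d * t - y * (y - d))
    as = solve-∀
    ring : ∀ r s → (r + s) * (r + s) - + 4 * (r * s) ≡ (r - s) * (r - s)
    ring = solve-∀

T-columns : ∀ R x → x ≤ R → T R x ≡ ∑ R (λ c → column R (suc c) (suc x))
T-columns R x x≤R = trans (T-lattice R R x x≤R) (trans (∑-swap R R λ j c → + suc j * + (suc x ∸ℕ suc c *ℕ suc j))
  (∑-cong R λ c → ∑-cong R λ j → cong (λ t → + suc j * + (suc x ∸ℕ t)) (ℕ.*-comm (suc c) (suc j))))

-- Since y < 4(E+1), only d = 1, 2, 3 contribute for e > E.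
far-columns : ∀ R E N y → 3 ≤ R → y < 4 *ℕ suc E →
  ∑ N (λ c → column R (suc (E +ℕ c)) y) ≡ ∑ 3 (λ j → + suc j * row N (suc j) (y ∸ℕ E *ℕ suc j))
far-columns R E N y 3≤R y< = begin
  ∑ N (λ c → ∑ R (λ j → + suc j * + (y ∸ℕ suc j *ℕ suc (E +ℕ c))))
    ≡⟨ ∑-swap N R (λ c j → + suc j * + (y ∸ℕ suc j *ℕ suc (E +ℕ c))) ⟩
  ∑ R (λ j → ∑ N (λ c → + suc j * + (y ∸ℕ suc j *ℕ suc (E +ℕ c))))
    ≡⟨ ∑-extend _ 3≤R (λ j 3≤j → ∑-zero N λ c _ → trans (cong (λ t → + suc j * + t) (ℕ.m≤n⇒m∸n≡0
         (ℕ.≤-trans (ℕ.<⇒≤ y<) (ℕ.*-mono-≤ (s≤s 3≤j) (s≤s (ℕ.m≤m+n E c)))))) (ℤ.*-zeroʳ (+ suc j))) ⟩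
  ∑ 3 (λ j → ∑ N (λ c → + suc j * + (y ∸ℕ suc j *ℕ suc (E +ℕ c))))
    ≡⟨ ∑-cong 3 (λ j → trans (∑-cong N λ c → cong (λ t → + suc j * t) (term j c)) (∑-*ˡ N (+ suc j) _)) ⟩
  ∑ 3 (λ j → + suc j * row N (suc j) (y ∸ℕ E *ℕ suc j)) ∎
  where
  term : ∀ j c → + (y ∸ℕ suc j *ℕ suc (E +ℕ c)) ≡ 1ℤ * + ((y ∸ℕ E *ℕ suc j) ∸ℕ suc c *ℕ suc j)
  term j c = trans (cong +_ (trans (cong (y ∸ℕ_) (trans (ℕ.*-comm (suc j) (suc (E +ℕ c)))
      (trans (cong (_*ℕ suc j) (sym (ℕ.+-suc E c))) (ℕ.*-distribʳ-+ (suc j) E (suc c)))))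
      (sym (ℕ.∸-+-assoc y (E *ℕ suc j) (suc c *ℕ suc j)))))
    (sym (ℤ.*-identityˡ _))

-- Two-sided bounds for the divisor sum T

module TBounds {R : ℕ} (ζ : Zeta R) (4≤R : 4 ≤ R) where
  open Zeta ζ
  open ZetaBounds ζ 4≤R

  S : ℕ → ℤ
  S n = ∑ n (λ i → + 2 * g i)

  columns-lower : ∀ y n → y ≤ R → n ≤ R →
    0ℤ ≤ℤ + 6 * Q * ∑ n (λ c → column R (suc c) y) - (+ y * + y * + y * S n - Q * + n * + y)
  columns-lower y zero _ _ = nonneg ℤ.≤-refl (e (+ y) Q)
    where
    e : ∀ y Q → + 6 * Q * 0ℤ - (y * y * y * 0ℤ - Q * 0ℤ * y) ≡ 0ℤ
    e = solve-∀
  columns-lower y (suc n) y≤R n<R = nonneg (+-nonneg (columns-lower y n y≤R (ℕ.<⇒≤ n<R))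
      (*-nonneg (*-nonneg (0≤+ 2) (g-nonneg n)) (column-lower R n y y≤R)))
    (go (+ y) (+ n) (S n) (g n) (∑ n (λ c → column R (suc c) y)) (column R (suc n) y) (g-eq n n<R))
    where
    ring : ∀ y n S g C c → let x = 1ℤ + n; Q = + 2 * x * x * g in
      + 6 * Q * (C + c) - (y * y * y * (S + + 2 * g) - Q * x * y) ≡
      + 6 * Q * C - (y * y * y * S - Q * n * y) + + 2 * g * (+ 6 * (x * x) * c - (y * y * y - x * x * y))
    ring = solve-∀
    go : ∀ y n S g C c {Q} → + 2 * (1ℤ + n) * (1ℤ + n) * g ≡ Q →
      + 6 * Q * (C + c) - (y * y * y * (S + + 2 * g) - Q * (1ℤ + n) * y) ≡
      + 6 * Q * C - (y * y * y * S - Q * n * y) + + 2 * g * (+ 6 * ((1ℤ + n) * (1ℤ + n)) * c - (y * y * y - (1ℤ + n) * (1ℤ + n) * y))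
    -- Matching on the equation replaces Q by 2 x² g, which turns the claim into a polynomial
    -- identity.
    go y n S g C c refl = ring y n S g C c

  columns-upper : ∀ y n → y ≤ R → n ≤ R →
    0ℤ ≤ℤ + 8 * (+ y * + y * + y) * S n - + 2 * Q * + n * + y + Q * + n * (1ℤ + + n) - + 48 * Q * ∑ n (λ c → column R (suc c) y)
  columns-upper y zero _ _ = nonneg ℤ.≤-refl (e (+ y) Q)
    where
    e : ∀ y Q → + 8 * (y * y * y) * 0ℤ - + 2 * Q * 0ℤ * y + Q * 0ℤ * (1ℤ + 0ℤ) - + 48 * Q * 0ℤ ≡ 0ℤ
    e = solve-∀
  columns-upper y (suc n) y≤R n<R = nonneg (+-nonneg (columns-upper y n y≤R (ℕ.<⇒≤ n<R))
      (*-nonneg (*-nonneg (0≤+ 4) (g-nonneg n)) (column-upper R n y y≤R)))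
    (go (+ y) (+ n) (S n) (g n) (∑ n (λ c → column R (suc c) y)) (column R (suc n) y) (g-eq n n<R))
    where
    ring : ∀ y n S g C c → let x = 1ℤ + n; Q = + 2 * x * x * g in
      + 8 * (y * y * y) * (S + + 2 * g) - + 2 * Q * x * y + Q * x * (1ℤ + x) - + 48 * Q * (C + c) ≡
      + 8 * (y * y * y) * S - + 2 * Q * n * y + Q * n * (1ℤ + n) - + 48 * Q * C
      + + 4 * g * (+ 4 * (y * y * y) - x * x * y + x * x * x - + 24 * (x * x) * c)
    ring = solve-∀
    go : ∀ y n S g C c {Q} → + 2 * (1ℤ + n) * (1ℤ + n) * g ≡ Q →
      + 8 * (y * y * y) * (S + + 2 * g) - + 2 * Q * (1ℤ + n) * y + Q * (1ℤ + n) * (1ℤ + (1ℤ + n)) - + 48 * Q * (C + c) ≡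
      + 8 * (y * y * y) * S - + 2 * Q * n * y + Q * n * (1ℤ + n) - + 48 * Q * C
      + + 4 * g * (+ 4 * (y * y * y) - (1ℤ + n) * (1ℤ + n) * y + (1ℤ + n) * (1ℤ + n) * (1ℤ + n) - + 24 * ((1ℤ + n) * (1ℤ + n)) * c)
    go y n S g C c refl = ring y n S g C c

  -- The terms with cofactor above E. As y - d (E + c) = (y - E d) - c d, each d ≤ 3 contributes a
  -- row that starts from y - E d.
  far : ℕ → ℕ → ℤ
  far E y = ∑ 3 λ j → + suc j * row (R ∸ℕ E) (suc j) (y ∸ℕ E *ℕ suc j)

  module _ (E ρ : ℕ) (y≤R : 4 *ℕ E +ℕ ρ ≤ R) where
    private
      y : ℕ
      y = 4 *ℕ E +ℕ ρ
      z : ℕ → ℕ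
      z j = y ∸ℕ E *ℕ suc j
      B : ℕ → ℤ
      B j = row (R ∸ℕ E) (suc j) (z j)
      z≤ : ∀ j → z j ≤ R ∸ℕ E
      z≤ j = ℕ.∸-mono y≤R (ℕ.m≤m*n E (suc j))
      z-eq : ∀ j → suc j ≤ 4 → + z j ≡ + 4 * + E + + ρ - + E * + suc j
      z-eq j j<4 = trans (∸-exact (ℕ.≤-trans (subst (E *ℕ suc j ≤_) (ℕ.*-comm E 4) (ℕ.*-monoʳ-≤ E j<4)) (ℕ.m≤m+n (4 *ℕ E) ρ)))
        (cong₂ _-_ (pos-*+ 4 E ρ) (ℤ.pos-* E (suc j)))
      low : ∀ j → j < 3 → 0ℤ ≤ℤ + 2 * + suc j * B j - (+ 4 * + E + + ρ - + E * + suc j) * (+ 4 * + E + + ρ - + E * + suc j - + suc j)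
      low j j<3 = subst (λ t → 0ℤ ≤ℤ + 2 * + suc j * B j - t * (t - + suc j)) (z-eq j (ℕ.m≤n⇒m≤1+n j<3)) (row-lower (R ∸ℕ E) j (z j) (z≤ j))
      upp : ∀ j → j < 3 → 0ℤ ≤ℤ + 4 * ((+ 4 * + E + + ρ - + E * + suc j) * (+ 4 * + E + + ρ - + E * + suc j - + suc j)) + + suc j * + suc j - + 8 * + suc j * B j
      upp j j<3 = subst (λ t → 0ℤ ≤ℤ + 4 * (t * (t - + suc j)) + + suc j * + suc j - + 8 * + suc j * B j) (z-eq j (ℕ.m≤n⇒m≤1+n j<3)) (row-upper (R ∸ℕ E) j (z j) (z≤ j))

    -- The sum of z (z - d) over d = 1, 2, 3, where z = (4 - d) E + ρ.
    far-main : ℤ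
    far-main = + 14 * (+ E * + E) + + 12 * + E * + ρ + + 3 * + ρ * + ρ - + 10 * + E - + 6 * + ρ

    far-lower : 0ℤ ≤ℤ + 2 * far E y - far-main
    far-lower = nonneg (+-nonneg (+-nonneg (low 0 (s≤s z≤n)) (low 1 (s≤s (s≤s z≤n)))) (low 2 ℕ.≤-refl)) (ring (+ E) (+ ρ) (B 0) (B 1) (B 2))
      where
      ring : ∀ x r b₀ b₁ b₂ → + 2 * (0ℤ + + 1 * b₀ + + 2 * b₁ + + 3 * b₂) - (+ 14 * (x * x) + + 12 * x * r + + 3 * r * r - + 10 * x - + 6 * r) ≡
        (+ 2 * + 1 * b₀ - (+ 4 * x + r - x * + 1) * (+ 4 * x + r - x * + 1 - + 1))
        + (+ 2 * + 2 * b₁ - (+ 4 * x + r - x * + 2) * (+ 4 * x + r - x * + 2 - + 2))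
        + (+ 2 * + 3 * b₂ - (+ 4 * x + r - x * + 3) * (+ 4 * x + r - x * + 3 - + 3))
      ring = solve-∀

    far-upper : 0ℤ ≤ℤ + 4 * far-main + + 14 - + 8 * far E y
    far-upper = nonneg (+-nonneg (+-nonneg (upp 0 (s≤s z≤n)) (upp 1 (s≤s (s≤s z≤n)))) (upp 2 ℕ.≤-refl)) (ring (+ E) (+ ρ) (B 0) (B 1) (B 2))
      where
      ring : ∀ x r b₀ b₁ b₂ → + 4 * (+ 14 * (x * x) + + 12 * x * r + + 3 * r * r - + 10 * x - + 6 * r) + + 14 - + 8 * (0ℤ + + 1 * b₀ + + 2 * b₁ + + 3 * b₂) ≡
        (+ 4 * ((+ 4 * x + r - x * + 1) * (+ 4 * x + r - x * + 1 - + 1)) + + 1 * + 1 - + 8 * + 1 * b₀)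
        + (+ 4 * ((+ 4 * x + r - x * + 2) * (+ 4 * x + r - x * + 2 - + 2)) + + 2 * + 2 - + 8 * + 2 * b₁)
        + (+ 4 * ((+ 4 * x + r - x * + 3) * (+ 4 * x + r - x * + 3 - + 3)) + + 3 * + 3 - + 8 * + 3 * b₂)
      ring = solve-∀

  -- A hyperbola method with very unequal sides: small cofactors are summed along columns, large
  -- ones along three rows.
  T-split : ∀ E ρ x → ρ < 4 → suc x ≡ 4 *ℕ E +ℕ ρ → suc x ≤ R →
    T R x ≡ ∑ E (λ c → column R (suc c) (suc x)) + far E (suc x)
  T-split E ρ x ρ<4 eq y≤R = begin
    T R x
      ≡⟨ T-columns R x (ℕ.<⇒≤ y≤R) ⟩
    ∑ R (λ c → column R (suc c) (suc x))
      ≡⟨ cong (λ k → ∑ k (λ c → column R (suc c) (suc x))) (sym (ℕ.m+[n∸m]≡n E≤R)) ⟩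
    ∑ (E +ℕ (R ∸ℕ E)) (λ c → column R (suc c) (suc x))
      ≡⟨ ∑-split E (R ∸ℕ E) (λ c → column R (suc c) (suc x)) ⟩
    ∑ E (λ c → column R (suc c) (suc x)) + ∑ (R ∸ℕ E) (λ c → column R (suc (E +ℕ c)) (suc x))
      ≡⟨ +-congˡ (∑ E (λ c → column R (suc c) (suc x))) (far-columns R E (R ∸ℕ E) (suc x) (ℕ.<⇒≤ 4≤R) y<) ⟩
    ∑ E (λ c → column R (suc c) (suc x)) + far E (suc x) ∎
    where
    E≤R : E ≤ R
    E≤R = ℕ.≤-trans (ℕ.≤-trans (ℕ.m≤n*m E 4) (ℕ.m≤m+n (4 *ℕ E) ρ)) (subst (_≤ R) eq y≤R)
    y< : suc x < 4 *ℕ suc E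
    y< = subst₂ _<_ (sym eq) (trans (ℕ.+-comm (4 *ℕ E) 4) (sym (ℕ.*-suc 4 E))) (ℕ.+-monoʳ-< (4 *ℕ E) ρ<4)

  Upper Lower : ℕ → Set
  Upper x = 0ℤ ≤ℤ + 40 * (X x * X x * X x) * Z - (+ 56 * (X x * X x) + + 240 * T R x) * Q
  Lower x = 0ℤ ≤ℤ (+ 240 * T R x + + 66 * (X x * X x) + + 15 * X x) * Q - + 40 * (X x * X x * X x) * Z

  -- What remains of T-upper and T-lower after splitting the divisor sum at x = ⌊y/4⌋ with y = 4x + r.
  upperPoly lowerPoly : ℤ → ℤ → ℤ
  upperPoly x r = let y = + 4 * x + r; P = + 14 * (x * x) + + 12 * x * r + + 3 * r * r - + 10 * x - + 6 * r in
    + 40 * (y * y * y) * (+ 2 * x - 1ℤ) + + 2 * x * x * (+ 10 * x * y - + 5 * x * (1ℤ + x) - + 120 * P - + 420 - + 56 * (y * y))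
  lowerPoly x r = let y = + 4 * x + r; P = + 14 * (x * x) + + 12 * x * r + + 3 * r * r - + 10 * x - + 6 * r in
    + 6 * x * x * x * (+ 120 * P + + 66 * (y * y) + + 15 * y - + 40 * x * y) - + 40 * (y * y * y) * (+ 6 * x * x - + 3 * x + 1ℤ)

  -- After the substitution x = 8 + t all coefficients are nonnegative. The start at 8 leaves y < 32
  -- to direct computation.
  upperPoly-nonneg : ∀ t r → 0ℤ ≤ℤ t → 0ℤ ≤ℤ r → 0ℤ ≤ℤ upperPoly (+ 8 + t) r
  upperPoly-nonneg t r t≥0 r≥0 = nonneg
    (horner (horner (0≤+ 14848) r≥0 (horner (0≤+ 12288) r≥0 (horner (0≤+ 4352) r≥0 (0≤+ 600)))) t≥0
    (horner (horner (0≤+ 31744) r≥0 (horner (0≤+ 8448) r≥0 (horner (0≤+ 1568) r≥0 (0≤+ 80)))) t≥0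
    (horner (horner (0≤+ 9672) r≥0 (horner (0≤+ 1536) r≥0 (0≤+ 128))) t≥0
    (horner (horner (0≤+ 1046) r≥0 (0≤+ 84)) t≥0 (0≤+ 38)))))
    (ring t r)
    where
    ring : ∀ t r → let x = + 8 + t; y = + 4 * x + r; P = + 14 * (x * x) + + 12 * x * r + + 3 * r * r - + 10 * x - + 6 * r in
        + 40 * (y * y * y) * (+ 2 * x - 1ℤ) + + 2 * x * x * (+ 10 * x * y - + 5 * x * (1ℤ + x) - + 120 * P - + 420 - + 56 * (y * y)) ≡
        (+ 14848 + r * (+ 12288 + r * (+ 4352 + r * + 600))) + t *
        ((+ 31744 + r * (+ 8448 + r * (+ 1568 + r * + 80))) + t *
        ((+ 9672 + r * (+ 1536 + r * + 128)) + t *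
        ((+ 1046 + r * + 84) + t * + 38)))
    ring = solve-∀

  -- Here powers of r with a negative coefficient occur. They are absorbed into r (3 - r), which is
  -- nonnegative because r is a remainder modulo 4.
  lowerPoly-nonneg : ∀ t r → 0ℤ ≤ℤ t → 0ℤ ≤ℤ r → 0ℤ ≤ℤ + 3 - r → 0ℤ ≤ℤ lowerPoly (+ 8 + t) r
  lowerPoly-nonneg t r t≥0 r≥0 s≥0 = nonneg
    (horner (horner (0≤+ 5275648) r≥0 (horner (0≤+ 494424) s≥0 (horner (0≤+ 120888) r≥0 (0≤+ 14440)))) t≥0
    (horner (horner (0≤+ 3194880) r≥0 (horner (0≤+ 208920) s≥0 (horner (0≤+ 50808) r≥0 (0≤+ 3720)))) t≥0
    (horner (horner (0≤+ 752640) r≥0 (horner (0≤+ 32064) s≥0 (horner (0≤+ 7056) r≥0 (0≤+ 240)))) t≥0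
    (horner (horner (0≤+ 85760) r≥0 (horner (0≤+ 2094) s≥0 (0≤+ 324))) t≥0
    (horner (horner (0≤+ 4680) r≥0 (0≤+ 48)) t≥0 (0≤+ 96))))))
    (ring t r)
    where
    ring : ∀ t r → let x = + 8 + t; y = + 4 * x + r; P = + 14 * (x * x) + + 12 * x * r + + 3 * r * r - + 10 * x - + 6 * r in
        + 6 * x * x * x * (+ 120 * P + + 66 * (y * y) + + 15 * y - + 40 * x * y) - + 40 * (y * y * y) * (+ 6 * x * x - + 3 * x + 1ℤ) ≡
        (+ 5275648 + r * (+ 494424 + (+ 3 - r) * (+ 120888 + r * + 14440))) + t *
        ((+ 3194880 + r * (+ 208920 + (+ 3 - r) * (+ 50808 + r * + 3720))) + t *
        ((+ 752640 + r * (+ 32064 + (+ 3 - r) * (+ 7056 + r * + 240))) + t *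
        ((+ 85760 + r * (+ 2094 + (+ 3 - r) * + 324)) + t *
        ((+ 4680 + r * + 48) + t * + 96))))
    ring = solve-∀

  private
    module Large (e t ρ : ℕ) (eq : suc e ≡ 8 +ℕ t) (ρ<4 : ρ < 4) (x : ℕ) (x-eq : suc x ≡ 4 *ℕ suc e +ℕ ρ) (y≤R : suc x ≤ R) where
      E≤R : suc e ≤ R
      E≤R = ℕ.≤-trans (ℕ.≤-trans (ℕ.m≤n*m (suc e) 4) (ℕ.m≤m+n (4 *ℕ suc e) ρ)) (subst (_≤ R) x-eq y≤R)
      C W : ℤ
      C = ∑ (suc e) (λ c → column R (suc c) (suc x))
      W = far (suc e) (suc x)
      T-eq : T R x ≡ C + W
      T-eq = T-split (suc e) ρ x ρ<4 x-eq y≤R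
      Xx : X x ≡ + 4 * X e + + ρ
      Xx = trans (cong +_ x-eq) (pos-*+ 4 (suc e) ρ)
      Xe : X e ≡ + 8 + + t
      Xe = trans (cong +_ eq) (ℤ.pos-+ 8 t)
      s≥0 : 0ℤ ≤ℤ + 3 - + ρ
      s≥0 = to-nonneg (ℤ.+≤+ (ℕ.≤-pred ρ<4))
      far-main′ : ℤ
      far-main′ = far-main (suc e) ρ (subst (_≤ R) x-eq y≤R)
      W-lower : 0ℤ ≤ℤ + 2 * W - far-main′
      W-lower = subst (λ z → 0ℤ ≤ℤ + 2 * far (suc e) z - far-main′) (sym x-eq) (far-lower (suc e) ρ (subst (_≤ R) x-eq y≤R))
      W-upper : 0ℤ ≤ℤ + 4 * far-main′ + + 14 - + 8 * W
      W-upper = subst (λ z → 0ℤ ≤ℤ + 4 * far-main′ + + 14 - + 8 * far (suc e) z) (sym x-eq) (far-upper (suc e) ρ (subst (_≤ R) x-eq y≤R))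

      -- A positive combination of the tail bound for ζ(2), the column bounds and the row bounds;
      -- what is left over is `g e` times a polynomial of known sign.
      upper-large : Upper x
      upper-large = nonneg
        (+-nonneg (+-nonneg (+-nonneg
          (*-nonneg (*-nonneg (0≤+ 40) (*-nonneg (*-nonneg (0≤+ (suc x)) (0≤+ (suc x))) (0≤+ (suc x)))) (to-nonneg (lower e E≤R)))
          (*-nonneg (0≤+ 5) (columns-upper (suc x) (suc e) y≤R E≤R)))
          (*-nonneg (*-nonneg (0≤+ 30) Q≥0) W-upper))
          (*-nonneg (g-nonneg e) (subst (λ z → 0ℤ ≤ℤ upperPoly z (+ ρ)) (sym Xe) (upperPoly-nonneg (+ t) (+ ρ) (0≤+ t) (0≤+ ρ) ))))
        (trans (cong (λ z → + 40 * (X x * X x * X x) * Z - (+ 56 * (X x * X x) + + 240 * z) * Q) T-eq)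
          (go (X e) (g e) Z (S (suc e)) C W (+ ρ) (X x) (g-eq e E≤R) Xx))
        where
        ring : ∀ x g Z S C W r → let y = + 4 * x + r; Q = + 2 * x * x * g in
          + 40 * (y * y * y) * Z - (+ 56 * (y * y) + + 240 * (C + W)) * Q ≡
          + 40 * (y * y * y) * (Z - (S + g * (+ 2 * x - 1ℤ)))
          + + 5 * (+ 8 * (y * y * y) * S - + 2 * Q * x * y + Q * x * (1ℤ + x) - + 48 * Q * C)
          + + 30 * Q * (+ 4 * (+ 14 * (x * x) + + 12 * x * r + + 3 * r * r - + 10 * x - + 6 * r) + + 14 - + 8 * W)
          + g * (+ 40 * (y * y * y) * (+ 2 * x - 1ℤ) + + 2 * x * x * (+ 10 * x * y - + 5 * x * (1ℤ + x)
            - + 120 * (+ 14 * (x * x) + + 12 * x * r + + 3 * r * r - + 10 * x - + 6 * r) - + 420 - + 56 * (y * y)))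
        ring = solve-∀
        go : ∀ x g Z S C W r y {Q} → + 2 * x * x * g ≡ Q → y ≡ + 4 * x + r →
          + 40 * (y * y * y) * Z - (+ 56 * (y * y) + + 240 * (C + W)) * Q ≡
          + 40 * (y * y * y) * (Z - (S + g * (+ 2 * x - 1ℤ)))
          + + 5 * (+ 8 * (y * y * y) * S - + 2 * Q * x * y + Q * x * (1ℤ + x) - + 48 * Q * C)
          + + 30 * Q * (+ 4 * (+ 14 * (x * x) + + 12 * x * r + + 3 * r * r - + 10 * x - + 6 * r) + + 14 - + 8 * W)
          + g * upperPoly x r
        go x g Z S C W r _ refl refl = ring x g Z S C W r

      lower-large : Lower x
      -- The factor 3E clears the denominator of 1/(6E³) in the upper tail bound for ζ(2).
      lower-large = *-cancel-nonneg {+ 3 * X e} (ℤ.+<+ (s≤s z≤n)) (nonneg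
        (+-nonneg (+-nonneg (+-nonneg
          (*-nonneg (*-nonneg (0≤+ 40) (*-nonneg (*-nonneg (0≤+ (suc x)) (0≤+ (suc x))) (0≤+ (suc x)))) (to-nonneg (upper e E≤R)))
          (*-nonneg (*-nonneg (0≤+ 120) (0≤+ (suc e))) (columns-lower (suc x) (suc e) y≤R E≤R)))
          (*-nonneg (*-nonneg (*-nonneg (0≤+ 360) (0≤+ (suc e))) Q≥0) W-lower))
          (*-nonneg (g-nonneg e) (subst (λ z → 0ℤ ≤ℤ lowerPoly z (+ ρ)) (sym Xe) (lowerPoly-nonneg (+ t) (+ ρ) (0≤+ t) (0≤+ ρ) s≥0))))
        (trans (cong (λ z → + 3 * X e * ((+ 240 * z + + 66 * (X x * X x) + + 15 * X x) * Q - + 40 * (X x * X x * X x) * Z)) T-eq)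
          (go (X e) (g e) Z (S (suc e)) C W (+ ρ) (X x) (g-eq e E≤R) Xx)))
        where
        ring : ∀ x g Z S C W r → let y = + 4 * x + r; Q = + 2 * x * x * g in
          + 3 * x * ((+ 240 * (C + W) + + 66 * (y * y) + + 15 * y) * Q - + 40 * (y * y * y) * Z) ≡
          + 40 * (y * y * y) * (+ 3 * x * S + g * (+ 6 * x * x - + 3 * x + 1ℤ) - + 3 * x * Z)
          + + 120 * x * (+ 6 * Q * C - (y * y * y * S - Q * x * y))
          + + 360 * x * Q * (+ 2 * W - (+ 14 * (x * x) + + 12 * x * r + + 3 * r * r - + 10 * x - + 6 * r))
          + g * (+ 6 * x * x * x * (+ 120 * (+ 14 * (x * x) + + 12 * x * r + + 3 * r * r - + 10 * x - + 6 * r)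
            + + 66 * (y * y) + + 15 * y - + 40 * x * y) - + 40 * (y * y * y) * (+ 6 * x * x - + 3 * x + 1ℤ))
        ring = solve-∀
        go : ∀ x g Z S C W r y {Q} → + 2 * x * x * g ≡ Q → y ≡ + 4 * x + r →
          + 3 * x * ((+ 240 * (C + W) + + 66 * (y * y) + + 15 * y) * Q - + 40 * (y * y * y) * Z) ≡
          + 40 * (y * y * y) * (+ 3 * x * S + g * (+ 6 * x * x - + 3 * x + 1ℤ) - + 3 * x * Z)
          + + 120 * x * (+ 6 * Q * C - (y * y * y * S - Q * x * y))
          + + 360 * x * Q * (+ 2 * W - (+ 14 * (x * x) + + 12 * x * r + + 3 * r * r - + 10 * x - + 6 * r))
          + g * lowerPoly x r
        go x g Z S C W r _ refl refl = ring x g Z S C W r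

    T-small : ∀ x → x < 31 → suc x ≤ R → T R x ≡ lattice (suc x) 31 (suc x)
    T-small x x<31 y≤R = trans (T-lattice R 31 x (ℕ.<⇒≤ x<31)) (lattice-extend 31 (suc x) (ℕ.n≤1+n (suc x)) y≤R)

    -- With ζ(2) replaced by 473/288 or 1895/1152, whichever is worse, neither R nor Z occurs any
    -- more and the cases can be decided by evaluation.
    smallBounds : ℕ → Set
    smallBounds x =
      + 288 * (+ 56 * (X x * X x) + + 240 * lattice (suc x) 31 (suc x)) ≤ℤ + 473 * (+ 40 * (X x * X x * X x)) ×
      + 1895 * (+ 40 * (X x * X x * X x)) ≤ℤ + 1152 * (+ 240 * lattice (suc x) 31 (suc x) + + 66 * (X x * X x) + + 15 * X x)

    smallBounds? : ∀ x → Dec (smallBounds x)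
    smallBounds? x =
      (+ 288 * (+ 56 * (X x * X x) + + 240 * lattice (suc x) 31 (suc x)) ℤ.≤? + 473 * (+ 40 * (X x * X x * X x))) ×-dec
      (+ 1895 * (+ 40 * (X x * X x * X x)) ℤ.≤? + 1152 * (+ 240 * lattice (suc x) 31 (suc x) + + 66 * (X x * X x) + + 15 * X x))

    small : ∀ {x} → x < 31 → smallBounds x
    small = toWitness {a? = ℕ.allUpTo? smallBounds? 31} tt

    upper-small : ∀ x → x < 31 → suc x ≤ R → Upper x
    upper-small x x<31 y≤R = subst (λ z → 0ℤ ≤ℤ + 40 * (X x * X x * X x) * Z - (+ 56 * (X x * X x) + + 240 * z) * Q) (sym (T-small x x<31 y≤R))
      (*-cancel-nonneg {+ 288} (ℤ.+<+ (s≤s z≤n)) (nonneg (+-nonneg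
        (*-nonneg (*-nonneg (0≤+ 40) (*-nonneg (*-nonneg (0≤+ (suc x)) (0≤+ (suc x))) (0≤+ (suc x)))) (to-nonneg Z-lower))
        (*-nonneg Q≥0 (to-nonneg (proj₁ (small x<31)))))
        (e (+ 288) (+ 473) (+ 40 * (X x * X x * X x)) (+ 56 * (X x * X x) + + 240 * lattice (suc x) 31 (suc x)) Q Z)))
      where
      e : ∀ c l A B Q Z → c * (A * Z - B * Q) ≡ A * (c * Z - l * Q) + Q * (l * A - c * B)
      e = solve-∀

    lower-small : ∀ x → x < 31 → suc x ≤ R → Lower x
    lower-small x x<31 y≤R = subst (λ z → 0ℤ ≤ℤ (+ 240 * z + + 66 * (X x * X x) + + 15 * X x) * Q - + 40 * (X x * X x * X x) * Z) (sym (T-small x x<31 y≤R))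
      (*-cancel-nonneg {+ 1152} (ℤ.+<+ (s≤s z≤n)) (nonneg (+-nonneg
        (*-nonneg (*-nonneg (0≤+ 40) (*-nonneg (*-nonneg (0≤+ (suc x)) (0≤+ (suc x))) (0≤+ (suc x)))) (to-nonneg Z-upper))
        (*-nonneg Q≥0 (to-nonneg (proj₂ (small x<31)))))
        (e (+ 1152) (+ 1895) (+ 40 * (X x * X x * X x)) (+ 240 * lattice (suc x) 31 (suc x) + + 66 * (X x * X x) + + 15 * X x) Q Z)))
      where
      e : ∀ c u A B Q Z → c * (B * Q - A * Z) ≡ A * (u * Q - c * Z) + Q * (c * B - u * A)
      e = solve-∀

    quarter : ∀ x → 31 ≤ x → Σ ℕ λ e → Σ ℕ λ t → suc e ≡ 8 +ℕ t × suc x ≡ 4 *ℕ suc e +ℕ suc x % 4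
    quarter x 31≤x = 7 +ℕ t , t , refl , trans (div-decompose (suc x) 3)
      (cong (_+ℕ suc x % 4) (trans (ℕ.*-comm (suc x / 4) 4) (cong (4 *ℕ_) (sym (ℕ.m+[n∸m]≡n 8≤)))))
      where
      8≤ : 8 ≤ suc x / 4
      8≤ = /-monoˡ-≤ 4 (s≤s 31≤x)
      t : ℕ
      t = suc x / 4 ∸ℕ 8

  T-upper : ∀ x → suc x ≤ R → Upper x
  T-upper x y≤R with 31 ℕ.≤? x
  ... | no 31≰x = upper-small x (ℕ.≰⇒> 31≰x) y≤R
  ... | yes 31≤x with quarter x 31≤x
  ...   | e , t , eq , x-eq = Large.upper-large e t (suc x % 4) eq (m%n<n (suc x) 4) x x-eq y≤R

  T-lower : ∀ x → suc x ≤ R → Lower x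
  T-lower x y≤R with 31 ℕ.≤? x
  ... | no 31≰x = lower-small x (ℕ.≰⇒> 31≰x) y≤R
  ... | yes 31≤x with quarter x 31≤x
  ...   | e , t , eq , x-eq = Large.lower-large e t (suc x % 4) eq (m%n<n (suc x) 4) x x-eq y≤R

  upperWeight-nonneg : ∀ x → suc x ≤ R → 0ℤ ≤ℤ upperWeight Q Z R x
  upperWeight-nonneg x y≤R = nonneg (T-upper x y≤R) (e Q Z (X x) (T R x))
    where
    e : ∀ Q Z X T → + 40 * Z * (X * X * X - X) + (+ 40 * Z + + 56 * Q) * X + - (+ 56 * Q) * (X * X + X) + - (+ 240 * Q) * T
      ≡ + 40 * (X * X * X) * Z - (+ 56 * (X * X) + + 240 * T) * Q
    e = solve-∀

  lowerWeight-nonneg : ∀ x → suc x ≤ R → 0ℤ ≤ℤ lowerWeight Q Z R x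
  lowerWeight-nonneg x y≤R = nonneg (T-lower x y≤R) (e Q Z (X x) (T R x))
    where
    e : ∀ Q Z X T → - (+ 40 * Z) * (X * X * X - X) + (- (+ 40 * Z) - + 51 * Q) * X + + 66 * Q * (X * X + X) + + 240 * Q * T
      ≡ (+ 240 * T + + 66 * (X * X) + + 15 * X) * Q - + 40 * (X * X * X) * Z
    e = solve-∀

-- A discrete Riccati barrier, for F = f(n), u = f(n) - f(n-1), v = f(n+1) - 2f(n) + f(n-1): the upper bound for v turns
-- barrier > 0 into log-concavity at n, and the lower bound for v propagates barrier > 0 to n + 1.

barrier : ℤ → ℤ → ℤ → ℤ → ℤ → ℤ → ℤ
barrier Q K P b F u = Q * P * u * u - (K * F - Q * b * u) * (F - u)

barrier⇒log-concave : ∀ Q K P b F u v → 0ℤ ≤ℤ Q * P → 0ℤ ≤ℤ F - u →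
  0ℤ ≤ℤ K * F - Q * b * u - Q * P * v → 0ℤ <ℤ barrier Q K P b F u → 0ℤ <ℤ u * u - v * (F - u)
barrier⇒log-concave Q K P b F u v QP≥0 G≥0 upper I = *-cancel-pos QP≥0 (posit (+-pos I (*-nonneg G≥0 upper)) (ring Q K P b F u v))
  where
  ring : ∀ Q K P b F u v → Q * P * (u * u - v * (F - u)) ≡
    Q * P * u * u - (K * F - Q * b * u) * (F - u) + (F - u) * (K * F - Q * b * u - Q * P * v)
  ring = solve-∀

-- Times Q M², the new barrier is the quadratic P′ X² - (K - Q b) M F X - K Q M² F² in X = Q M (u +
-- v). The lower bound for v says X ≥ w. The quadratic has the value E₀ at w, and moving on to X
-- adds (X - w)(y + P′ X).
barrier-step : ∀ Q K P P′ M b b′ F u v →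
  0ℤ <ℤ Q → 0ℤ ≤ℤ K → 0ℤ ≤ℤ F → 0ℤ ≤ℤ u → 0ℤ <ℤ M → 0ℤ <ℤ M - b → 0ℤ ≤ℤ M - b′ → 0ℤ ≤ℤ P′ → 0ℤ ≤ℤ P′ - M →
  0ℤ ≤ℤ P′ * (M - b′) * (M - b′) - M * (M - b) * (P - b) →
  0ℤ ≤ℤ K * (+ 2 * P′ * (M - b′) - M * (M - b′) - M * (M - b)) - Q * (b * (b′ - b) * M) →
  0ℤ ≤ℤ Q * b′ * u + Q * M * v - K * F →
  0ℤ <ℤ barrier Q K P b F u → 0ℤ <ℤ barrier Q K P′ b (F + (u + v)) (u + v)
barrier-step Q K P P′ M b b′ F u v Q>0 K≥0 F≥0 u≥0 M>0 M-b>0 M-b′≥0 P′≥0 P′-M≥0 c₁ c₂ lower I =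
  *-cancel-pos (*-nonneg Q≥0 (*-nonneg M≥0 M≥0)) (posit
    (+-pos E₀>0 (+-nonneg (*-nonneg lower (ℤ.<⇒≤ y>0)) (*-nonneg (*-nonneg P′≥0 x≥0) lower))) (final Q K P′ M b b′ F u v))
  where
  w y E₀ : ℤ
  w = K * F + Q * (M - b′) * u
  y = P′ * w - (K - Q * b) * M * F
  E₀ = w * y - K * Q * (M * M) * (F * F)
  Q≥0 : 0ℤ ≤ℤ Q
  Q≥0 = ℤ.<⇒≤ Q>0
  M≥0 : 0ℤ ≤ℤ M
  M≥0 = ℤ.<⇒≤ M>0
  w≥0 : 0ℤ ≤ℤ w
  w≥0 = +-nonneg (*-nonneg K≥0 F≥0) (*-nonneg (*-nonneg Q≥0 M-b′≥0) u≥0)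
  x≥0 : 0ℤ ≤ℤ Q * M * (u + v)
  x≥0 = nonneg (+-nonneg w≥0 lower) (e Q K M b′ F u v)
    where
    e : ∀ Q K M b′ F u v → Q * M * (u + v) ≡ K * F + Q * (M - b′) * u + (Q * b′ * u + Q * M * v - K * F)
    e = solve-∀
  E₀>0 : 0ℤ <ℤ E₀
  -- The old barrier reappears with a positive factor; the remainder is a quadratic form in u and F
  -- whose coefficients of u², u F and F² are controlled by `c₁`, `c₂` and P′ - M.
  E₀>0 = posit (+-pos (+-pos (+-pos (*-pos (*-pos (*-pos Q>0 M>0) M-b>0) I)
      (*-nonneg (*-nonneg (*-nonneg Q≥0 Q≥0) (*-nonneg u≥0 u≥0)) c₁))
      (*-nonneg (*-nonneg (*-nonneg Q≥0 u≥0) F≥0) c₂))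
      (*-nonneg (*-nonneg (*-nonneg K≥0 K≥0) (*-nonneg F≥0 F≥0)) P′-M≥0))
    (ring Q K P P′ M b b′ F u)
    where
    ring : ∀ Q K P P′ M b b′ F u →
      (K * F + Q * (M - b′) * u) * (P′ * (K * F + Q * (M - b′) * u) - (K - Q * b) * M * F) - K * Q * (M * M) * (F * F) ≡
      Q * M * (M - b) * (Q * P * u * u - (K * F - Q * b * u) * (F - u))
      + Q * Q * (u * u) * (P′ * (M - b′) * (M - b′) - M * (M - b) * (P - b))
      + Q * u * F * (K * (+ 2 * P′ * (M - b′) - M * (M - b′) - M * (M - b)) - Q * (b * (b′ - b) * M))
      + K * K * (F * F) * (P′ - M)
    ring = solve-∀
  y>0 : 0ℤ <ℤ y
  -- Since E₀ is positive, w y exceeds K Q M² F² ≥ 0, and w is nonnegative.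
  y>0 = *-cancel-pos w≥0 (posit (+-pos E₀>0 (*-nonneg (*-nonneg (*-nonneg K≥0 Q≥0) (*-nonneg M≥0 M≥0)) (*-nonneg F≥0 F≥0)))
    (e (w * y) (K * Q * (M * M) * (F * F))))
    where
    e : ∀ a c → a ≡ a - c + c
    e = solve-∀
  final : ∀ Q K P′ M b b′ F u v → Q * (M * M) * (Q * P′ * (u + v) * (u + v) - (K * (F + (u + v)) - Q * b * (u + v)) * (F + (u + v) - (u + v))) ≡
    (K * F + Q * (M - b′) * u) * (P′ * (K * F + Q * (M - b′) * u) - (K - Q * b) * M * F) - K * Q * (M * M) * (F * F)
    + ((Q * b′ * u + Q * M * v - K * F) * (P′ * (K * F + Q * (M - b′) * u) - (K - Q * b) * M * F)
    + P′ * (Q * M * (u + v)) * (Q * b′ * u + Q * M * v - K * F))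
  final = solve-∀

-- Difference inequalities and the barrier for k colours

prod-nonneg : ∀ L n → 0ℤ ≤ℤ prod L n
prod-nonneg [] zero = 0≤+ 1
prod-nonneg [] (suc n) = 0≤+ 0
prod-nonneg (d ∷ L) = geo-nonneg (suc d) (prod-nonneg L)

-- fᵢ is (1-q)ⁱ times the generating function for j + 3 colours.

module Differences (j M : ℕ) (f₄ c : Series)
  (f₃-eq : ∀ n → geo 1 f₄ n ≡ prod (replicate j 0 ++ bigParts (3 +ℕ j) M) n) (4≤R : 4 ≤ suc M) where

  open Zeta (zeta M) using (Q; Z; Q-pos) public
  open ZetaBounds (zeta M) 4≤R public
  open TBounds (zeta M) 4≤R using (upperWeight-nonneg; lowerWeight-nonneg) public

  R : ℕ
  R = suc M
  f₀ f₁ f₂ f₃ : Series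
  f₃ = prod (replicate j 0 ++ bigParts (3 +ℕ j) M)
  f₂ = geo 1 f₃
  f₁ = geo 1 f₂
  f₀ = geo 1 f₁
  k : ℤ
  k = + (3 +ℕ j)
  τ : Series
  τ = conv (T R) f₄

  recurrence : ∀ n → + n * f₂ n ≡ k * τ n - + 2 * sh f₁ n
  recurrence n = trans (θ-colouredParts (suc j) M n) (cong (λ t → k * t - + 2 * sh f₁ n) (sym (trans (conv-T R f₄ n)
    (∑-cong R λ i → cong (λ t → + suc i * t) (shift-cong (suc i) (geo-cong (suc i) (geo-cong 1 f₃-eq)) n)))))

  conv-weight′ : ∀ a b c d n → conv (weight a b c d R) f₄ n ≡
    + 6 * a * sh f₀ n + b * f₂ n + + 2 * c * (sh f₁ n + f₂ n) + d * τ n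
  conv-weight′ a b c d n = trans (conv-weight a b c d R f₄ n) (cong (_+ d * τ n) (cong₂ _+_ (cong₂ _+_
    (cong (λ t → + 6 * a * t) (sh-cong (geo-cong 1 (geo-cong 1 (geo-cong 1 f₃-eq))) n))
    (cong (λ t → b * t) (geo-cong 1 f₃-eq n)))
    (cong (λ t → + 2 * c * t) (trans (geo-cong 1 (geo-cong 1 f₃-eq) n) (trans (geo-one f₂ n) (ℤ.+-comm (f₂ n) (sh f₁ n)))))))

  upper-ineq : ∀ n → 0ℤ ≤ℤ conv (upperWeight Q Z R) f₄ n + c n →
    0ℤ ≤ℤ + 240 * k * Z * sh f₀ n - (+ 112 * k + + 480) * Q * sh f₁ n - (+ 240 * + n - + 10 * k) * Q * f₂ n + k * c n
  upper-ineq n h = upper-difference Q Z k (+ n) (sh f₀ n) (sh f₁ n) (f₂ n) (τ n) (c n)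
    Q≥0 (0≤+ _) (prod-nonneg (replicate (suc j) 0 ++ bigParts (3 +ℕ j) M) n) (recurrence n)
    (rescale-≤ 1152 1895 100 165 Q≥0 (s≤s z≤n) (ℕ.≤ᵇ⇒≤ _ _ tt) Z-upper)
    (subst (λ t → 0ℤ ≤ℤ t + c n) (conv-weight′ (+ 40 * Z) (+ 40 * Z + + 56 * Q) (- (+ 56 * Q)) (- (+ 240 * Q)) n) h)

  lower-ineq : ∀ n → 0ℤ ≤ℤ conv (lowerWeight Q Z R) f₄ n + c n →
    0ℤ ≤ℤ (+ 132 * k + + 480) * Q * sh f₁ n + (+ 240 * + n + + 16 * k) * Q * f₂ n - + 240 * k * Z * sh f₀ n + k * c n
  lower-ineq n h = lower-difference Q Z k (+ n) (sh f₀ n) (sh f₁ n) (f₂ n) (τ n) (c n)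
    Q≥0 (0≤+ _) (prod-nonneg (replicate (suc j) 0 ++ bigParts (3 +ℕ j) M) n) (recurrence n)
    (rescale-≥ 288 473 100 164 Q≥0 (s≤s z≤n) (ℕ.≤ᵇ⇒≤ _ _ tt) Z-lower)
    (subst (λ t → 0ℤ ≤ℤ t + c n) (conv-weight′ (- (+ 40 * Z)) (- (+ 40 * Z) - + 51 * Q) (+ 66 * Q) (+ 240 * Q) n) h)

  convs-nonneg : ∀ a n → n < R → (∀ i → i ≤ n → 0ℤ ≤ℤ a i) →
    0ℤ ≤ℤ conv (upperWeight Q Z R) a n × 0ℤ ≤ℤ conv (lowerWeight Q Z R) a n
  convs-nonneg a n n<R a≥0 =
    conv-nonneg n (λ i i≤n → upperWeight-nonneg i (ℕ.≤-trans (s≤s i≤n) n<R)) a≥0 ,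
    conv-nonneg n (λ i i≤n → lowerWeight-nonneg i (ℕ.≤-trans (s≤s i≤n) n<R)) a≥0

  -- With σ = 120/k, upper and lower are upper-ineq and lower-ineq divided by 2k; ε absorbs the defect c into a multiple of f₁.
  -- The size conditions c₁, c₂, c₃ limit the method to k ≤ 5.

  module Barrier (n₀ σ P₀ M₀ b b′ : ℕ)
    (b<M₀ : b < M₀) (b′≤M₀ : b′ ≤ M₀) (M₀≤P₀+σ : M₀ ≤ P₀ +ℕ σ)
    (c₁ : ∀ T → 0ℤ ≤ℤ T → 0ℤ ≤ℤ (+ P₀ + + σ * (1ℤ + T)) * ((+ M₀ + + σ * T) - + b′) * ((+ M₀ + + σ * T) - + b′) - (+ M₀ + + σ * T) * ((+ M₀ + + σ * T) - + b) * ((+ P₀ + + σ * T) - + b))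
    (c₂ : ∀ T → 0ℤ ≤ℤ T → 0ℤ ≤ℤ (+ 2 * (+ P₀ + + σ * (1ℤ + T)) * ((+ M₀ + + σ * T) - + b′) - (+ M₀ + + σ * T) * ((+ M₀ + + σ * T) - + b′) - (+ M₀ + + σ * T) * ((+ M₀ + + σ * T) - + b)))
    (c₃ : ∀ T → 0ℤ ≤ℤ T → 0ℤ ≤ℤ + 196 * (+ 2 * (+ P₀ + + σ * (1ℤ + T)) * ((+ M₀ + + σ * T) - + b′) - (+ M₀ + + σ * T) * ((+ M₀ + + σ * T) - + b′) - (+ M₀ + + σ * T) * ((+ M₀ + + σ * T) - + b)) - + b * (+ b′ - + b) * (+ M₀ + + σ * T))
    (ε : ℕ) (kσ≡120 : k * + σ ≡ + 120)
    (P₀-eq : + P₀ ≡ + suc n₀ * + σ - + 5 - + ε) (M₀-eq : + M₀ ≡ + suc n₀ * + σ + + 8 + + ε)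
    (b-eq : + b ≡ + 56 + + 2 * + σ - + ε) (b′-eq : + b′ ≡ + 66 + + 2 * + σ + + ε)
    (weights≥0 : ∀ n → n < R → 0ℤ ≤ℤ conv (upperWeight Q Z R) f₄ n + c n × 0ℤ ≤ℤ conv (lowerWeight Q Z R) f₄ n + c n)
    (defect≤ : ∀ n → n₀ < n → n < R → c n ≤ℤ + 2 * + ε * Q * f₁ n)
    (base : 0ℤ <ℤ + P₀ * (f₁ n₀ * f₁ n₀) + + b * (f₁ n₀ * (f₀ n₀ - f₁ n₀)) - + 198 * (f₀ n₀ * (f₀ n₀ - f₁ n₀))) where

    private
      f₀≥0 : ∀ n → 0ℤ ≤ℤ f₀ n
      f₀≥0 = prod-nonneg (replicate (3 +ℕ j) 0 ++ bigParts (3 +ℕ j) M)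
      f₁≥0 : ∀ n → 0ℤ ≤ℤ f₁ n
      f₁≥0 = prod-nonneg (replicate (2 +ℕ j) 0 ++ bigParts (3 +ℕ j) M)
      f₀-f₁ : ∀ n → f₀ n - f₁ n ≡ sh f₀ n
      f₀-f₁ n = trans (cong (_- f₁ n) (geo-one f₁ n)) (e (f₁ n) (sh f₀ n))
        where
        e : ∀ a b → a + b - a ≡ b
        e = solve-∀
      G≥0 : ∀ n → 0ℤ ≤ℤ f₀ n - f₁ n
      G≥0 n = nonneg (shift-nonneg 1 f₀≥0 n) (f₀-f₁ n)
      K≥0 : 0ℤ ≤ℤ + 120 * Z
      K≥0 = *-nonneg (0≤+ 120) (*-cancel-nonneg {+ 288} (ℤ.+<+ (s≤s z≤n)) (ℤ.≤-trans (*-nonneg (0≤+ 473) Q≥0) Z-lower))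
      m-eq : ∀ t → + suc (t +ℕ n₀) ≡ + suc n₀ + + t
      m-eq t = trans (cong +_ (ℕ.+-comm (suc t) n₀)) (trans (cong +_ (ℕ.+-suc n₀ t)) (ℤ.pos-+ (suc n₀) t))
      f₁-suc : ∀ n → f₁ (suc n) ≡ f₁ n + f₂ (suc n)
      f₁-suc n = trans (geo-one f₂ (suc n)) (ℤ.+-comm (f₂ (suc n)) (f₁ n))

      upper : ∀ t → suc (t +ℕ n₀) < R → 0ℤ ≤ℤ + 120 * Z * f₀ (t +ℕ n₀) - Q * + b * f₁ (t +ℕ n₀) - Q * (+ P₀ + + σ * (+ t)) * f₂ (suc (t +ℕ n₀))
      upper t t< = *-cancel-nonneg {+ 2 * k} (ℤ.+<+ (s≤s z≤n)) (nonneg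
        (+-nonneg (upper-ineq n (proj₁ (weights≥0 n t<))) (*-nonneg (0≤+ (3 +ℕ j)) (to-nonneg (defect≤ n (s≤s (ℕ.m≤n+m n₀ t)) t<))))
        (go k (+ suc n₀) (+ n) (+ t) (+ σ) (+ ε) (+ P₀) (+ b) Q Z (f₀ (t +ℕ n₀)) (f₁ (t +ℕ n₀)) (f₂ n) (c n) P₀-eq b-eq (m-eq t) kσ≡120 (f₁-suc (t +ℕ n₀))))
        where
        n : ℕ
        n = suc (t +ℕ n₀)
        ring : ∀ k N T σ ε Q Z F u v c → + 2 * k * (+ 120 * Z * F - Q * (+ 56 + + 2 * σ - ε) * u - Q * (N * σ - + 5 - ε + σ * T) * v) ≡
          + 240 * k * Z * F - (+ 112 * k + + 480) * Q * u - (+ 240 * (N + T) - + 10 * k) * Q * v + k * c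
          + k * (+ 2 * ε * Q * (u + v) - c) + (+ 4 * u + + 2 * (N + T) * v) * Q * (+ 120 - k * σ)
        ring = solve-∀
        go : ∀ k N m T σ ε P b Q Z F u v c {f₁} → P ≡ N * σ - + 5 - ε → b ≡ + 56 + + 2 * σ - ε → m ≡ N + T → k * σ ≡ + 120 → f₁ ≡ u + v →
          + 2 * k * (+ 120 * Z * F - Q * b * u - Q * (P + σ * T) * v) ≡
          + 240 * k * Z * F - (+ 112 * k + + 480) * Q * u - (+ 240 * m - + 10 * k) * Q * v + k * c + k * (+ 2 * ε * Q * f₁ - c)
        go k N _ T σ ε _ _ Q Z F u v c refl refl refl kσ refl = trans (ring k N T σ ε Q Z F u v c)
          (+-vanish A ((+ 4 * u + + 2 * (N + T) * v) * Q) (ℤ.i≡j⇒i-j≡0 (sym kσ)))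
          where
          A : ℤ
          A = + 240 * k * Z * F - (+ 112 * k + + 480) * Q * u - (+ 240 * (N + T) - + 10 * k) * Q * v + k * c + k * (+ 2 * ε * Q * (u + v) - c)

      lower : ∀ t → suc (t +ℕ n₀) < R → 0ℤ ≤ℤ Q * + b′ * f₁ (t +ℕ n₀) + Q * (+ M₀ + + σ * (+ t)) * f₂ (suc (t +ℕ n₀)) - + 120 * Z * f₀ (t +ℕ n₀)
      lower t t< = *-cancel-nonneg {+ 2 * k} (ℤ.+<+ (s≤s z≤n)) (nonneg
        (+-nonneg (lower-ineq n (proj₂ (weights≥0 n t<))) (*-nonneg (0≤+ (3 +ℕ j)) (to-nonneg (defect≤ n (s≤s (ℕ.m≤n+m n₀ t)) t<))))
        (go k (+ suc n₀) (+ n) (+ t) (+ σ) (+ ε) (+ M₀) (+ b′) Q Z (f₀ (t +ℕ n₀)) (f₁ (t +ℕ n₀)) (f₂ n) (c n) M₀-eq b′-eq (m-eq t) kσ≡120 (f₁-suc (t +ℕ n₀))))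
        where
        n : ℕ
        n = suc (t +ℕ n₀)
        ring : ∀ k N T σ ε Q Z F u v c → + 2 * k * (Q * (+ 66 + + 2 * σ + ε) * u + Q * (N * σ + + 8 + ε + σ * T) * v - + 120 * Z * F) ≡
          (+ 132 * k + + 480) * Q * u + (+ 240 * (N + T) + + 16 * k) * Q * v - + 240 * k * Z * F + k * c
          + k * (+ 2 * ε * Q * (u + v) - c) + - (+ 4 * u + + 2 * (N + T) * v) * Q * (+ 120 - k * σ)
        ring = solve-∀
        go : ∀ k N m T σ ε P b Q Z F u v c {f₁} → P ≡ N * σ + + 8 + ε → b ≡ + 66 + + 2 * σ + ε → m ≡ N + T → k * σ ≡ + 120 → f₁ ≡ u + v →
          + 2 * k * (Q * b * u + Q * (P + σ * T) * v - + 120 * Z * F) ≡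
          (+ 132 * k + + 480) * Q * u + (+ 240 * m + + 16 * k) * Q * v - + 240 * k * Z * F + k * c + k * (+ 2 * ε * Q * f₁ - c)
        go k N _ T σ ε _ _ Q Z F u v c refl refl refl kσ refl = trans (ring k N T σ ε Q Z F u v c)
          (+-vanish A (- (+ 4 * u + + 2 * (N + T) * v) * Q) (ℤ.i≡j⇒i-j≡0 (sym kσ)))
          where
          A : ℤ
          A = (+ 132 * k + + 480) * Q * u + (+ 240 * (N + T) + + 16 * k) * Q * v - + 240 * k * Z * F + k * c + k * (+ 2 * ε * Q * (u + v) - c)

      suc-T : ∀ t → + suc t ≡ 1ℤ + + t
      suc-T t = ℤ.pos-+ 1 t

    barrier-holds : ∀ t → t +ℕ n₀ < R → 0ℤ <ℤ barrier Q (+ 120 * Z) ((+ P₀ + + σ * (+ t))) (+ b) (f₀ (t +ℕ n₀)) (f₁ (t +ℕ n₀))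
    -- Replacing 120 ζ(2) by its upper bound 198 only lowers the barrier and makes the start a
    -- statement about numerals.
    barrier-holds zero _ = posit (+-pos (*-pos Q-pos base)
      (*-nonneg (to-nonneg (rescale-≤ 1152 1895 120 198 Q≥0 (s≤s z≤n) (ℕ.≤ᵇ⇒≤ _ _ tt) Z-upper)) (*-nonneg (f₀≥0 n₀) (G≥0 n₀))))
      (trans (cong (λ P → barrier Q (+ 120 * Z) P (+ b) (f₀ n₀) (f₁ n₀)) (+-vanish (+ P₀) (+ σ) {+ zero} refl))
        (ring Q Z (+ P₀) (+ b) (f₀ n₀) (f₁ n₀)))
      where
      ring : ∀ Q Z P b F u → Q * P * u * u - (+ 120 * Z * F - Q * b * u) * (F - u) ≡
        Q * (P * (u * u) + b * (u * (F - u)) - + 198 * (F * (F - u))) + (+ 198 * Q - + 120 * Z) * (F * (F - u))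
      ring = solve-∀
    barrier-holds (suc t) t< = subst₂ (λ F u → 0ℤ <ℤ barrier Q (+ 120 * Z) ((+ P₀ + + σ * (+ suc t))) (+ b) F u) F-eq u-eq
      (subst (λ T → 0ℤ <ℤ barrier Q (+ 120 * Z) (+ P₀ + + σ * T) (+ b) (f₀ n + (f₁ n + f₂ (suc n))) (f₁ n + f₂ (suc n))) (sym (suc-T t))
        (barrier-step Q (+ 120 * Z) ((+ P₀ + + σ * (+ t))) ((+ P₀ + + σ * (1ℤ + (+ t)))) ((+ M₀ + + σ * (+ t))) (+ b) (+ b′) (f₀ n) (f₁ n) (f₂ (suc n))
          Q-pos K≥0 (f₀≥0 n) (f₁≥0 n) N>0 N-b>0 N-b′≥0 P′≥0 P′-N≥0 (c₁ (+ t) T≥0)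
          -- The lower bound 196 for 120 ζ(2) splits the condition into the parts `c₂` and `c₃`,
          -- which do not mention Z.
          (nonneg (+-nonneg (*-nonneg (to-nonneg (rescale-≥ 288 473 120 196 Q≥0 (s≤s z≤n) (ℕ.≤ᵇ⇒≤ _ _ tt) Z-lower)) (c₂ (+ t) T≥0)) (*-nonneg Q≥0 (c₃ (+ t) T≥0)))
            (e Q (+ 120 * Z) ((+ 2 * (+ P₀ + + σ * (1ℤ + (+ t))) * ((+ M₀ + + σ * (+ t)) - + b′) - (+ M₀ + + σ * (+ t)) * ((+ M₀ + + σ * (+ t)) - + b′) - (+ M₀ + + σ * (+ t)) * ((+ M₀ + + σ * (+ t)) - + b))) (+ b * (+ b′ - + b) * (+ M₀ + + σ * (+ t)))))
          (lower t t<) (barrier-holds t (ℕ.<⇒≤ t<))))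
      where
      n : ℕ
      n = t +ℕ n₀
      T≥0 : 0ℤ ≤ℤ + t
      T≥0 = 0≤+ t
      σT≥0 : 0ℤ ≤ℤ + σ * + t
      σT≥0 = *-nonneg (0≤+ σ) T≥0
      N>0 : 0ℤ <ℤ (+ M₀ + + σ * (+ t))
      N>0 = +-pos (ℤ.+<+ (ℕ.≤-trans (s≤s z≤n) b<M₀)) σT≥0
      minus : ∀ m s b → m + s - b ≡ m - b + s
      minus = solve-∀
      N-b>0 : 0ℤ <ℤ (+ M₀ + + σ * (+ t)) - + b
      N-b>0 = posit (+-pos (to-pos (ℤ.+<+ b<M₀)) σT≥0) (minus (+ M₀) (+ σ * + t) (+ b))
      N-b′≥0 : 0ℤ ≤ℤ (+ M₀ + + σ * (+ t)) - + b′
      N-b′≥0 = nonneg (+-nonneg (to-nonneg (ℤ.+≤+ b′≤M₀)) σT≥0) (minus (+ M₀) (+ σ * + t) (+ b′))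
      P′≥0 : 0ℤ ≤ℤ (+ P₀ + + σ * (1ℤ + (+ t)))
      P′≥0 = +-nonneg (0≤+ P₀) (*-nonneg (0≤+ σ) (+-nonneg (0≤+ 1) T≥0))
      P′-N≥0 : 0ℤ ≤ℤ (+ P₀ + + σ * (1ℤ + (+ t))) - (+ M₀ + + σ * (+ t))
      P′-N≥0 = nonneg (to-nonneg (subst (+ M₀ ≤ℤ_) (ℤ.pos-+ P₀ σ) (ℤ.+≤+ M₀≤P₀+σ))) (d (+ P₀) (+ σ) (+ t) (+ M₀))
        where
        d : ∀ P s t m → P + s * (1ℤ + t) - (m + s * t) ≡ P + s - m
        d = solve-∀
      e : ∀ Q K W c → K * W - Q * c ≡ (K - + 196 * Q) * W + Q * (+ 196 * W - c)
      e = solve-∀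
      u-eq : f₁ n + f₂ (suc n) ≡ f₁ (suc n)
      u-eq = trans (ℤ.+-comm (f₁ n) (f₂ (suc n))) (sym (geo-one f₂ (suc n)))
      F-eq : f₀ n + (f₁ n + f₂ (suc n)) ≡ f₀ (suc n)
      F-eq = trans (cong (λ t → f₀ n + t) u-eq) (trans (ℤ.+-comm (f₀ n) (f₁ (suc n))) (sym (geo-one f₁ (suc n))))

    log-concave : ∀ t → suc (t +ℕ n₀) < R → sh f₀ (t +ℕ n₀) * f₀ (suc (t +ℕ n₀)) <ℤ f₀ (t +ℕ n₀) * f₀ (t +ℕ n₀)
    log-concave t t< = from-pos (posit (barrier⇒log-concave Q (+ 120 * Z) ((+ P₀ + + σ * (+ t))) (+ b) (f₀ n) (f₁ n) (f₂ (suc n))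
        (*-nonneg Q≥0 (+-nonneg (0≤+ P₀) (*-nonneg (0≤+ σ) (0≤+ t)))) (G≥0 n) (upper t t<) (barrier-holds t (ℕ.<⇒≤ t<)))
      (trans (cong₂ (λ a c → f₀ n * f₀ n - a * c) (sym (f₀-f₁ n)) F-eq) (ring (f₀ n) (f₁ n) (f₂ (suc n)))))
      where
      n : ℕ
      n = t +ℕ n₀
      F-eq : f₀ (suc n) ≡ f₀ n + (f₁ n + f₂ (suc n))
      F-eq = trans (geo-one f₁ (suc n)) (trans (ℤ.+-comm (f₁ (suc n)) (f₀ n)) (cong (λ t → f₀ n + t) (trans (geo-one f₂ (suc n)) (ℤ.+-comm (f₂ (suc n)) (f₁ n)))))
      ring : ∀ F u v → F * F - (F - u) * (F + (u + v)) ≡ u * u - v * (F - u)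
      ring = solve-∀

-- Values for small n

at : List ℕ → ℕ → ℕ
at [] _ = 0
at (x ∷ _) zero = x
at (_ ∷ xs) (suc n) = at xs n

table : ℕ → List ℕ
table 0 = 1 ∷ []
table 1 = 1 ∷ 1 ∷ 2 ∷ 3 ∷ 5 ∷ 7 ∷ 11 ∷ 15 ∷ 22 ∷ 30 ∷ 42 ∷ 56 ∷ 77 ∷ 101 ∷ 135 ∷ 176 ∷ []
table 2 = 1 ∷ 2 ∷ 5 ∷ 10 ∷ 20 ∷ 36 ∷ 65 ∷ 110 ∷ 185 ∷ 300 ∷ 481 ∷ 752 ∷ 1165 ∷ 1770 ∷ 2665 ∷ 3956 ∷ []
table 3 = 1 ∷ 3 ∷ 9 ∷ 22 ∷ 51 ∷ 108 ∷ 221 ∷ 429 ∷ 810 ∷ 1479 ∷ 2640 ∷ 4599 ∷ 7868 ∷ 13209 ∷ 21843 ∷ 35581 ∷ []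
table 4 = 1 ∷ 4 ∷ 14 ∷ 40 ∷ 105 ∷ 252 ∷ 574 ∷ 1240 ∷ 2580 ∷ 5180 ∷ 10108 ∷ 19208 ∷ 35693 ∷ 64960 ∷ 116090 ∷ 203984 ∷ []
table 5 = 1 ∷ 5 ∷ 20 ∷ 65 ∷ 190 ∷ 506 ∷ 1265 ∷ 2990 ∷ 6765 ∷ 14725 ∷ 31027 ∷ 63505 ∷ 126730 ∷ 247170 ∷ 472295 ∷ 885723 ∷ []
table (suc (suc (suc (suc (suc (suc _)))))) = []

row-sum : (ℕ → ℕ) → (ℕ → ℕ) → ℕ → ℕ
row-sum a b n = sum (map (λ i → a i *ℕ b (n ∸ℕ i)) (upTo (suc n)))

row-sum-cong : ∀ {a a' b b'} n → (∀ i → i ≤ n → a i ≡ a' i) → (∀ i → i ≤ n → b i ≡ b' i) → row-sum a b n ≡ row-sum a' b' n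
row-sum-cong {a} {a'} {b} {b'} n h k = ℤ.+-injective (trans (sum-upTo (λ i → a i *ℕ b (n ∸ℕ i)) (suc n))
  (trans (∑-cong< (suc n) λ { i (s≤s i≤n) → cong +_ (cong₂ _*ℕ_ (h i i≤n) (k (n ∸ℕ i) (ℕ.m∸n≤m n i))) })
    (sym (sum-upTo (λ i → a' i *ℕ b' (n ∸ℕ i)) (suc n)))))

p1-table : ∀ {n} → n < 16 → p1 n ≡ at (table 1) n
p1-table = toWitness {a? = ℕ.allUpTo? (λ n → p1 n ℕ.≟ at (table 1) n) 16} tt

row-table : ∀ {k} → k < 5 → ∀ {n} → n < 16 → row-sum (at (table k)) (at (table 1)) n ≡ at (table (suc k)) n
row-table = toWitness {a? = ℕ.allUpTo? (λ k → ℕ.allUpTo? (λ n → row-sum (at (table k)) (at (table 1)) n ℕ.≟ at (table (suc k)) n) 16) 5} tt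

-- Each row of the table is checked as the convolution of the preceding row with row 1, so the
-- nested sums in `p` are never unfolded.
p-table : ∀ k n → k ≤ 5 → n < 16 → p k n ≡ at (table k) n
p-table zero zero _ _ = refl
p-table zero (suc n) _ _ = refl
p-table (suc k) n k<5 n<16 = trans
  (row-sum-cong n (λ i i≤n → p-table k i (ℕ.<⇒≤ k<5) (ℕ.≤-trans (s≤s i≤n) n<16)) (λ i i≤n → p1-table (ℕ.≤-trans (s≤s i≤n) n<16)))
  (row-table k<5 n<16)

-- Raising a largest part by one is injective on partitions with parts ≥ 2, that is q (h - 1) ≤ h - 1 for their generating function h.

bigProd : ℕ → Series
bigProd M = prod (bigParts 3 M)

shift-mono : ∀ d {a b} → (∀ n → a n ≤ℤ b n) → ∀ n → shift d a n ≤ℤ shift d b n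
shift-mono zero h n = h n
shift-mono (suc d) h zero = ℤ.≤-refl
shift-mono (suc d) h (suc n) = shift-mono d h n

≤-geo : ∀ d {a} → (∀ n → 0ℤ ≤ℤ a n) → ∀ n → a n ≤ℤ geo (suc d) a n
≤-geo d {a} a≥0 n = from-nonneg (nonneg (shift-nonneg (suc d) (geo-nonneg (suc d) a≥0) n)
  (trans (cong (_- a n) (geo-unfold d a n)) (e (a n) (shift (suc d) (geo (suc d) a) n))))
  where
  e : ∀ x y → x + y - x ≡ y
  e = solve-∀

-- With y = 1/(1-x), y³ = 1 + x (y + y² + y³). This separates the partitions that contain a given
-- part size from those that do not; the bracket is `geo-powers`.
geo-powers : ℕ → Series → Series
geo-powers d a n = geo (suc d) a n + geo (suc d) (geo (suc d) a) n + geo (suc d) (geo (suc d) (geo (suc d) a)) n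

geo³ : ∀ d a n → geo (suc d) (geo (suc d) (geo (suc d) a)) n ≡ a n + shift (suc d) (geo-powers d a) n
geo³ d a n = begin
  g₃ n                                                              ≡⟨ geo-unfold d g₂ n ⟩
  g₂ n + s g₃                                                       ≡⟨ cong (_+ s g₃) (trans (geo-unfold d g₁ n) (cong (_+ s g₂) (geo-unfold d a n))) ⟩
  a n + s g₁ + s g₂ + s g₃                                          ≡⟨ e (a n) (s g₁) (s g₂) (s g₃) ⟩
  a n + (s g₁ + s g₂ + s g₃)                                        ≡⟨ cong (λ t → a n + t) (sym (trans (shift-add (suc d) (λ m → g₁ m + g₂ m) g₃ n) (cong (_+ s g₃) (shift-add (suc d) g₁ g₂ n)))) ⟩
  a n + shift (suc d) (geo-powers d a) n                            ∎
  where
  g₁ g₂ g₃ : Series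
  g₁ = geo (suc d) a
  g₂ = geo (suc d) g₁
  g₃ = geo (suc d) g₂
  s : Series → ℤ
  s b = shift (suc d) b n
  e : ∀ a x y z → a + x + y + z ≡ a + (x + y + z)
  e = solve-∀

-- Each term on the right carries all factors of its counterpart and more, and a further factor 1/(1
-- - q^i) only raises nonnegative coefficients.
geo-powers-mono : ∀ d a → (∀ n → 0ℤ ≤ℤ a n) → ∀ n →
  geo-powers d a n ≤ℤ geo-powers (suc d) (geo (suc d) (geo (suc d) (geo (suc d) a))) n
geo-powers-mono d a a≥0 n = ℤ.+-mono-≤ (ℤ.+-mono-≤
    (ℤ.≤-trans (≤-geo d g₁≥0 n) (ℤ.≤-trans (≤-geo d g₂≥0 n) (≤-geo (suc d) g₃≥0 n)))
    (ℤ.≤-trans (≤-geo d g₂≥0 n) (ℤ.≤-trans (≤-geo (suc d) g₃≥0 n) (≤-geo (suc d) (geo-nonneg (2 +ℕ d) g₃≥0) n))))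
    (ℤ.≤-trans (≤-geo (suc d) g₃≥0 n) (ℤ.≤-trans (≤-geo (suc d) (geo-nonneg (2 +ℕ d) g₃≥0) n)
      (≤-geo (suc d) (geo-nonneg (2 +ℕ d) (geo-nonneg (2 +ℕ d) g₃≥0)) n)))
  where
  g₁≥0 : ∀ n → 0ℤ ≤ℤ geo (suc d) a n
  g₁≥0 = geo-nonneg (suc d) a≥0
  g₂≥0 : ∀ n → 0ℤ ≤ℤ geo (suc d) (geo (suc d) a) n
  g₂≥0 = geo-nonneg (suc d) g₁≥0
  g₃≥0 : ∀ n → 0ℤ ≤ℤ geo (suc d) (geo (suc d) (geo (suc d) a)) n
  g₃≥0 = geo-nonneg (suc d) g₂≥0

enlarge : ∀ M n → 0ℤ ≤ℤ (bigProd (suc M) n - δ₀ n) - (sh (bigProd M) n - sh δ₀ n)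
enlarge zero n = nonneg (shift-nonneg 2 powers≥0 n)
  (trans (cong (λ t → t - δ₀ n - (sh δ₀ n - sh δ₀ n)) (geo³ 1 δ₀ n)) (e (δ₀ n) (sh δ₀ n) (shift 2 (geo-powers 1 δ₀) n)))
  where
  δ≥0 : ∀ n → 0ℤ ≤ℤ δ₀ n
  δ≥0 = prod-nonneg []
  powers≥0 : ∀ n → 0ℤ ≤ℤ geo-powers 1 δ₀ n
  powers≥0 n = +-nonneg (+-nonneg (geo-nonneg 2 δ≥0 n) (geo-nonneg 2 (geo-nonneg 2 δ≥0) n)) (geo-nonneg 2 (geo-nonneg 2 (geo-nonneg 2 δ≥0)) n)
  e : ∀ d s x → d + x - d - (s - s) ≡ x
  e = solve-∀
-- The partitions with largest part M + 3 are set against those with largest part M + 2, raised by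
-- one: both carry the power q^(M+3).
enlarge (suc M) n = nonneg (+-nonneg (enlarge M n) (to-nonneg (shift-mono (3 +ℕ M) (geo-powers-mono (suc M) (bigProd M) (prod-nonneg (bigParts 3 M))) n)))
  (trans (cong₂ (λ a b → a - δ₀ n - (b - sh δ₀ n)) (geo³ (2 +ℕ M) (bigProd (suc M)) n)
    (trans (sh-cong (geo³ (suc M) (bigProd M)) n) (sh-add (bigProd M) (shift (2 +ℕ M) (geo-powers (suc M) (bigProd M))) n)))
    (e (bigProd (suc M) n) (δ₀ n) (sh (bigProd M) n) (sh δ₀ n) (shift (3 +ℕ M) (geo-powers (2 +ℕ M) (bigProd (suc M))) n) (shift (3 +ℕ M) (geo-powers (suc M) (bigProd M)) n)))
  where
  e : ∀ a d b s x y → a + x - d - (b + y - s) ≡ (a - d) - (b - s) + (x - y)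
  e = solve-∀

-- The products with and without the part M + 2 agree below degree M + 2. After multiplication by q
-- they agree up to degree M + 2, and there `enlarge` compares a product with its own shift.
bigProd-difference : ∀ M n → n ≤ 2 +ℕ M → 0ℤ ≤ℤ bigProd (suc M) n - sh (bigProd (suc M)) n + sh δ₀ n
bigProd-difference M n n≤ = nonneg (+-nonneg (enlarge M n) (prod-nonneg [] n))
  (trans (cong (λ t → bigProd (suc M) n - t + sh δ₀ n) (trans (sh-cong (geo³ (suc M) (bigProd M)) n)
    (trans (sh-add (bigProd M) (shift (2 +ℕ M) (geo-powers (suc M) (bigProd M))) n)
    (trans (cong (λ t → sh (bigProd M) n + t) (shift-zero (3 +ℕ M) (geo-powers (suc M) (bigProd M)) (s≤s n≤))) (ℤ.+-identityʳ _)))))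
    (e (bigProd (suc M) n) (sh (bigProd M) n) (δ₀ n) (sh δ₀ n)))
  where
  e : ∀ a b d s → a - b + s ≡ (a - d) - (b - s) + d
  e = solve-∀

first-differences : ∀ (f₀ f₁ f₂ f₃ : Series) → (∀ n → f₀ n ≡ f₁ n + sh f₀ n) → (∀ n → f₁ n ≡ f₂ n + sh f₁ n) → (∀ n → f₂ n ≡ f₃ n + sh f₂ n) →
  ∀ {a b c d} → f₀ 15 ≡ a → f₀ 14 ≡ b → f₀ 13 ≡ c → f₀ 12 ≡ d →
  f₁ 15 ≡ a - b × f₂ 15 ≡ a - + 2 * b + c × f₃ 15 ≡ a - + 3 * b + + 3 * c - d
first-differences f₀ f₁ f₂ f₃ h₁ h₂ h₃ {a} {b} {c} {d} ea eb ec ed = f₁15 , f₂15 , trans (sub (h₃ 15)) (trans (cong₂ _-_ f₂15 f₂14) (e₃ a b c d))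
  where
  sub : ∀ {x y z} → x ≡ y + z → y ≡ x - z
  sub {_} {y} {z} refl = e y z
    where
    e : ∀ y z → y ≡ y + z - z
    e = solve-∀
  e₂ : ∀ a b c → (a - b) - (b - c) ≡ a - + 2 * b + c
  e₂ = solve-∀
  e₃ : ∀ a b c d → (a - + 2 * b + c) - (b - + 2 * c + d) ≡ a - + 3 * b + + 3 * c - d
  e₃ = solve-∀
  f₁15 : f₁ 15 ≡ a - b
  f₁15 = trans (sub (h₁ 15)) (cong₂ _-_ ea eb)
  f₁14 : f₁ 14 ≡ b - c
  f₁14 = trans (sub (h₁ 14)) (cong₂ _-_ eb ec)
  f₁13 : f₁ 13 ≡ c - d
  f₁13 = trans (sub (h₁ 13)) (cong₂ _-_ ec ed)
  f₂15 : f₂ 15 ≡ a - + 2 * b + c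
  f₂15 = trans (sub (h₂ 15)) (trans (cong₂ _-_ f₁15 f₁14) (e₂ a b c))
  f₂14 : f₂ 14 ≡ b - + 2 * c + d
  f₂14 = trans (sub (h₂ 14)) (trans (cong₂ _-_ f₁14 f₁13) (e₂ b c d))

-- The base cases of three, four and five colours

zero-defect : ∀ Q u → + 2 * + 0 * Q * u ≡ 0ℤ
zero-defect Q u = refl

module Four (M : ℕ) (15≤M : 15 ≤ M) where
  open Differences 1 M (prod (bigParts 4 M)) (λ _ → 0ℤ) (λ _ → refl) (s≤s (ℕ.≤-trans (ℕ.m≤m+n 3 12) 15≤M)) public

  value : ∀ n → n < 16 → f₀ n ≡ + at (table 4) n
  value n (s≤s n≤15) = trans (sym (p-prod 4 M n (ℕ.m≤n⇒m≤1+n (ℕ.≤-trans n≤15 15≤M)))) (cong +_ (p-table 4 n (ℕ.≤ᵇ⇒≤ _ _ tt) (s≤s n≤15)))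

  differences-at-15 : f₁ 15 ≡ _ × f₂ 15 ≡ _ × f₃ 15 ≡ _
  differences-at-15 = first-differences f₀ f₁ f₂ f₃ (geo-one f₁) (geo-one f₂) (geo-one f₃)
    (value 15 ℕ.≤-refl) (value 14 (ℕ.<ᵇ⇒< _ _ tt)) (value 13 (ℕ.<ᵇ⇒< _ _ tt)) (value 12 (ℕ.<ᵇ⇒< _ _ tt))

  private
    -- The numerals are p₄(15) and p₄(15) - p₄(14). Handing them over through variables keeps the
    -- evaluation away from the series.
    base : ∀ F u → F ≡ + 203984 → u ≡ + 87894 → 0ℤ <ℤ + 475 * (u * u) + + 116 * (u * (F - u)) - + 198 * (F * (F - u))
    base _ _ refl refl = ℤ.+<+ (s≤s z≤n)

    weights≥0 : ∀ n → n < R → 0ℤ ≤ℤ conv (upperWeight Q Z R) (prod (bigParts 4 M)) n + 0ℤ × 0ℤ ≤ℤ conv (lowerWeight Q Z R) (prod (bigParts 4 M)) n + 0ℤ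
    weights≥0 n n<R = +-nonneg (proj₁ both) ℤ.≤-refl , +-nonneg (proj₂ both) ℤ.≤-refl
      where
      both = convs-nonneg (prod (bigParts 4 M)) n n<R (λ i _ → prod-nonneg (bigParts 4 M) i)

    ring₁ : ∀ T → let P′ = + 475 + + 30 * (1ℤ + T); N = + 488 + + 30 * T; P = + 475 + + 30 * T in
      P′ * (N - + 126) * (N - + 126) - N * (N - + 116) * (P - + 116) ≡ + 1005796 + T * (+ 191640 + T * + 9000)
    ring₁ = solve-∀
    ring₂ : ∀ T → let P′ = + 475 + + 30 * (1ℤ + T); N = + 488 + + 30 * T in
      + 2 * P′ * (N - + 126) - N * (N - + 126) - N * (N - + 116) ≡ + 7428 + T * + 720
    ring₂ = solve-∀
    ring₃ : ∀ T → let P′ = + 475 + + 30 * (1ℤ + T); N = + 488 + + 30 * T in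
      + 196 * (+ 2 * P′ * (N - + 126) - N * (N - + 126) - N * (N - + 116)) - + 116 * (+ 126 - + 116) * N ≡ + 889808 + T * + 106320
    ring₃ = solve-∀

  -- σ = 120/4, and the other numbers follow from n₀ = 15 and ε = 0: 16σ - 5, 16σ + 8, 56 + 2σ and
  -- 66 + 2σ.
  open Barrier 15 30 475 488 116 126 (ℕ.<ᵇ⇒< _ _ tt) (ℕ.≤ᵇ⇒≤ _ _ tt) (ℕ.≤ᵇ⇒≤ _ _ tt)
    (λ T T≥0 → nonneg (horner (0≤+ 1005796) T≥0 (horner (0≤+ 191640) T≥0 (0≤+ 9000))) (ring₁ T))
    (λ T T≥0 → nonneg (horner (0≤+ 7428) T≥0 (0≤+ 720)) (ring₂ T))
    (λ T T≥0 → nonneg (horner (0≤+ 889808) T≥0 (0≤+ 106320)) (ring₃ T))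
    0 refl refl refl refl refl weights≥0 (λ n _ _ → ℤ.≤-reflexive (sym (zero-defect Q (f₁ n))))
    (base (f₀ 15) (f₁ 15) (value 15 ℕ.≤-refl) (proj₁ differences-at-15)) public

module Five (M : ℕ) (15≤M : 15 ≤ M) where
  open Differences 2 M (prod (0 ∷ bigParts 5 M)) (λ _ → 0ℤ) (λ _ → refl) (s≤s (ℕ.≤-trans (ℕ.m≤m+n 3 12) 15≤M)) public

  value : ∀ n → n < 16 → f₀ n ≡ + at (table 5) n
  value n (s≤s n≤15) = trans (sym (p-prod 5 M n (ℕ.m≤n⇒m≤1+n (ℕ.≤-trans n≤15 15≤M)))) (cong +_ (p-table 5 n (ℕ.≤ᵇ⇒≤ _ _ tt) (s≤s n≤15)))

  differences-at-15 : f₁ 15 ≡ _ × f₂ 15 ≡ _ × f₃ 15 ≡ _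
  differences-at-15 = first-differences f₀ f₁ f₂ f₃ (geo-one f₁) (geo-one f₂) (geo-one f₃)
    (value 15 ℕ.≤-refl) (value 14 (ℕ.<ᵇ⇒< _ _ tt)) (value 13 (ℕ.<ᵇ⇒< _ _ tt)) (value 12 (ℕ.<ᵇ⇒< _ _ tt))

  private
    base : ∀ F u → F ≡ + 885723 → u ≡ + 413428 → 0ℤ <ℤ + 379 * (u * u) + + 104 * (u * (F - u)) - + 198 * (F * (F - u))
    base _ _ refl refl = ℤ.+<+ (s≤s z≤n)

    weights≥0 : ∀ n → n < R → 0ℤ ≤ℤ conv (upperWeight Q Z R) (prod (0 ∷ bigParts 5 M)) n + 0ℤ × 0ℤ ≤ℤ conv (lowerWeight Q Z R) (prod (0 ∷ bigParts 5 M)) n + 0ℤ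
    weights≥0 n n<R = +-nonneg (proj₁ both) ℤ.≤-refl , +-nonneg (proj₂ both) ℤ.≤-refl
      where
      both = convs-nonneg (prod (0 ∷ bigParts 5 M)) n n<R (λ i _ → prod-nonneg (0 ∷ bigParts 5 M) i)

    ring₁ : ∀ T → let P′ = + 379 + + 24 * (1ℤ + T); N = + 392 + + 24 * T; P = + 379 + + 24 * T in
      P′ * (N - + 114) * (N - + 114) - N * (N - + 104) * (P - + 104) ≡ + 99052 + T * (+ 34944 + T * + 2304)
    ring₁ = solve-∀
    ring₂ : ∀ T → let P′ = + 379 + + 24 * (1ℤ + T); N = + 392 + + 24 * T in
      + 2 * P′ * (N - + 114) - N * (N - + 114) - N * (N - + 104) ≡ + 2196 + T * + 288
    ring₂ = solve-∀
    ring₃ : ∀ T → let P′ = + 379 + + 24 * (1ℤ + T); N = + 392 + + 24 * T in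
      + 196 * (+ 2 * P′ * (N - + 114) - N * (N - + 114) - N * (N - + 104)) - + 104 * (+ 114 - + 104) * N ≡ + 22736 + T * + 31488
    ring₃ = solve-∀

  -- Five colours are the tightest case: the constant term of the third condition falls from 889808
  -- to 22736.
  open Barrier 15 24 379 392 104 114 (ℕ.<ᵇ⇒< _ _ tt) (ℕ.≤ᵇ⇒≤ _ _ tt) (ℕ.≤ᵇ⇒≤ _ _ tt)
    (λ T T≥0 → nonneg (horner (0≤+ 99052) T≥0 (horner (0≤+ 34944) T≥0 (0≤+ 2304))) (ring₁ T))
    (λ T T≥0 → nonneg (horner (0≤+ 2196) T≥0 (0≤+ 288)) (ring₂ T))
    (λ T T≥0 → nonneg (horner (0≤+ 22736) T≥0 (0≤+ 31488)) (ring₃ T))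
    0 refl refl refl refl refl weights≥0 (λ n _ _ → ℤ.≤-reflexive (sym (zero-defect Q (f₁ n))))
    (base (f₀ 15) (f₁ 15) (value 15 ℕ.≤-refl) (proj₁ differences-at-15)) public


-- For three colours f₄ has the coefficient -1 at q, and f₄ + q is nonnegative.
module Three (M′ : ℕ) (15≤M′ : 15 ≤ M′) where
  private
    M : ℕ
    M = suc M′
    15≤M : 15 ≤ M
    15≤M = ℕ.m≤n⇒m≤1+n 15≤M′
    f₄ : Series
    f₄ n = bigProd M n - sh (bigProd M) n
    f₃-eq : ∀ n → geo 1 f₄ n ≡ bigProd M n
    f₃-eq n = sym (geo-unique 0 {f₄} {bigProd M} (λ n → e (bigProd M n) (sh (bigProd M) n)) n)
      where
      e : ∀ a b → a ≡ a - b + b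
      e = solve-∀
    defect : Series
    defect = sh (λ x → Zeta.Q (zeta M) * (+ 10 * X x * X x + + 15 * X x))

  open Differences 0 M f₄ defect f₃-eq (s≤s (ℕ.≤-trans (ℕ.m≤m+n 3 12) 15≤M)) public

  value : ∀ n → n < 16 → f₀ n ≡ + at (table 3) n
  value n (s≤s n≤15) = trans (sym (p-prod 3 M n (ℕ.m≤n⇒m≤1+n (ℕ.≤-trans n≤15 15≤M)))) (cong +_ (p-table 3 n (ℕ.≤ᵇ⇒≤ _ _ tt) (s≤s n≤15)))

  differences-at-15 : f₁ 15 ≡ _ × f₂ 15 ≡ _ × f₃ 15 ≡ _
  differences-at-15 = first-differences f₀ f₁ f₂ f₃ (geo-one f₁) (geo-one f₂) (geo-one f₃)
    (value 15 ℕ.≤-refl) (value 14 (ℕ.<ᵇ⇒< _ _ tt)) (value 13 (ℕ.<ᵇ⇒< _ _ tt)) (value 12 (ℕ.<ᵇ⇒< _ _ tt))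

  private
    base : ∀ F u → F ≡ + 35581 → u ≡ + 13738 → 0ℤ <ℤ + 633 * (u * u) + + 134 * (u * (F - u)) - + 198 * (F * (F - u))
    base _ _ refl refl = ℤ.+<+ (s≤s z≤n)

    defect-sum : ∀ n → defect n ≡ sh (upperWeight Q Z R) n + sh (lowerWeight Q Z R) n
    defect-sum n = trans (sh-cong (λ x → sym (weights-sum Q Z R x)) n) (sh-add (upperWeight Q Z R) (lowerWeight Q Z R) n)

    conv-f₄ : ∀ w n → conv w (λ m → f₄ m + sh δ₀ m) n ≡ conv w f₄ n + sh w n
    conv-f₄ w n = trans (conv-addʳ w f₄ (sh δ₀) n) (cong (λ t → conv w f₄ n + t) (trans (conv-shʳ w δ₀ n) (sh-cong (conv-δʳ w) n)))

    sh-nonneg : ∀ w n → n < R → (∀ x → suc x ≤ R → 0ℤ ≤ℤ w x) → 0ℤ ≤ℤ sh w n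
    sh-nonneg w zero _ _ = ℤ.≤-refl
    sh-nonneg w (suc n) n<R h = h n (ℕ.<⇒≤ n<R)

    -- As f₄ + q is nonnegative, a weight w convolved with f₄ is at least -q w. Adding the other
    -- weight, also nonnegative, turns q w into the explicit `defect`.
    weights≥0 : ∀ n → n < R → 0ℤ ≤ℤ conv (upperWeight Q Z R) f₄ n + defect n × 0ℤ ≤ℤ conv (lowerWeight Q Z R) f₄ n + defect n
    weights≥0 n n<R =
      nonneg (+-nonneg (proj₁ both) (sh-nonneg (lowerWeight Q Z R) n n<R lowerWeight-nonneg))
        (trans (cong (λ t → conv (upperWeight Q Z R) f₄ n + t) (defect-sum n)) (trans (e₁ (conv (upperWeight Q Z R) f₄ n) (sh (upperWeight Q Z R) n) (sh (lowerWeight Q Z R) n))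
          (cong (_+ sh (lowerWeight Q Z R) n) (sym (conv-f₄ (upperWeight Q Z R) n))))) ,
      nonneg (+-nonneg (proj₂ both) (sh-nonneg (upperWeight Q Z R) n n<R upperWeight-nonneg))
        (trans (cong (λ t → conv (lowerWeight Q Z R) f₄ n + t) (defect-sum n)) (trans (e₂ (conv (lowerWeight Q Z R) f₄ n) (sh (upperWeight Q Z R) n) (sh (lowerWeight Q Z R) n))
          (cong (_+ sh (upperWeight Q Z R) n) (sym (conv-f₄ (lowerWeight Q Z R) n)))))
      where
      f₄⁺ : ∀ i → i ≤ n → 0ℤ ≤ℤ f₄ i + sh δ₀ i
      f₄⁺ i i≤n = bigProd-difference M′ i (ℕ.≤-trans i≤n (ℕ.<⇒≤ n<R))
      both = convs-nonneg (λ m → f₄ m + sh δ₀ m) n n<R f₄⁺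
      e₁ : ∀ a u l → a + (u + l) ≡ a + u + l
      e₁ = solve-∀
      e₂ : ∀ a u l → a + (u + l) ≡ a + l + u
      e₂ = solve-∀

    -- f₃ does not decrease here, so a constant lower bound persists; summing it twice yields for f₁
    -- precisely the quadratic that occurs in `defect`.
    growth : ∀ t → t +ℕ 15 ≤ R → let n = + (t +ℕ 15) in
      0ℤ ≤ℤ f₃ (t +ℕ 15) - + 5 × 0ℤ ≤ℤ + 4 * f₂ (t +ℕ 15) - (+ 20 * n + + 5) × 0ℤ ≤ℤ + 4 * f₁ (t +ℕ 15) - (+ 10 * n * n + + 15 * n)
    growth zero _ = start (f₁ 15) (f₂ 15) (f₃ 15) (proj₁ differences-at-15) (proj₁ (proj₂ differences-at-15)) (proj₂ (proj₂ differences-at-15))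
      where
      start : ∀ u v w → u ≡ + 13738 → v ≡ + 5104 → w ≡ + 1811 →
        0ℤ ≤ℤ w - + 5 × 0ℤ ≤ℤ + 4 * v - (+ 20 * + 15 + + 5) × 0ℤ ≤ℤ + 4 * u - (+ 10 * + 15 * + 15 + + 15 * + 15)
      start _ _ _ refl refl refl = 0≤+ _ , 0≤+ _ , 0≤+ _
    growth (suc t) n<R with growth t (ℕ.<⇒≤ n<R)
    ... | h₃ , h₂ , h₁ = h₃′ , h₂′ , h₁′
      where
      n : ℕ
      n = t +ℕ 15
      δ-zero : ∀ n → 0 < n → δ₀ n ≡ 0ℤ
      δ-zero (suc n) _ = refl
      h₃′ : 0ℤ ≤ℤ f₃ (suc n) - + 5
      h₃′ = nonneg (+-nonneg h₃ (bigProd-difference M′ (suc n) n<R))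
        (trans (e (f₃ (suc n)) (f₃ n)) (cong (λ d → f₃ n - + 5 + (f₃ (suc n) - f₃ n + d)) (sym (δ-zero n (ℕ.≤-trans (s≤s z≤n) (ℕ.m≤n+m 15 t))))))
        where
        e : ∀ a b → a - + 5 ≡ b - + 5 + (a - b + 0ℤ)
        e = solve-∀
      h₂′ : 0ℤ ≤ℤ + 4 * f₂ (suc n) - (+ 20 * + suc n + + 5)
      h₂′ = nonneg (+-nonneg h₂ (*-nonneg (0≤+ 4) h₃′)) (trans (cong₂ (λ a m → + 4 * a - (+ 20 * m + + 5)) (geo-one f₃ (suc n)) (ℤ.pos-+ 1 n)) (e (f₃ (suc n)) (f₂ n) (+ n)))
        where
        e : ∀ a b n → + 4 * (a + b) - (+ 20 * (1ℤ + n) + + 5) ≡ + 4 * b - (+ 20 * n + + 5) + + 4 * (a - + 5)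
        e = solve-∀
      h₁′ : 0ℤ ≤ℤ + 4 * f₁ (suc n) - (+ 10 * + suc n * + suc n + + 15 * + suc n)
      h₁′ = nonneg (+-nonneg h₁ h₂′) (trans (cong (λ a → + 4 * a - (+ 10 * + suc n * + suc n + + 15 * + suc n)) (geo-one f₂ (suc n)))
        (go (f₂ (suc n)) (f₁ n) (+ n) (+ suc n) (ℤ.pos-+ 1 n)))
        where
        e : ∀ a b n → + 4 * (a + b) - (+ 10 * (1ℤ + n) * (1ℤ + n) + + 15 * (1ℤ + n)) ≡ + 4 * b - (+ 10 * n * n + + 15 * n) + (+ 4 * a - (+ 20 * (1ℤ + n) + + 5))
        e = solve-∀
        go : ∀ a b n m → m ≡ 1ℤ + n → + 4 * (a + b) - (+ 10 * m * m + + 15 * m) ≡ + 4 * b - (+ 10 * n * n + + 15 * n) + (+ 4 * a - (+ 20 * m + + 5))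
        go a b n _ refl = e a b n

    defect≤ : ∀ n → 15 < n → n < R → defect n ≤ℤ + 2 * + 2 * Q * f₁ n
    defect≤ (suc n) 15<n n<R = from-nonneg (nonneg (*-nonneg Q≥0 (subst (λ m → 0ℤ ≤ℤ + 4 * f₁ m - (+ 10 * + m * + m + + 15 * + m)) (ℕ.m∸n+n≡m (ℕ.<⇒≤ 15<n))
        (proj₂ (proj₂ (growth (suc n ∸ℕ 15) (subst (_≤ R) (sym (ℕ.m∸n+n≡m (ℕ.<⇒≤ 15<n))) (ℕ.<⇒≤ n<R)))))))
      (e Q (X n) (f₁ (suc n))))
      where
      e : ∀ Q X u → + 2 * + 2 * Q * u - Q * (+ 10 * X * X + + 15 * X) ≡ Q * (+ 4 * u - (+ 10 * X * X + + 15 * X))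
      e = solve-∀

    ring₁ : ∀ T → let P′ = + 633 + + 40 * (1ℤ + T); N = + 650 + + 40 * T; P = + 633 + + 40 * T in
      P′ * (N - + 148) * (N - + 148) - N * (N - + 134) * (P - + 134) ≡ + 2234092 + T * (+ 418480 + T * + 19200)
    ring₁ = solve-∀
    ring₂ : ∀ T → let P′ = + 633 + + 40 * (1ℤ + T); N = + 650 + + 40 * T in
      + 2 * P′ * (N - + 148) - N * (N - + 148) - N * (N - + 134) ≡ + 13992 + T * + 1280
    ring₂ = solve-∀
    ring₃ : ∀ T → let P′ = + 633 + + 40 * (1ℤ + T); N = + 650 + + 40 * T in
      + 196 * (+ 2 * P′ * (N - + 148) - N * (N - + 148) - N * (N - + 134)) - + 134 * (+ 148 - + 134) * N ≡ + 1523032 + T * + 175840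
    ring₃ = solve-∀

  -- ε = 2 because the defect is at most 4 Q f₁. It widens the constants to 640 - 7, 640 + 10, 136 -
  -- 2 and 146 + 2.
  open Barrier 15 40 633 650 134 148 (ℕ.<ᵇ⇒< _ _ tt) (ℕ.≤ᵇ⇒≤ _ _ tt) (ℕ.≤ᵇ⇒≤ _ _ tt)
    (λ T T≥0 → nonneg (horner (0≤+ 2234092) T≥0 (horner (0≤+ 418480) T≥0 (0≤+ 19200))) (ring₁ T))
    (λ T T≥0 → nonneg (horner (0≤+ 13992) T≥0 (0≤+ 1280)) (ring₂ T))
    (λ T T≥0 → nonneg (horner (0≤+ 1523032) T≥0 (0≤+ 175840)) (ring₃ T))
    2 refl refl refl refl refl weights≥0 defect≤
    (base (f₀ 15) (f₁ 15) (value 15 ℕ.≤-refl) (proj₁ differences-at-15)) public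

-- Log-concave sequences and their convolutions

-- Strictness starts at n = 1 because p₃(0) p₃(2) = 9 = p₃(1)². This suffices for partitions, whose
-- parts are at least 1.
record LogConcave (f : Series) : Set where
  field
    pos : ∀ n → 0ℤ <ℤ f n
    weak : ∀ n → f n * f (2 +ℕ n) ≤ℤ f (suc n) * f (suc n)
    strict : ∀ n → 1 ≤ n → f n * f (2 +ℕ n) <ℤ f (suc n) * f (suc n)

module _ {f : Series} (lc : LogConcave f) where
  open LogConcave lc

  ratio-decreasing : ∀ y t → 0ℤ ≤ℤ f (suc y) * f (suc (t +ℕ y)) - f y * f (2 +ℕ (t +ℕ y))
  ratio-decreasing y zero = to-nonneg (weak y)
  ratio-decreasing y (suc t) = *-cancel-nonneg (pos (suc (t +ℕ y))) (nonneg
    (+-nonneg (*-nonneg (ℤ.<⇒≤ (pos (2 +ℕ (t +ℕ y)))) (ratio-decreasing y t)) (*-nonneg (ℤ.<⇒≤ (pos y)) (to-nonneg (weak (suc (t +ℕ y))))))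
    (e (f y) (f (suc y)) (f (suc (t +ℕ y))) (f (2 +ℕ (t +ℕ y))) (f (3 +ℕ (t +ℕ y)))))
    where
    e : ∀ y y' a b c → a * (y' * b - y * c) ≡ b * (y' * a - y * b) + y * (b * b - a * c)
    e = solve-∀

  -- `sh` supplies the value 0 at index -1, so the minors at the edge y = 0 need no separate form
  -- later.
  minor-nonneg : ∀ y x → y < x → 0ℤ ≤ℤ f y * sh f x - f x * sh f y
  minor-nonneg zero (suc x) _ = nonneg (*-nonneg (ℤ.<⇒≤ (pos 0)) (ℤ.<⇒≤ (pos x))) (e (f 0 * f x) (f (suc x)))
    where
    e : ∀ a b → a - b * 0ℤ ≡ a
    e = solve-∀
  minor-nonneg (suc y) (suc x) (s≤s y<x) = subst (λ z → 0ℤ ≤ℤ f (suc y) * f z - f (suc z) * f y) (trans (sym (ℕ.+-suc t y)) (ℕ.m∸n+n≡m y<x))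
    (nonneg (ratio-decreasing y t) (e (f (suc y)) (f (suc (t +ℕ y))) (f (2 +ℕ (t +ℕ y))) (f y)))
    where
    t : ℕ
    t = x ∸ℕ suc y
    e : ∀ a b c d → a * b - c * d ≡ a * b - d * c
    e = solve-∀

-- Binet–Cauchy: a 2×2 minor of a convolution is a sum of products of 2×2 minors.

module _ (α β γ δ : ℕ → ℤ) where
  binet-cauchy : ℕ → ℤ
  binet-cauchy n = ∑ n (λ a → δ a * α a) * ∑ n (λ a → γ a * β a) - ∑ n (λ a → γ a * α a) * ∑ n (λ a → δ a * β a)

  minors-sum : ∀ n aₙ bₙ cₙ dₙ → ∑ n (λ a → (bₙ * α a - aₙ * β a) * (cₙ * δ a - dₙ * γ a)) ≡
    bₙ * cₙ * ∑ n (λ a → δ a * α a) - bₙ * dₙ * ∑ n (λ a → γ a * α a) - aₙ * cₙ * ∑ n (λ a → δ a * β a) + aₙ * dₙ * ∑ n (λ a → γ a * β a)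
  minors-sum zero aₙ bₙ cₙ dₙ = e aₙ bₙ cₙ dₙ
    where
    e : ∀ a b c d → 0ℤ ≡ b * c * 0ℤ - b * d * 0ℤ - a * c * 0ℤ + a * d * 0ℤ
    e = solve-∀
  minors-sum (suc n) aₙ bₙ cₙ dₙ = trans (cong (_+ (bₙ * α n - aₙ * β n) * (cₙ * δ n - dₙ * γ n)) (minors-sum n aₙ bₙ cₙ dₙ))
    (e aₙ bₙ cₙ dₙ (α n) (β n) (γ n) (δ n) (∑ n (λ a → δ a * α a)) (∑ n (λ a → γ a * α a)) (∑ n (λ a → δ a * β a)) (∑ n (λ a → γ a * β a)))
    where
    e : ∀ a b c d x y z w p q r s → b * c * p - b * d * q - a * c * r + a * d * s + (b * x - a * y) * (c * w - d * z) ≡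
      b * c * (p + w * x) - b * d * (q + z * x) - a * c * (r + w * y) + a * d * (s + z * y)
    e = solve-∀

  -- One more column adds exactly the products of those minors that involve it.
  binet-cauchy-suc : ∀ n → binet-cauchy (suc n) ≡ binet-cauchy n + ∑ n (λ a → (β n * α a - α n * β a) * (γ n * δ a - δ n * γ a))
  binet-cauchy-suc n = trans
    (e (α n) (β n) (γ n) (δ n) (∑ n (λ a → δ a * α a)) (∑ n (λ a → γ a * α a)) (∑ n (λ a → δ a * β a)) (∑ n (λ a → γ a * β a)))
    (cong (λ t → binet-cauchy n + t) (sym (minors-sum n (α n) (β n) (γ n) (δ n))))
    where
    e : ∀ a b c d p q r s → (p + d * a) * (s + c * b) - (q + c * a) * (r + d * b) ≡ (p * s - q * r) + (b * c * p - b * d * q - a * c * r + a * d * s)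
    e = solve-∀

module _ {g f : Series} (lg : LogConcave g) (lf : LogConcave f) where
  private
    module G = LogConcave lg
    module F = LogConcave lf

    α β : ℕ → ℕ → ℤ
    α N a = f (N ∸ℕ a)
    β N a = sh f (N ∸ℕ a)

    term-nonneg : ∀ N n a → n ≤ N → a < n → 0ℤ ≤ℤ (β N n * α N a - α N n * β N a) * (g n * sh g a - sh g n * g a)
    term-nonneg N n a n≤N a<n = nonneg
      (*-nonneg (minor-nonneg lf (N ∸ℕ n) (N ∸ℕ a) (ℕ.∸-monoʳ-< a<n n≤N)) (minor-nonneg lg a n a<n))
      (e (β N n) (α N a) (α N n) (β N a) (g n) (sh g a) (sh g n) (g a))
      where
      e : ∀ bn aa an ba gn sa sn ga → (bn * aa - an * ba) * (gn * sa - sn * ga) ≡ (an * ba - aa * bn) * (ga * sn - gn * sa)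
      e = solve-∀

    minor : ℕ → ℕ → ℤ
    minor N = binet-cauchy (α N) (β N) g (sh g)

    minor-≥ : ∀ N n → 2 ≤ n → n ≤ suc N → minor N 2 ≤ℤ minor N n
    minor-≥ N (suc (suc zero)) _ _ = ℤ.≤-refl
    minor-≥ N (suc zero) (s≤s ()) _
    minor-≥ N (suc (suc (suc n))) _ (s≤s n≤N) = ℤ.≤-trans (minor-≥ N (suc (suc n)) (s≤s (s≤s z≤n)) (ℕ.m≤n⇒m≤1+n n≤N))
      (from-nonneg (nonneg (∑-nonneg (suc (suc n)) λ a a<n → term-nonneg N (suc (suc n)) a n≤N a<n)
        (trans (cong (_- minor N (suc (suc n))) (binet-cauchy-suc (α N) (β N) g (sh g) (suc (suc n)))) (e (minor N (suc (suc n))) _))))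
      where
      e : ∀ a b → a + b - a ≡ b
      e = solve-∀

    -- Columns 0 and 1 alone already contain the defect of log-concavity of f, times g(0)². As later
    -- columns only add to it, strictness of f passes to the convolution.
    minor-2 : ∀ n → minor (2 +ℕ n) 2 ≡ (f (suc n) * f (suc n) - f n * f (2 +ℕ n)) * (g 0 * g 0)
    minor-2 n = e (f (2 +ℕ n)) (f (suc n)) (f n) (g 0) (g 1)
      where
      e : ∀ f₂ f₁ f₀ g₀ g₁ → (0ℤ + 0ℤ * f₂ + g₀ * f₁) * (0ℤ + g₀ * f₁ + g₁ * f₀) - (0ℤ + g₀ * f₂ + g₁ * f₁) * (0ℤ + 0ℤ * f₁ + g₀ * f₀)
        ≡ (f₁ * f₁ - f₀ * f₂) * (g₀ * g₀)
      e = solve-∀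

    minor-conv : ∀ n → minor (2 +ℕ n) (3 +ℕ n) ≡ conv g f (suc n) * conv g f (suc n) - conv g f n * conv g f (2 +ℕ n)
    minor-conv n = trans (cong₂ _-_
        (cong₂ _*_ (conv-shˡ g f (2 +ℕ n)) (conv-shʳ g f (2 +ℕ n)))
        (cong (λ t → conv g f (2 +ℕ n) * t) (trans (conv-shˡ g (sh f) (2 +ℕ n)) (conv-shʳ g f (suc n)))))
      (e (conv g f (suc n)) (conv g f n) (conv g f (2 +ℕ n)))
      where
      e : ∀ a b c → a * a - c * b ≡ a * a - b * c
      e = solve-∀

    conv-minor-≥ : ∀ n → (f (suc n) * f (suc n) - f n * f (2 +ℕ n)) * (g 0 * g 0) ≤ℤ conv g f (suc n) * conv g f (suc n) - conv g f n * conv g f (2 +ℕ n)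
    conv-minor-≥ n = subst₂ _≤ℤ_ (minor-2 n) (minor-conv n) (minor-≥ (2 +ℕ n) (3 +ℕ n) (s≤s (s≤s z≤n)) ℕ.≤-refl)

  LogConcave-conv : LogConcave (conv g f)
  LogConcave-conv = record
    { pos = λ n → posit (+-pos (*-pos (G.pos 0) (F.pos n))
        (∑-nonneg n λ i _ → *-nonneg (ℤ.<⇒≤ (G.pos (suc i))) (ℤ.<⇒≤ (F.pos (n ∸ℕ suc i))))) (∑-head n λ i → g i * f (n ∸ℕ i))
    ; weak = λ n → from-nonneg (ℤ.≤-trans (*-nonneg (to-nonneg (F.weak n)) (ℤ.<⇒≤ (*-pos (G.pos 0) (G.pos 0)))) (conv-minor-≥ n))
    ; strict = λ n 1≤n → from-pos (ℤ.<-≤-trans (*-pos (to-pos (F.strict n 1≤n)) (*-pos (G.pos 0) (G.pos 0))) (conv-minor-≥ n)) }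

LogConcave-cong : ∀ {f g} → (∀ n → f n ≡ g n) → LogConcave f → LogConcave g
LogConcave-cong {f} {g} h lf = record
  { pos = λ n → subst (0ℤ <ℤ_) (h n) (pos n)
  ; weak = λ n → subst₂ _≤ℤ_ (cong₂ _*_ (h n) (h (2 +ℕ n))) (cong₂ _*_ (h (suc n)) (h (suc n))) (weak n)
  ; strict = λ n 1≤n → subst₂ _<ℤ_ (cong₂ _*_ (h n) (h (2 +ℕ n))) (cong₂ _*_ (h (suc n)) (h (suc n))) (strict n 1≤n) }
  where open LogConcave lf

-- Log-concavity for every k ≥ 3

prod-zero : ∀ L → prod L 0 ≡ 1ℤ
prod-zero [] = refl
prod-zero (d ∷ L) = trans (ℤ.+-identityˡ (prod L 0)) (prod-zero L)

p-pos : ∀ k n → 0ℤ <ℤ + p (suc k) n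
p-pos k n = subst (0ℤ <ℤ_) (sym (p-prod (suc k) n n (ℕ.n≤1+n n))) (go n)
  where
  L : List ℕ
  L = replicate k 0 ++ bigParts (suc k) n
  go : ∀ m → 0ℤ <ℤ prod (0 ∷ L) m
  go zero = subst (0ℤ <ℤ_) (sym (prod-zero (0 ∷ L))) (ℤ.+<+ (s≤s z≤n))
  go (suc m) = posit (+-pos (go m) (prod-nonneg L (suc m))) (trans (geo-unfold 0 (prod L) (suc m)) (ℤ.+-comm (prod L (suc m)) _))

StrictAt : ℕ → ℕ → Set
StrictAt k n = + p k n * + p k (2 +ℕ n) <ℤ + p k (suc n) * + p k (suc n)

-- The index m is n + 1, written as t + 15 because the barrier argument starts at 15.
strict-from-prod : ∀ k M n → 14 ≤ n → 2 +ℕ n ≤ suc M → let F = prod (colouredParts k M); m = (n ∸ℕ 14) +ℕ 15 in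
  sh F m * F (suc m) <ℤ F m * F m → StrictAt k n
strict-from-prod k M n 14≤n n≤M h = subst₂ _<ℤ_
  (cong₂ _*_ (sym (p-prod k M n (ℕ.≤-trans (ℕ.m≤n+m n 2) n≤M))) (sym (p-prod k M (2 +ℕ n) n≤M)))
  (cong₂ _*_ (sym (p-prod k M (suc n) (ℕ.<⇒≤ n≤M))) (sym (p-prod k M (suc n) (ℕ.<⇒≤ n≤M))))
  (subst (λ m → sh (prod (colouredParts k M)) m * prod (colouredParts k M) (suc m) <ℤ prod (colouredParts k M) m * prod (colouredParts k M) m)
    (trans (ℕ.+-suc (n ∸ℕ 14) 14) (cong suc (ℕ.m∸n+n≡m 14≤n))) h)

strict-from-table : ∀ k n → k ≤ 5 → n < 14 → at (table k) n *ℕ at (table k) (2 +ℕ n) < at (table k) (suc n) *ℕ at (table k) (suc n) → StrictAt k n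
strict-from-table k n k≤5 n<14 h = subst₂ _<ℤ_ (trans (cong +_ (cong₂ _*ℕ_ (sym (p-table k n k≤5 (ℕ.≤-trans n<14 (ℕ.m≤m+n 14 2)))) (sym (p-table k (2 +ℕ n) k≤5 (s≤s (s≤s n<14)))))) (ℤ.pos-* (p k n) (p k (2 +ℕ n))))
  (trans (cong +_ (cong₂ _*ℕ_ (sym e) (sym e))) (ℤ.pos-* (p k (suc n)) (p k (suc n)))) (ℤ.+<+ h)
  where
  e : p k (suc n) ≡ at (table k) (suc n)
  e = p-table k (suc n) k≤5 (s≤s (ℕ.m≤n⇒m≤1+n n<14))

table-concave : ∀ k → Set
table-concave k = ∀ {n} → n < 13 → at (table k) (suc n) *ℕ at (table k) (3 +ℕ n) < at (table k) (2 +ℕ n) *ℕ at (table k) (2 +ℕ n)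

table-concave? : ∀ k → Dec (table-concave k)
table-concave? k = ℕ.allUpTo? (λ n → at (table k) (suc n) *ℕ at (table k) (3 +ℕ n) ℕ.<? at (table k) (2 +ℕ n) *ℕ at (table k) (2 +ℕ n)) 13

log-concave-p : ∀ k → p (suc k) 0 *ℕ p (suc k) 2 ≤ p (suc k) 1 *ℕ p (suc k) 1 → suc k ≤ 5 → table-concave (suc k) →
  (∀ n → 14 ≤ n → StrictAt (suc k) n) → LogConcave (λ n → + p (suc k) n)
log-concave-p k h₀ k≤5 small large = record { pos = p-pos k ; weak = weak ; strict = strict }
  where
  strict : ∀ n → 1 ≤ n → StrictAt (suc k) n
  strict (suc n) _ with 14 ℕ.≤? suc n
  ... | yes 14≤n = large (suc n) 14≤n
  ... | no 14≰n = strict-from-table (suc k) (suc n) k≤5 (ℕ.≰⇒> 14≰n) (small (ℕ.≤-pred (ℕ.≰⇒> 14≰n)))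
  weak : ∀ n → + p (suc k) n * + p (suc k) (2 +ℕ n) ≤ℤ + p (suc k) (suc n) * + p (suc k) (suc n)
  weak zero = subst₂ _≤ℤ_ (ℤ.pos-* (p (suc k) 0) (p (suc k) 2)) (ℤ.pos-* (p (suc k) 1) (p (suc k) 1)) (ℤ.+≤+ h₀)
  weak (suc n) = ℤ.<⇒≤ (strict (suc n) (s≤s z≤n))

private
  index : ∀ d n → 14 ≤ n → 2 ≤ d → suc ((n ∸ℕ 14) +ℕ 15) < suc (d +ℕ n)
  index d n 14≤n 2≤d = subst (λ m → suc m < suc (d +ℕ n)) (sym (trans (ℕ.+-suc (n ∸ℕ 14) 14) (cong suc (ℕ.m∸n+n≡m 14≤n)))) (s≤s (ℕ.+-monoˡ-≤ n 2≤d))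

  15≤ : ∀ n → 14 ≤ n → 15 ≤ 2 +ℕ n
  15≤ n 14≤n = s≤s (ℕ.m≤n⇒m≤1+n 14≤n)

log-concave-3 : LogConcave (λ n → + p 3 n)
log-concave-3 = log-concave-p 2 (ℕ.≤ᵇ⇒≤ _ _ tt) (ℕ.≤ᵇ⇒≤ _ _ tt) (toWitness {a? = table-concave? 3} tt) λ n 14≤n →
  strict-from-prod 3 (3 +ℕ n) n 14≤n (ℕ.m≤n+m (2 +ℕ n) 2)
    (Three.log-concave (2 +ℕ n) (15≤ n 14≤n) (n ∸ℕ 14) (index 3 n 14≤n (ℕ.≤ᵇ⇒≤ _ _ tt)))

log-concave-4 : LogConcave (λ n → + p 4 n)
log-concave-4 = log-concave-p 3 (ℕ.≤ᵇ⇒≤ _ _ tt) (ℕ.≤ᵇ⇒≤ _ _ tt) (toWitness {a? = table-concave? 4} tt) λ n 14≤n →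
  strict-from-prod 4 (2 +ℕ n) n 14≤n (ℕ.m≤n+m (2 +ℕ n) 1)
    (Four.log-concave (2 +ℕ n) (15≤ n 14≤n) (n ∸ℕ 14) (index 2 n 14≤n (ℕ.≤ᵇ⇒≤ _ _ tt)))

log-concave-5 : LogConcave (λ n → + p 5 n)
log-concave-5 = log-concave-p 4 (ℕ.≤ᵇ⇒≤ _ _ tt) (ℕ.≤ᵇ⇒≤ _ _ tt) (toWitness {a? = table-concave? 5} tt) λ n 14≤n →
  strict-from-prod 5 (2 +ℕ n) n 14≤n (ℕ.m≤n+m (2 +ℕ n) 1)
    (Five.log-concave (2 +ℕ n) (15≤ n 14≤n) (n ∸ℕ 14) (index 2 n 14≤n (ℕ.≤ᵇ⇒≤ _ _ tt)))

log-concave-from-3 : ∀ k → LogConcave (λ n → + p (3 +ℕ k) n)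
log-concave-from-3 0 = log-concave-3
log-concave-from-3 1 = log-concave-4
log-concave-from-3 2 = log-concave-5
log-concave-from-3 (suc (suc (suc k))) = LogConcave-cong (λ n → sym (p-3+ (3 +ℕ k) n)) (LogConcave-conv (log-concave-from-3 k) log-concave-3)

-- Unit transfers and majorization

ratio-strictly-decreasing : ∀ {f} → LogConcave f → ∀ x t → 1 ≤ x → 0ℤ <ℤ f (suc x) * f (suc (t +ℕ x)) - f x * f (2 +ℕ (t +ℕ x))
ratio-strictly-decreasing lf x zero 1≤x = to-pos (LogConcave.strict lf x 1≤x)
ratio-strictly-decreasing {f} lf x (suc t) 1≤x = *-cancel-pos (ℤ.<⇒≤ (pos (suc (t +ℕ x)))) (posit
  (+-pos (*-pos (pos (2 +ℕ (t +ℕ x))) (ratio-strictly-decreasing lf x t 1≤x)) (*-nonneg (ℤ.<⇒≤ (pos x)) (to-nonneg (weak (suc (t +ℕ x))))))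
  (e (f x) (f (suc x)) (f (suc (t +ℕ x))) (f (2 +ℕ (t +ℕ x))) (f (3 +ℕ (t +ℕ x)))))
  where
  open LogConcave lf
  e : ∀ y y' a b c → a * (y' * b - y * c) ≡ b * (y' * a - y * b) + y * (b * b - a * c)
  e = solve-∀

-- Moving a unit from an entry y + 1 to a smaller entry x strictly raises the product; x ≥ 1 keeps
-- clear of the index 0, where strictness fails for k = 3.
unit-transfer : ∀ k x y → 1 ≤ x → x < y → p (3 +ℕ k) x *ℕ p (3 +ℕ k) (suc y) < p (3 +ℕ k) (suc x) *ℕ p (3 +ℕ k) y
unit-transfer k x y 1≤x x<y = ℤ.drop‿+<+ (subst₂ _<ℤ_ (sym (ℤ.pos-* (p (3 +ℕ k) x) (p (3 +ℕ k) (suc y)))) (sym (ℤ.pos-* (p (3 +ℕ k) (suc x)) (p (3 +ℕ k) y)))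
  (from-pos (subst (λ z → 0ℤ <ℤ f (suc x) * f z - f x * f (suc z)) (trans (sym (ℕ.+-suc (y ∸ℕ suc x) x)) (ℕ.m∸n+n≡m x<y))
    (ratio-strictly-decreasing (log-concave-from-3 k) x (y ∸ℕ suc x) 1≤x))))
  where
  f : Series
  f n = + p (3 +ℕ k) n

p>0 : ∀ k n → 0 < p (3 +ℕ k) n
p>0 k n = ℤ.drop‿+<+ (LogConcave.pos (log-concave-from-3 k) n)

-- Every prefix sum of a is at most c plus that of b, with equality for the full sums.

data Dominated : ∀ {r} → ℕ → Vec ℕ r → Vec ℕ r → Set where
  [] : Dominated 0 [] []
  step : ∀ {r c c' x y} {a b : Vec ℕ r} → x +ℕ c' ≡ y +ℕ c → Dominated c' a b → Dominated c (x ∷ a) (y ∷ b)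

dominated : ∀ {r} c (a b : Vec ℕ r) → (∀ ν → psum ν a ≤ psum ν b +ℕ c) → vsum a ≡ vsum b +ℕ c → Dominated c a b
dominated c [] [] _ eq = subst (λ c → Dominated c [] []) eq []
dominated c (x ∷ a) (y ∷ b) h eq = step x+c'≡ (dominated c' a b
    (λ ν → ℕ.+-cancelˡ-≤ x _ _ (subst (x +ℕ psum ν a ≤_) (rearrange (psum ν b)) (h (suc ν))))
    (ℕ.+-cancelˡ-≡ x _ _ (trans eq (rearrange (vsum b)))))
  where
  c' : ℕ
  c' = (y +ℕ c) ∸ℕ x
  x+c'≡ : x +ℕ c' ≡ y +ℕ c
  x+c'≡ = ℕ.m+[n∸m]≡n (subst₂ _≤_ (trans (cong (x +ℕ_) (psum0 a)) (ℕ.+-identityʳ x)) (cong (λ t → t +ℕ c) (trans (cong (y +ℕ_) (psum0 b)) (ℕ.+-identityʳ y))) (h 1))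
    where
    psum0 : ∀ {r} (a : Vec ℕ r) → psum 0 a ≡ 0
    psum0 _ = refl
  e : ∀ y s c → y +ℕ s +ℕ c ≡ y +ℕ c +ℕ s
  e = solve-∀ℕ
  e' : ∀ x c s → x +ℕ c +ℕ s ≡ x +ℕ (s +ℕ c)
  e' = solve-∀ℕ
  rearrange : ∀ s → y +ℕ s +ℕ c ≡ x +ℕ (s +ℕ c')
  rearrange s = trans (e y s c) (trans (cong (_+ℕ s) (sym x+c'≡)) (e' x c' s))

module _ (k : ℕ) where
  private
    f : ℕ → ℕ
    f = p (3 +ℕ k)
    P : ∀ {r} → Vec ℕ r → ℕ
    P = pVec (3 +ℕ k)

  P>0 : ∀ {r} (a : Vec ℕ r) → 0 < P a
  P>0 [] = s≤s z≤n
  P>0 (x ∷ a) = ℕ.*-mono-< (p>0 k x) (P>0 a)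

  -- The search runs along a to the first position where the slack is used up. The entry there
  -- exceeds the entry z of b, hence is y + 1 with y ≥ z ≥ β and can give up a unit; all earlier
  -- slacks are positive and survive the loss. The products are compared crosswise to avoid
  -- division.
  take-unit : ∀ {r c β} {a b : Vec ℕ r} → Dominated (suc c) a b → 1 ≤ β → (∀ i → β ≤ lookup b i) → (∀ i → 1 ≤ lookup a i) →
    Σ (Vec ℕ r) λ a' → Σ ℕ λ y → β ≤ y × Dominated c a' b × (∀ i → 1 ≤ lookup a' i) × P a *ℕ f y ≡ P a' *ℕ f (suc y)
  take-unit {c = c} {β} {x ∷ a} {z ∷ b} (step {c' = zero} eq d) 1≤β β≤b a≥1 =
    (z +ℕ c) ∷ a , z +ℕ c , β≤y , step (ℕ.+-identityʳ _) d , pos , product (x≡ eq)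
    where
    β≤y : β ≤ z +ℕ c
    β≤y = ℕ.≤-trans (β≤b zero) (ℕ.m≤m+n z c)
    pos : ∀ i → 1 ≤ lookup ((z +ℕ c) ∷ a) i
    pos zero = ℕ.≤-trans 1≤β β≤y
    pos (suc i) = a≥1 (suc i)
    x≡ : x +ℕ 0 ≡ z +ℕ suc c → x ≡ suc (z +ℕ c)
    x≡ eq = trans (sym (ℕ.+-identityʳ x)) (trans eq (ℕ.+-suc z c))
    e : ∀ u v w → u *ℕ v *ℕ w ≡ w *ℕ v *ℕ u
    e = solve-∀ℕ
    product : x ≡ suc (z +ℕ c) → f x *ℕ P a *ℕ f (z +ℕ c) ≡ f (z +ℕ c) *ℕ P a *ℕ f (suc (z +ℕ c))
    product refl = e (f (suc (z +ℕ c))) (P a) (f (z +ℕ c))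
  take-unit {c = c} {a = x ∷ a} {z ∷ b} (step {c' = suc c'} eq d) 1≤β β≤b a≥1
    with take-unit d 1≤β (λ i → β≤b (suc i)) (λ i → a≥1 (suc i))
  ... | a' , y , β≤y , d' , a'≥1 , product = x ∷ a' , y , β≤y ,
    step (ℕ.suc-injective (trans (sym (ℕ.+-suc x c')) (trans eq (ℕ.+-suc z c)))) d' , pos ,
    trans (ℕ.*-assoc (f x) (P a) (f y)) (trans (cong (f x *ℕ_) product) (sym (ℕ.*-assoc (f x) (P a') (f (suc y)))))
    where
    pos : ∀ i → 1 ≤ lookup (x ∷ a') i
    pos zero = a≥1 zero
    pos (suc i) = a'≥1 i

  transfer-increases : ∀ {r} x y (a a' : Vec ℕ r) → 1 ≤ x → x < y → P a *ℕ f y ≡ P a' *ℕ f (suc y) → f x *ℕ P a < f (suc x) *ℕ P a'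
  transfer-increases x y a a' 1≤x x<y eq = ℕ.*-cancelʳ-< (f y) _ _ (subst₂ _<_ lhs rhs
    (ℕ.*-monoˡ-< (P a') {{>-nonZero (P>0 a')}} (unit-transfer k x y 1≤x x<y)))
    where
    e₁ : ∀ u v w → u *ℕ v *ℕ w ≡ u *ℕ (w *ℕ v)
    e₁ = solve-∀ℕ
    e₂ : ∀ u v w → u *ℕ v *ℕ w ≡ u *ℕ w *ℕ v
    e₂ = solve-∀ℕ
    lhs : f x *ℕ f (suc y) *ℕ P a' ≡ f x *ℕ P a *ℕ f y
    lhs = trans (e₁ (f x) (f (suc y)) (P a')) (trans (cong (f x *ℕ_) (sym eq)) (sym (ℕ.*-assoc (f x) (P a) (f y))))
    rhs : f (suc x) *ℕ f y *ℕ P a' ≡ f (suc x) *ℕ P a' *ℕ f y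
    rhs = e₂ (f (suc x)) (f y) (P a')

  -- Only b has to be sorted: the transfers turning a into b may destroy the order of a.
  karamata : ∀ {r} (a b : Vec ℕ r) → Dominated 0 a b → (∀ i → 1 ≤ lookup a i) →
    (∀ i j → toℕ i ≤ toℕ j → lookup b i ≤ lookup b j) → a ≡ b ⊎ P a < P b
  karamata [] [] [] _ _ = inj₁ refl
  karamata (x ∷ a) (z ∷ b) (step {c' = c'} eq d) a≥1 sorted = go c' x a (trans eq (ℕ.+-identityʳ z)) d a≥1
    where
    go : ∀ c' x a → x +ℕ c' ≡ z → Dominated c' a b → (∀ i → 1 ≤ lookup (x ∷ a) i) → x ∷ a ≡ z ∷ b ⊎ P (x ∷ a) < P (z ∷ b)
    go zero x a eq d a≥1 with trans (sym (ℕ.+-identityʳ x)) eq | karamata a b d (λ i → a≥1 (suc i)) (λ i j i≤j → sorted (suc i) (suc j) (s≤s i≤j))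
    ... | refl | inj₁ refl = inj₁ refl
    ... | refl | inj₂ lt = inj₂ (ℕ.*-monoʳ-< (f z) {{>-nonZero (p>0 k z)}} lt)
    -- β is the first entry z of b. Since b is sorted, the unit comes from an entry y + 1 with y ≥ z
    -- > x, so the transfer is a strict gain; it also lowers the deficit z - x by one.
    go (suc c') x a eq d a≥1 with take-unit d (ℕ.≤-trans (a≥1 zero) x≤z) (λ i → sorted zero (suc i) z≤n) (λ i → a≥1 (suc i))
      where
      x≤z : x ≤ z
      x≤z = subst (x ≤_) eq (ℕ.m≤m+n x (suc c'))
    ... | a' , y , z≤y , d' , a'≥1 , product = inj₂ (conclude (go c' (suc x) a' (trans (sym (ℕ.+-suc x c')) eq) d' pos))
      where
      pos : ∀ i → 1 ≤ lookup (suc x ∷ a') i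
      pos zero = s≤s z≤n
      pos (suc i) = a'≥1 i
      x<z : x < z
      x<z = subst (suc x ≤_) (trans (sym (ℕ.+-suc x c')) eq) (ℕ.m≤m+n (suc x) c')
      increases : P (x ∷ a) < P (suc x ∷ a')
      increases = transfer-increases x y a a' (a≥1 zero) (ℕ.≤-trans x<z z≤y) product
      conclude : suc x ∷ a' ≡ z ∷ b ⊎ P (suc x ∷ a') < P (z ∷ b) → P (x ∷ a) < P (z ∷ b)
      conclude (inj₁ same) = subst (λ v → P (x ∷ a) < P v) same increases
      conclude (inj₂ lt) = ℕ.<-trans increases lt

psum-all : ∀ {r} (a : Vec ℕ r) ν → r ≤ ν → psum ν a ≡ vsum a
psum-all [] zero _ = refl
psum-all [] (suc ν) _ = refl
psum-all (x ∷ a) (suc ν) (s≤s r≤ν) = cong (x +ℕ_) (psum-all a ν r≤ν)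

theorem1p3 : (n r : ℕ) (a b : Vec ℕ r)
    → IsPartition n r a → IsPartition n r b
    → StrictlyMajorizes b a
    → (k : ℕ) → 3 ≤ k
    → pVec k a < pVec k b
theorem1p3 n r a b (a≥1 , _ , sum-a) (_ , sorted , sum-b) (majorizes , a≢b) (suc (suc (suc k))) (s≤s (s≤s (s≤s z≤n)))
  with karamata k a b (dominated 0 a b prefix (trans sums (sym (ℕ.+-identityʳ (vsum b))))) a≥1 sorted
  where
  sums : vsum a ≡ vsum b
  sums = trans sum-a (sym sum-b)
  prefix : ∀ ν → psum ν a ≤ psum ν b +ℕ 0
  prefix zero = z≤n
  prefix (suc ν) with suc ν ℕ.≤? r ∸ℕ 1
  ... | yes ν≤ = ℕ.≤-trans (majorizes (suc ν) (s≤s z≤n) ν≤) (ℕ.m≤m+n _ 0)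
  -- From r entries on both prefix sums are the full sums, which agree.
  ... | no ν≰ = ℕ.≤-reflexive (trans (psum-all a (suc ν) r≤) (trans sums (trans (sym (psum-all b (suc ν) r≤)) (sym (ℕ.+-identityʳ _)))))
    where
    r≤ : r ≤ suc ν
    r≤ = ℕ.≤-trans (ℕ.m≤n+m∸n r 1) (ℕ.≰⇒> ν≰)
... | inj₁ a≡b = ⊥-elim (a≢b a≡b)
... | inj₂ lt = lt
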